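{- Let $\mathcal{F}$ be an $n\times m$ Ferrers diagram and let $2\le d\le n$ and $1\le k\le|\mathcal{F}|$ be integers with $\kappa(\mathcal{F},d)\ge1$. Then, with limits taken as $q\to+\infty$ over prime powers: (1) if $k\le\tau(\mathcal{F},d-1)$, then $\lim_{q\to+\infty}\delta_q(\mathcal{F},k,d)=1$; (2) if $k\ge\tau(\mathcal{F},d-1)+2$, then $\lim_{q\to+\infty}\delta_q(\mathcal{F},k,d)=0$; (3) if $k=\tau(\mathcal{F},d-1)+1$, then $\limsup_{q\to+\infty}\delta_q(\mathcal{F},k,d)\le 1/2$.
   Context: $q$ denotes a prime power and $\mathbb{F}_q$ the finite field with $q$ elements; $[i]=\{1,\dots,i\}$. An $n\times m$ Ferrers diagram is a subset $\mathcal{F}\subseteq[n]\times[m]$ such that $(1,1),(n,m)\in\mathcal{F}$; if $(i,j)\in\mathcal{F}$ and $j<m$ then $(i,j+1)\in\mathcal{F}$; and if $(i,j)\in\mathcal{F}$ and $i>1$ then $(i-1,j)\in\mathcal{F}$. Let $c_j=|\{i:(i,j)\in\mathcal{F}\}|$. For an integer $d\ge1$ and $0\le j\le d-1$ set $\kappa_j(\mathcal{F},d)=\sum_{t=1}^{m-d+1+j}\max\{c_t-j,0\}$ (an empty sum being $0$) and $\kappa(\mathcal{F},d)=\min_{0\le j\le d-1}\kappa_j(\mathcal{F},d)$. $\mathbb{F}_q[\mathcal{F}]$ is the space of $n\times m$ matrices over $\mathbb{F}_q$ whose entries outside $\mathcal{F}$ are zero; an $[\mathcal{F},d]_q$-space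 is an $\mathbb{F}_q$-linear subspace $\mathcal{C}\le\mathbb{F}_q[\mathcal{F}]$ with $\mathrm{rk}(M)\ge d$ for all nonzero $M\in\mathcal{C}$. With $\binom{a}{b}_q=\prod_{i=0}^{b-1}\frac{q^a-q^i}{q^b-q^i}$ the $q$-binomial coefficient, $\delta_q(\mathcal{F},k,d)$ is the number of $k$-dimensional $[\mathcal{F},d]_q$-spaces divided by $\binom{|\mathcal{F}|}{k}_q$. A non-attacking rook placement is a subset $C\subseteq[n]\times[m]$ with no two elements sharing a row or column index; for such $C\subseteq\mathcal{F}$, $\mathrm{inv}(C,\mathcal{F})$ is the number of $(a,b)\in\mathcal{F}$ such that there is no $(i,j)\in C$ with ($b=j$ and $a\le i$) or ($a=i$ and $b\ge j$). $R_q(\mathcal{F},r)=\sum_C q^{\mathrm{inv}(C,\mathcal{F})}$ over non-attacking rook placements $C\subseteq\mathcal{F}$ with $|C|=r$, and $\tau(\mathcal{F},r)$ is its trailing degree. -}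

module Defs where

open import Data.Nat using (ℕ; zero; suc; _+_; _*_; _∸_; _^_; _≤_; _<_; _⊓_; _≤ᵇ_; _<ᵇ_; _≡ᵇ_; ∣_-_∣)
open import Data.Bool using (Bool; true; false; if_then_else_; T; _∧_; _∨_; not)
open import Data.Fin using (Fin; toℕ) renaming (zero to fzero; suc to fsuc)
open import Data.List using (List; []; _∷_; length; map; foldr; upTo; allFin)
open import Data.Nat.ListAction using (sum; product)
open import Data.Bool.ListAction using (any)
open import Data.List.Membership.Propositional using (_∈_)
open import Data.List.Relation.Unary.All using (All)
open import Data.List.Relation.Unary.Any using (Any)
open import Data.List.Relation.Unary.AllPairs using (AllPairs)
open import Data.List.Relation.Unary.Unique.Propositional using (Unique)
open import Data.Product using (Σ; ∃; _×_; _,_; proj₁; proj₂)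
open import Relation.Binary.PropositionalEquality using (_≡_; _≢_)
open import Relation.Binary.Definitions using (DecidableEquality)
open import Relation.Nullary using (¬_)
open import Algebra.Core using (Op₁; Op₂)
open import Algebra.Structures using (IsCommutativeRing)

record FiniteField (q : ℕ) : Set₁ where
  field
    Carrier   : Set
    _+ᶠ_      : Op₂ Carrier
    _*ᶠ_      : Op₂ Carrier
    -ᶠ_       : Op₁ Carrier
    0ᶠ        : Carrier
    1ᶠ        : Carrier
    isCommutativeRing : IsCommutativeRing _≡_ _+ᶠ_ _*ᶠ_ -ᶠ_ 0ᶠ 1ᶠ
    0≢1       : 0ᶠ ≢ 1ᶠ
    inverse   : ∀ x → x ≢ 0ᶠ → ∃ λ y → x *ᶠ y ≡ 1ᶠ
    _≟_       : DecidableEquality Carrier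
    elements  : List Carrier
    elements-unique   : Unique elements
    elements-complete : ∀ x → x ∈ elements
    elements-length   : length elements ≡ q

-- Ferrers diagrams (0-based indices: row i ∈ Fin n stands for row i+1).

record Ferrers (n m : ℕ) : Set where
  field
    cell     : Fin n → Fin m → Bool
    topLeft  : Σ (Fin n) λ i → Σ (Fin m) λ j → toℕ i ≡ 0 × toℕ j ≡ 0 × T (cell i j)
    botRight : Σ (Fin n) λ i → Σ (Fin m) λ j → suc (toℕ i) ≡ n × suc (toℕ j) ≡ m × T (cell i j)
    rightClosed : ∀ i j j′ → toℕ j′ ≡ suc (toℕ j) → T (cell i j) → T (cell i j′)
    upClosed    : ∀ i i′ j → suc (toℕ i′) ≡ toℕ i → T (cell i j) → T (cell i′ j)

open Ferrers public

module _ {n m : ℕ} (F : Ferrers n m) where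

  private
    ind : Bool → ℕ
    ind b = if b then 1 else 0

  card : ℕ
  card = sum (map (λ i → sum (map (λ j → ind (cell F i j)) (allFin m))) (allFin n))

  colHeight : Fin m → ℕ
  colHeight t = sum (map (λ i → ind (cell F i t)) (allFin n))

  -- κ_j(F,d) = Σ_{t=1}^{m-d+1+j} max{c_t - j, 0}  (max{c-j,0} = c ∸ j; empty sum = 0)
  kappaJ : ℕ → ℕ → ℕ
  kappaJ d j = sum (map (λ t → if toℕ t <ᵇ ((m + 1 + j) ∸ d) then colHeight t ∸ j else 0) (allFin m))

  kappa : ℕ → ℕ
  kappa d = foldr _⊓_ (kappaJ d 0) (map (kappaJ d) (upTo d))

  -- Non-attacking rook placements C ⊆ F with |C| = r, given as an
  -- injective enumeration of their r cells (rows pairwise distinct,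
  -- columns pairwise distinct).

  record RookPlacement (r : ℕ) : Set where
    field
      pos    : Fin r → Fin n × Fin m
      rowInj : ∀ a b → proj₁ (pos a) ≡ proj₁ (pos b) → a ≡ b
      colInj : ∀ a b → proj₂ (pos a) ≡ proj₂ (pos b) → a ≡ b
      inF    : ∀ a → T (cell F (proj₁ (pos a)) (proj₂ (pos a)))

  inv : ∀ {r} → RookPlacement r → ℕ
  inv {r} C = sum (map (λ a → sum (map (λ b →
                 ind (cell F a b ∧ not (covered a b))) (allFin m))) (allFin n))
    where
      open RookPlacement C
      covered : Fin n → Fin m → Bool
      covered a b = any (λ c →
          ((toℕ b ≡ᵇ toℕ (proj₂ (pos c))) ∧ (toℕ a ≤ᵇ toℕ (proj₁ (pos c))))
        ∨ ((toℕ a ≡ᵇ toℕ (proj₁ (pos c))) ∧ (toℕ (proj₂ (pos c)) ≤ᵇ toℕ b))) (allFin r)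

  -- t = τ(F,r), the trailing degree of R_q(F,r) = Σ_C q^{inv(C,F)}:
  -- the coefficient of q^t (= #{C : inv C = t}) is nonzero and every
  -- monomial has degree ≥ t (all coefficients are non-negative).
  IsTrailingDegree : ℕ → ℕ → Set
  IsTrailingDegree r t = (Σ (RookPlacement r) λ C → inv C ≡ t)
                       × (∀ (C : RookPlacement r) → t ≤ inv C)

module _ {q : ℕ} (K : FiniteField q) where
  open FiniteField K

  Σᶠ : ∀ {k} → (Fin k → Carrier) → Carrier
  Σᶠ {zero}  f = 0ᶠ
  Σᶠ {suc k} f = f fzero +ᶠ Σᶠ (λ l → f (fsuc l))

  LinIndepVecs : ∀ {m r} → (Fin r → Fin m → Carrier) → Set
  LinIndepVecs {m} {r} v =
    ∀ (c : Fin r → Carrier) → (∀ j → Σᶠ (λ l → c l *ᶠ v l j) ≡ 0ᶠ) → ∀ l → c l ≡ 0ᶠ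

  Mat : ℕ → ℕ → Set
  Mat n m = Fin n → Fin m → Carrier

  IsZeroMat : ∀ {n m} → Mat n m → Set
  IsZeroMat M = ∀ i j → M i j ≡ 0ᶠ

  IsRank : ∀ {n m} → Mat n m → ℕ → Set
  IsRank {n} M r = (Σ (Fin r → Fin n) λ ρ → LinIndepVecs (λ l → M (ρ l)))
                 × (∀ (ρ : Fin (suc r) → Fin n) → ¬ LinIndepVecs (λ l → M (ρ l)))

  RankAtLeast : ∀ {n m} → Mat n m → ℕ → Set
  RankAtLeast M d = Σ ℕ λ r → IsRank M r × d ≤ r

  LinIndepMats : ∀ {n m k} → (Fin k → Mat n m) → Set
  LinIndepMats {k = k} b =
    ∀ (c : Fin k → Carrier) → (∀ i j → Σᶠ (λ l → c l *ᶠ b l i j) ≡ 0ᶠ) → ∀ l → c l ≡ 0ᶠ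

  module _ {n m : ℕ} (F : Ferrers n m) where

    InFq[F] : Mat n m → Set
    InFq[F] M = ∀ i j → cell F i j ≡ false → M i j ≡ 0ᶠ

    SubsetMat : Set
    SubsetMat = Mat n m → Bool

    _≈ˢ_ : SubsetMat → SubsetMat → Set
    S ≈ˢ S′ = ∀ M → S M ≡ S′ M

    record IsSubspace (S : SubsetMat) : Set where
      field
        respects : ∀ M M′ → (∀ i j → M i j ≡ M′ i j) → S M ≡ S M′
        inside   : ∀ M → T (S M) → InFq[F] M
        hasZero  : T (S (λ _ _ → 0ᶠ))
        addClosed : ∀ M M′ → T (S M) → T (S M′) → T (S (λ i j → M i j +ᶠ M′ i j))
        scalClosed : ∀ a M → T (S M) → T (S (λ i j → a *ᶠ M i j))

    HasDim : SubsetMat → ℕ → Set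
    HasDim S k = Σ (Fin k → Mat n m) λ b →
                   (∀ l → T (S (b l)))
                 × LinIndepMats b
                 × (∀ M → T (S M) → Σ (Fin k → Carrier) λ c →
                        ∀ i j → M i j ≡ Σᶠ (λ l → c l *ᶠ b l i j))

    IsFdSpace : ℕ → ℕ → SubsetMat → Set
    IsFdSpace k d S = IsSubspace S × HasDim S k
                    × (∀ M → T (S M) → ¬ IsZeroMat M → RankAtLeast M d)

CountedBy : {A : Set} → (A → A → Set) → (A → Set) → ℕ → Set
CountedBy {A} _≈_ P N = Σ (List A) λ L →
    length L ≡ N
  × All P L
  × AllPairs (λ x y → ¬ (x ≈ y)) L
  × (∀ x → P x → Any (x ≈_) L)

NumFdSpaces : ∀ {q n m} → FiniteField q → Ferrers n m → ℕ → ℕ → ℕ → Set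
NumFdSpaces K F k d N = CountedBy (_≈ˢ_ K F) (IsFdSpace K F k d) N

-- q-binomial [a choose b]_q = qbinNum q a b / qbinDen q a b
qbinNum : ℕ → ℕ → ℕ → ℕ
qbinNum q a b = product (map (λ i → q ^ a ∸ q ^ i) (upTo b))

qbinDen : ℕ → ℕ → ℕ → ℕ
qbinDen q a b = product (map (λ i → q ^ b ∸ q ^ i) (upTo b))

-- δ = N / [a choose k]_q = (N · qbinDen) / qbinNum.  ε = e₁/e₂.
-- |δ - 1| ≤ ε
DensityNear1 : (q a k N e₁ e₂ : ℕ) → Set
DensityNear1 q a k N e₁ e₂ = ∣ N * qbinDen q a k - qbinNum q a k ∣ * e₂ ≤ e₁ * qbinNum q a k

DensityAtMost : (q a k N e₁ e₂ : ℕ) → Set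
DensityAtMost q a k N e₁ e₂ = N * qbinDen q a k * e₂ ≤ e₁ * qbinNum q a k

DensityAtMostHalfPlus : (q a k N e₁ e₂ : ℕ) → Set
DensityAtMostHalfPlus q a k N e₁ e₂ = 2 * e₂ * (N * qbinDen q a k) ≤ (e₂ + 2 * e₁) * qbinNum q a k

-- Eventually in q over finite fields (i.e. over prime powers q → ∞):
-- for every ε = e₁/e₂ > 0 there is Q such that for every q ≥ Q, every
-- field K with q elements, and N = #{k-dim [F,d]_q-spaces}, the bound holds.
EventuallyDensity : ∀ {n m} → Ferrers n m → ℕ → ℕ → (ℕ → ℕ → ℕ → ℕ → ℕ → ℕ → Set) → Set₁
EventuallyDensity F k d Bound =
  ∀ (e₁ e₂ : ℕ) → 1 ≤ e₁ → 1 ≤ e₂ →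
  Σ ℕ λ Q → ∀ (q : ℕ) → Q ≤ q → (K : FiniteField q) → ∀ (N : ℕ) →
    NumFdSpaces K F k d N → Bound q (card F) k N e₁ e₂

{-# OPTIONS --safe #-}

-- Encode a k-dimensional space by its ordered bases: up to factors 1 + O(1/q), the
-- density is the probability that a uniformly random k-tuple b in F_q[F] is good,
-- i.e. that no nonzero combination of b has rank < d.  Each fixed nonzero
-- combination of b is uniform on F_q[F], so if v = |F_q[F]| and ℓ is the number of
-- its matrices of rank < d,
--   * P(b not good) ≤ (k q^(k-1)) ℓ / v by the union bound over the nonzero
--     coefficient vectors up to scaling;
--   * P(b good) ≤ 1 / (1 + E) with E = q^(k-1) ℓ / v by the second moment method for
--     the combinations with first coefficient 1, which are pairwise independent.
-- Gaussian elimination on the first column, whose pivot plays the role of a rook,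
-- shows that ℓ / v is at least q^(-τ) (1 - O(1/q)) and at most a constant times
-- q^(-τ).

module Submission where

open import Defs
open import Algebra.Bundles using (Group)
import Algebra.Properties.Group
open import Algebra.Structures using (IsCommutativeRing; IsAbelianGroup)
open import Data.Bool using (Bool; true; false; if_then_else_; T; T?; _∧_; _∨_; not)
open import Data.Bool.ListAction using (any)
open import Data.Bool.Properties using (T-∧; T-∨; T-≡)
open import Data.Empty using (⊥; ⊥-elim)
open import Data.Fin using (Fin; toℕ; fromℕ<) renaming (zero to fzero; suc to fsuc)
import Data.Fin.Properties as Fin
open import Data.Fin.Properties using (toℕ-injective; toℕ<n; suc-injective; any?; toℕ-fromℕ<)
open import Data.List as List using (List; []; _∷_; map; foldr; length; _++_; filter; concatMap; cartesianProduct; cartesianProductWith; allFin; upTo)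
open import Data.List.Membership.Propositional using (_∈_; lose; find)
open import Data.List.Membership.Propositional.Properties
open import Data.List.Membership.Propositional.Properties.WithK using (unique∧set⇒bag)
open import Data.List.Properties using (length-++; length-map; length-filter; length-tabulate; length-upTo; map-tabulate)
open import Data.List.Relation.Binary.BagAndSetEquality using (∼bag⇒↭)
open import Data.List.Relation.Binary.Permutation.Propositional as ↭ using (_↭_)
open import Data.List.Relation.Unary.All as All using (All; []; _∷_)
open import Data.List.Relation.Unary.AllPairs using (AllPairs; []; _∷_)
open import Data.List.Relation.Unary.Any as Any using (here; there)
open import Data.List.Relation.Unary.Any.Properties using (any⁺; any⁻)
open import Data.List.Relation.Unary.Unique.Propositional using (Unique)
import Data.List.Relation.Unary.Unique.Propositional.Properties as Unique
open import Data.Maybe using (Maybe; just; nothing)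
open import Data.Maybe.Properties using (just-injective)
open import Data.Nat hiding (_≟_)
open import Data.Nat.ListAction using (sum; product)
open import Data.Nat.Properties hiding (_≟_; suc-injective)
import Data.Nat.Tactic.RingSolver as ℕR
open import Data.Product using (Σ; ∃; _×_; _,_; proj₁; proj₂; map₂)
open import Data.Sum using (_⊎_; inj₁; inj₂; [_,_]′)
open import Data.Unit using (tt)
open import Data.Vec as Vec using (Vec; []; _∷_; lookup; replicate; zipWith; tabulate; _[_]≔_)
import Data.Vec.Properties as Vec
open import Function using (_∘_; id; _⇔_; mk⇔; Equivalence)
open import Relation.Binary.Definitions using (DecidableEquality)
open import Relation.Binary.PropositionalEquality as ≡ using (_≡_; _≢_; refl; cong; cong₂; sym; subst; subst₂)
open import Relation.Nullary using (¬_; Dec; yes; no; does; contradiction)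
open import Relation.Nullary.Decidable using (map′; ¬?; _→-dec_; _×-dec_; _⊎-dec_; ⌊_⌋; toWitness; fromWitness)

-- Finite sums and counting

-- The three cases reflect the size of E, which is q^(k-1-τ) up to constant factors. For k ≤ τ the
-- union bound loses only O(1/q); for k = τ + 1 the lower bound on ℓ / v gives E ≥ 1 - O(1/q), hence
-- 1 / (1 + E) ≤ 1/2 + O(1/q); for k ≥ τ + 2 it gives E at least of order q. That elimination and
-- rooks lead to the same exponent is a parameter count. A zero first column of height h costs a
-- factor q^h. A pivot costs only a constant: its entry, the rest of its column and the multipliers
-- of the later columns are free, while the rank left over and every later height drop by one. The
-- fewest uncovered cells obey the same recursion: a skipped column leaves h cells, a rook in the
-- lowest cell leaves none. κ ≥ 1 makes the last d columns tall enough for a placement to attain the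
-- value of the recursion. The ordered bases of a space are not counted exactly either: the union
-- bound for coefficient vectors, with "zero" in place of "of low rank", is precise enough.
-- Denominators are cleared throughout, so all estimates stay in ℕ.

private
  variable
    X Y Z : Set

∑ : List X → (X → ℕ) → ℕ
∑ []       f = 0
∑ (x ∷ xs) f = f x + ∑ xs f

∑-mono : (xs : List X) {f g : X → ℕ} → (∀ x → x ∈ xs → f x ≤ g x) → ∑ xs f ≤ ∑ xs g
∑-mono []       h = z≤n
∑-mono (x ∷ xs) h = +-mono-≤ (h x (here refl)) (∑-mono xs (λ y y∈ → h y (there y∈)))

∑-cong : (xs : List X) {f g : X → ℕ} → (∀ x → x ∈ xs → f x ≡ g x) → ∑ xs f ≡ ∑ xs g
∑-cong []       h = refl
∑-cong (x ∷ xs) h = cong₂ _+_ (h x (here refl)) (∑-cong xs (λ y y∈ → h y (there y∈)))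

∑-+ : (xs : List X) (f g : X → ℕ) → ∑ xs (λ x → f x + g x) ≡ ∑ xs f + ∑ xs g
∑-+ []       f g = refl
∑-+ (x ∷ xs) f g rewrite ∑-+ xs f g = lem (f x) (g x) (∑ xs f) (∑ xs g)
  where
  lem : ∀ a b c d → a + b + (c + d) ≡ a + c + (b + d)
  lem = ℕR.solve-∀

∑-* : (xs : List X) (c : ℕ) (f : X → ℕ) → ∑ xs (λ x → c * f x) ≡ c * ∑ xs f
∑-* []       c f = sym (*-zeroʳ c)
∑-* (x ∷ xs) c f = ≡.trans (cong (c * f x +_) (∑-* xs c f)) (sym (*-distribˡ-+ c (f x) (∑ xs f)))

∑-*ʳ : (xs : List X) (c : ℕ) (f : X → ℕ) → ∑ xs (λ x → f x * c) ≡ ∑ xs f * c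
∑-*ʳ []       c f = refl
∑-*ʳ (x ∷ xs) c f = ≡.trans (cong (f x * c +_) (∑-*ʳ xs c f)) (sym (*-distribʳ-+ c (f x) (∑ xs f)))

∑-const : (xs : List X) (c : ℕ) → ∑ xs (λ _ → c) ≡ length xs * c
∑-const []       c = refl
∑-const (x ∷ xs) c = cong (c +_) (∑-const xs c)

∑-swap : (xs : List X) (ys : List Y) (f : X → Y → ℕ) →
  ∑ xs (λ x → ∑ ys (f x)) ≡ ∑ ys (λ y → ∑ xs (λ x → f x y))
∑-swap []       ys f = sym (≡.trans (∑-const ys 0) (*-zeroʳ (length ys)))
∑-swap (x ∷ xs) ys f = ≡.trans (cong (∑ ys (f x) +_) (∑-swap xs ys f)) (sym (∑-+ ys (f x) _))

∑-++ : (xs ys : List X) (f : X → ℕ) → ∑ (xs ++ ys) f ≡ ∑ xs f + ∑ ys f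
∑-++ []       ys f = refl
∑-++ (x ∷ xs) ys f = ≡.trans (cong (f x +_) (∑-++ xs ys f)) (sym (+-assoc (f x) _ _))

∑-map : (g : X → Y) (xs : List X) (f : Y → ℕ) → ∑ (map g xs) f ≡ ∑ xs (f ∘ g)
∑-map g []       f = refl
∑-map g (x ∷ xs) f = cong (f (g x) +_) (∑-map g xs f)

∑-cartesian : (g : X → Y → Z) (xs : List X) (ys : List Y) (f : Z → ℕ) →
  ∑ (cartesianProductWith g xs ys) f ≡ ∑ xs (λ x → ∑ ys (λ y → f (g x y)))
∑-cartesian g []       ys f = refl
∑-cartesian g (x ∷ xs) ys f =
  ≡.trans (∑-++ (map (g x) ys) _ f) (cong₂ _+_ (∑-map (g x) ys f) (∑-cartesian g xs ys f))

∑-↭ : {xs ys : List X} (f : X → ℕ) → xs ↭ ys → ∑ xs f ≡ ∑ ys f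
∑-↭ f ↭.refl         = refl
∑-↭ f (↭.prep x p)   = cong (f x +_) (∑-↭ f p)
∑-↭ f (↭.swap x y p) = ≡.trans (cong (λ s → f x + (f y + s)) (∑-↭ f p)) (lem (f x) (f y) _)
  where
  lem : ∀ a b c → a + (b + c) ≡ b + (a + c)
  lem = ℕR.solve-∀
∑-↭ f (↭.trans p r)  = ≡.trans (∑-↭ f p) (∑-↭ f r)

∑-single : {xs : List X} {x : X} (f : X → ℕ) → x ∈ xs → f x ≤ ∑ xs f
∑-single f (here refl) = m≤m+n _ _
∑-single f (there {x = y} p) = ≤-trans (∑-single f p) (m≤n+m _ (f y))

length-∑ : (xs : List X) → length xs ≡ ∑ xs (λ _ → 1)
length-∑ []       = refl
length-∑ (x ∷ xs) = cong suc (length-∑ xs)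

length-cartesian : (g : X → Y → Z) (xs : List X) (ys : List Y) →
  length (cartesianProductWith g xs ys) ≡ length xs * length ys
length-cartesian g []       ys = refl
length-cartesian g (x ∷ xs) ys =
  ≡.trans (length-++ (map (g x) ys)) (cong₂ _+_ (length-map (g x) ys) (length-cartesian g xs ys))

length-concatMap : (g : X → List Y) (xs : List X) → length (concatMap g xs) ≡ ∑ xs (length ∘ g)
length-concatMap g []       = refl
length-concatMap g (x ∷ xs) = ≡.trans (length-++ (g x)) (cong (length (g x) +_) (length-concatMap g xs))

⟦_⟧ : {P : Set} → Dec P → ℕ
⟦ yes _ ⟧ = 1
⟦ no _ ⟧  = 0

⟦⟧-yes : {P : Set} (p? : Dec P) → P → ⟦ p? ⟧ ≡ 1
⟦⟧-yes (yes _) p = refl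
⟦⟧-yes (no ¬p) p = contradiction p ¬p

⟦⟧-no : {P : Set} (p? : Dec P) → ¬ P → ⟦ p? ⟧ ≡ 0
⟦⟧-no (yes p) ¬p = contradiction p ¬p
⟦⟧-no (no _)  ¬p = refl

⟦⟧-mono : {P Q : Set} (p? : Dec P) (q? : Dec Q) → (P → Q) → ⟦ p? ⟧ ≤ ⟦ q? ⟧
⟦⟧-mono (yes p) q? f rewrite ⟦⟧-yes q? (f p) = ≤-refl
⟦⟧-mono (no _)  q? f = z≤n

⟦⟧-cong : {P Q : Set} (p? : Dec P) (q? : Dec Q) → (P → Q) → (Q → P) → ⟦ p? ⟧ ≡ ⟦ q? ⟧
⟦⟧-cong p? q? f g = ≤-antisym (⟦⟧-mono p? q? f) (⟦⟧-mono q? p? g)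

⟦⟧≤1 : {P : Set} (p? : Dec P) → ⟦ p? ⟧ ≤ 1
⟦⟧≤1 (yes _) = ≤-refl
⟦⟧≤1 (no _)  = z≤n

∑-filter : {P : X → Set} (P? : ∀ x → Dec (P x)) (xs : List X) →
  length (filter P? xs) ≡ ∑ xs (λ x → ⟦ P? x ⟧)
∑-filter P? [] = refl
∑-filter P? (x ∷ xs) with P? x
... | yes _ = cong suc (∑-filter P? xs)
... | no _  = ∑-filter P? xs

unique-↭ : {xs ys : List X} → Unique xs → Unique ys →
  (∀ {x} → x ∈ xs → x ∈ ys) → (∀ {x} → x ∈ ys → x ∈ xs) → xs ↭ ys
unique-↭ ux uy f g = ∼bag⇒↭ (unique∧set⇒bag ux uy (mk⇔ f g))

private
  remove : {x : X} (ys : List X) → x ∈ ys → List X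
  remove (y ∷ ys) (here _)  = ys
  remove (y ∷ ys) (there p) = y ∷ remove ys p

  length-remove : {x : X} {ys : List X} (p : x ∈ ys) → suc (length (remove ys p)) ≡ length ys
  length-remove (here _)  = refl
  length-remove (there p) = cong suc (length-remove p)

  ∈-remove : {x z : X} {ys : List X} (p : x ∈ ys) → z ∈ ys → z ≢ x → z ∈ remove ys p
  ∈-remove (here refl) (here refl) ne = contradiction refl ne
  ∈-remove (here _)      (there r)     ne = r
  ∈-remove (there p)     (here e)      ne = here e
  ∈-remove (there p)     (there r)     ne = there (∈-remove p r ne)

unique-length≤ : {xs ys : List X} → Unique xs → (∀ {x} → x ∈ xs → x ∈ ys) → length xs ≤ length ys
unique-length≤ []       h = z≤n
unique-length≤ {xs = x ∷ xs} {ys} (x∉ ∷ u) h =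
  ≤-trans (s≤s (unique-length≤ u (λ {z} z∈ → ∈-remove (h (here refl)) (h (there z∈))
                                               (λ e → All.lookup x∉ z∈ (sym e)))))
          (≤-reflexive (length-remove (h (here refl))))

-- If some `y` were missed, `y ∷ xs` would be a list without repetitions inside `ys`, yet longer
-- than `ys`.
unique-surjective : (_≟_ : ∀ (x y : X) → Dec (x ≡ y)) {xs ys : List X} → Unique xs →
  (∀ {x} → x ∈ xs → x ∈ ys) → length ys ≤ length xs → ∀ {y} → y ∈ ys → y ∈ xs
unique-surjective {X = X} _≟_ {xs} {ys} u h le {y} y∈ with y ∈? xs
  where open import Data.List.Membership.DecPropositional _≟_ using (_∈?_)
... | yes p = p
... | no ¬p = contradiction le (<⇒≱ (unique-length≤ {xs = y ∷ xs} (All.tabulate (λ z∈ e → ¬p (subst (_∈ xs) (sym e) z∈)) ∷ u) sub))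
  where
  sub : ∀ {z} → z ∈ y ∷ xs → z ∈ ys
  sub (here refl) = y∈
  sub (there r)     = h r

unique-map : {f : X → Y} {xs : List X} → Unique xs →
  (∀ {x y} → x ∈ xs → y ∈ xs → f x ≡ f y → x ≡ y) → Unique (map f xs)
unique-map [] inj = []
unique-map {f = f} {x ∷ xs} (x∉ ∷ u) inj =
  All.tabulate (λ z∈ e → let (y , y∈ , e′) = ∈-map⁻ f z∈ in
     All.lookup x∉ y∈ (inj (here refl) (there y∈) (≡.trans e e′)))
  ∷ unique-map u (λ p r → inj (there p) (there r))

count-injection : {P : X → Set} {Q : Y → Set} (P? : ∀ x → Dec (P x)) (Q? : ∀ y → Dec (Q y))
  {xs : List X} {ys : List Y} → Unique xs → (f : X → Y) →
  (∀ {x y} → x ∈ xs → y ∈ xs → f x ≡ f y → x ≡ y) →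
  (∀ {x} → x ∈ xs → P x → f x ∈ ys × Q (f x)) →
  ∑ xs (λ x → ⟦ P? x ⟧) ≤ ∑ ys (λ y → ⟦ Q? y ⟧)
count-injection P? Q? {xs} {ys} u f inj h = begin
  ∑ xs (λ x → ⟦ P? x ⟧)            ≡⟨ ∑-filter P? xs ⟨
  length (filter P? xs)            ≡⟨ length-map f (filter P? xs) ⟨
  length (map f (filter P? xs))    ≤⟨ unique-length≤ (unique-map (Unique.filter⁺ P? u)
                                        (λ p r → inj (proj₁ (∈-filter⁻ P? p)) (proj₁ (∈-filter⁻ P? r)))) sub ⟩
  length (filter Q? ys)            ≡⟨ ∑-filter Q? ys ⟩
  ∑ ys (λ y → ⟦ Q? y ⟧)            ∎
  where
  open ≤-Reasoning
  sub : ∀ {y} → y ∈ map f (filter P? xs) → y ∈ filter Q? ys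
  sub y∈ with ∈-map⁻ f y∈
  ... | x , x∈ , refl with ∈-filter⁻ P? x∈
  ... | x∈′ , px with h x∈′ px
  ... | fx∈ , qx = ∈-filter⁺ Q? fx∈ qx

-- `R` stands in for equality: the main use is for subspaces given as Boolean functions, which a
-- list keeps apart only up to `_≈ˢ_`.
count≤1 : {P Q : X → Set} {R : X → X → Set} (P? : ∀ x → Dec (P x)) (xs : List X) →
  All Q xs → AllPairs (λ x y → ¬ R x y) xs → (∀ {x y} → Q x → Q y → P x → P y → R x y) →
  ∑ xs (λ x → ⟦ P? x ⟧) ≤ 1
count≤1 P? [] _ _ h = z≤n
count≤1 {P = P} {Q} P? (x ∷ xs) (qx ∷ qs) (ne ∷ ap) h with P? x
... | no _   = count≤1 P? xs qs ap h
... | yes px = s≤s (≤-reflexive (≡.trans (∑-cong xs none) (≡.trans (∑-const xs 0) (*-zeroʳ (length xs)))))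
  where
  none : ∀ y → y ∈ xs → ⟦ P? y ⟧ ≡ 0
  none y y∈ = ⟦⟧-no (P? y) (λ py → All.lookup ne y∈ (h qx (All.lookup qs y∈) px py))

-- With a separate list for each coordinate, one construction yields the columns supported on a set
-- of rows, the matrices supported on a board and, for a constant list, the tuples.
vecs : (k : ℕ) → (Fin k → List X) → List (Vec X k)
vecs zero    cs = [] ∷ []
vecs (suc k) cs = cartesianProductWith _∷_ (cs fzero) (vecs k (cs ∘ fsuc))

vecs-unique : (k : ℕ) {cs : Fin k → List X} → (∀ i → Unique (cs i)) → Unique (vecs k cs)
vecs-unique zero    u = [] ∷ []
vecs-unique (suc k) u = Unique.cartesianProductWith⁺ _∷_ Vec.∷-injective (u fzero) (vecs-unique k (u ∘ fsuc))

∈-vecs⁺ : (k : ℕ) {cs : Fin k → List X} {v : Vec X k} → (∀ i → lookup v i ∈ cs i) → v ∈ vecs k cs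
∈-vecs⁺ zero    {v = []}    h = here refl
∈-vecs⁺ (suc k) {v = x ∷ v} h = ∈-cartesianProductWith⁺ _∷_ (h fzero) (∈-vecs⁺ k (h ∘ fsuc))

∈-vecs⁻ : (k : ℕ) {cs : Fin k → List X} {v : Vec X k} → v ∈ vecs k cs → ∀ i → lookup v i ∈ cs i
∈-vecs⁻ (suc k) {cs} {v} v∈ i with ∈-cartesianProductWith⁻ _∷_ (cs fzero) (vecs k (cs ∘ fsuc)) v∈
∈-vecs⁻ (suc k) v∈ fzero    | x , w , x∈ , w∈ , refl = x∈
∈-vecs⁻ (suc k) v∈ (fsuc i) | x , w , x∈ , w∈ , refl = ∈-vecs⁻ k w∈ i

ΣN : {n : ℕ} → (Fin n → ℕ) → ℕ
ΣN {zero}  f = 0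
ΣN {suc n} f = f fzero + ΣN (f ∘ fsuc)

length-vecs : (q k : ℕ) {cs : Fin k → List X} (e : Fin k → ℕ) →
  (∀ i → length (cs i) ≡ q ^ e i) → length (vecs k cs) ≡ q ^ ΣN e
length-vecs q zero    e h = refl
length-vecs q (suc k) {cs} e h = begin
  length (vecs (suc k) cs)                         ≡⟨ length-cartesian _∷_ (cs fzero) _ ⟩
  length (cs fzero) * length (vecs k (cs ∘ fsuc))  ≡⟨ cong₂ _*_ (h fzero) (length-vecs q k (e ∘ fsuc) (h ∘ fsuc)) ⟩
  q ^ e fzero * q ^ ΣN (e ∘ fsuc)                  ≡⟨ ^-distribˡ-+-* q (e fzero) _ ⟨
  q ^ ΣN e                                         ∎
  where open ≡.≡-Reasoning

tuples : List X → (k : ℕ) → List (Vec X k)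
tuples U k = vecs k (λ _ → U)

length-tuples : (U : List X) (k : ℕ) → length (tuples U k) ≡ length U ^ k
length-tuples U zero    = refl
length-tuples U (suc k) = ≡.trans (length-cartesian _∷_ U _) (cong (length U *_) (length-tuples U k))

sum-allFin : ∀ {n} (f : Fin n → ℕ) → sum (map f (allFin n)) ≡ ΣN f
sum-allFin {n} f = ≡.trans (cong sum (map-tabulate (λ i → i) f)) (go f)
  where
  go : ∀ {n} (f : Fin n → ℕ) → sum (List.tabulate f) ≡ ΣN f
  go {zero}  f = refl
  go {suc n} f = cong (f fzero +_) (go (f ∘ fsuc))

ΣN-cong : ∀ {n} {f g : Fin n → ℕ} → (∀ i → f i ≡ g i) → ΣN f ≡ ΣN g
ΣN-cong {zero}  h = refl
ΣN-cong {suc n} h = cong₂ _+_ (h fzero) (ΣN-cong (h ∘ fsuc))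

ΣN-mono : ∀ {n} {f g : Fin n → ℕ} → (∀ i → f i ≤ g i) → ΣN f ≤ ΣN g
ΣN-mono {zero}  h = z≤n
ΣN-mono {suc n} h = +-mono-≤ (h fzero) (ΣN-mono (h ∘ fsuc))

ΣN-const : ∀ n (c : ℕ) → ΣN {n} (λ _ → c) ≡ n * c
ΣN-const zero    c = refl
ΣN-const (suc n) c = cong (c +_) (ΣN-const n c)

ΣN-+ : ∀ {n} (f g : Fin n → ℕ) → ΣN (λ i → f i + g i) ≡ ΣN f + ΣN g
ΣN-+ {zero}  f g = refl
ΣN-+ {suc n} f g rewrite ΣN-+ (f ∘ fsuc) (g ∘ fsuc) = lem (f fzero) (g fzero) (ΣN (f ∘ fsuc)) (ΣN (g ∘ fsuc))
  where
  lem : ∀ a b c d → a + b + (c + d) ≡ a + c + (b + d)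
  lem = ℕR.solve-∀

ΣN-swap : ∀ {n m} (f : Fin n → Fin m → ℕ) → ΣN (λ i → ΣN (f i)) ≡ ΣN (λ j → ΣN (λ i → f i j))
ΣN-swap {zero}  {m} f = sym (≡.trans (ΣN-const m 0) (*-zeroʳ m))
ΣN-swap {suc n} f = ≡.trans (cong (ΣN (f fzero) +_) (ΣN-swap (f ∘ fsuc))) (sym (ΣN-+ (f fzero) _))

ΣN-single : ∀ {n} (f : Fin n → ℕ) (i : Fin n) → f i ≤ ΣN f
ΣN-single f fzero    = m≤m+n _ _
ΣN-single f (fsuc i) = ≤-trans (ΣN-single (f ∘ fsuc) i) (m≤n+m _ (f fzero))

-- The trailing degree as a recursion on the columns

ind : Bool → ℕ
ind b = if b then 1 else 0

ind-mono : ∀ x y → (T x → T y) → ind x ≤ ind y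
ind-mono false y     f = z≤n
ind-mono true  true  f = ≤-refl
ind-mono true  false f = ⊥-elim (f tt)

ind-cong : ∀ x y → (T x → T y) → (T y → T x) → ind x ≡ ind y
ind-cong x y f g = ≤-antisym (ind-mono x y f) (ind-mono y x g)

T-not : ∀ {b} → ¬ T b → T (not b)
T-not {false} h = tt
T-not {true}  h = ⊥-elim (h tt)

not-T : ∀ {b} → T (not b) → ¬ T b
not-T {false} _ ()
not-T {true}  () _

-- Striking the row of a rook or pivot can leave a gap inside the columns, so the inductions leave
-- the class of Ferrers diagrams. They run over boards, for which closure to the right survives.
Board : ℕ → ℕ → Set
Board n m = Fin n → Fin m → Bool

RightClosed : ∀ {n m} → Board n m → Set
RightClosed B = ∀ i j j′ → toℕ j ≤ toℕ j′ → T (B i j) → T (B i j′)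

count : ∀ {n} → (Fin n → Bool) → ℕ
count β = ΣN (ind ∘ β)

without : ∀ {n} → Fin n → (Fin n → Bool) → Fin n → Bool
without i₀ β i = not (does (i Fin.≟ i₀)) ∧ β i

without⁺ : ∀ {n} {i₀ i : Fin n} {β} → i ≢ i₀ → T (β i) → T (without i₀ β i)
without⁺ {i₀ = i₀} {i} ne t with i Fin.≟ i₀
... | yes e = contradiction e ne
... | no _  = t

without⁻ : ∀ {n} {i₀ i : Fin n} {β} → T (without i₀ β i) → i ≢ i₀ × T (β i)
without⁻ {i₀ = i₀} {i} t with i Fin.≟ i₀
... | no ne = ne , t

count-without : ∀ {n} (β : Fin n → Bool) i₀ → T (β i₀) → suc (count (without i₀ β)) ≡ count β
count-without β fzero t with β fzero
... | true = refl
count-without β (fsuc i₀) t =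
  ≡.trans (sym (+-suc (ind (β fzero)) _)) (cong (ind (β fzero) +_) (count-without (β ∘ fsuc) i₀ t))

tail : ∀ {n m} → Board n (suc m) → Board n m
tail B i j = B i (fsuc j)

delete : ∀ {n m} → Fin n → Board n m → Board n m
delete i₀ B i j = without i₀ (λ a → B a j) i

tail-closed : ∀ {n m} {B : Board n (suc m)} → RightClosed B → RightClosed (tail B)
tail-closed rc i j j′ le = rc i (fsuc j) (fsuc j′) (s≤s le)

delete-closed : ∀ {n m} {B : Board n m} i₀ → RightClosed B → RightClosed (delete i₀ B)
delete-closed {B = B} i₀ rc i j j′ le t =
  without⁺ {β = λ a → B a j′} (proj₁ p) (rc i j j′ le (proj₂ p))
  where p = without⁻ {β = λ a → B a j} t

Heights : ∀ {n m} → Board n m → (Fin m → ℕ) → Set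
Heights B c = ∀ j → count (λ i → B i j) ≡ c j

-- By closure to the right, row `i₀` meets every later column, so each of them loses exactly one
-- cell.
delete-heights : ∀ {n m} {B : Board n (suc m)} {c} → RightClosed B → Heights B c →
  ∀ i₀ → T (B i₀ fzero) → Heights (delete i₀ (tail B)) (pred ∘ c ∘ fsuc)
delete-heights {B = B} rc hts i₀ t j =
  cong pred (≡.trans (count-without (λ a → B a (fsuc j)) i₀ (rc i₀ fzero (fsuc j) z≤n t)) (hts (fsuc j)))

-- A column of height 0 can hold neither a rook nor a pivot, so there the second option is not on
-- offer.
trailing-step : ℕ → ℕ → ℕ → ℕ
trailing-step zero    x y = x
trailing-step (suc h) x y = (suc h + x) ⊓ y

-- Either the first column stays empty, or it has a rook, best placed in its
-- lowest cell, and the columns to its right lose the row of that rook.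
trailing : (m : ℕ) → (Fin m → ℕ) → ℕ → ℕ
trailing zero    c r       = 0
trailing (suc m) c zero    = c fzero + trailing m (c ∘ fsuc) zero
trailing (suc m) c (suc r) =
  trailing-step (c fzero) (trailing m (c ∘ fsuc) (suc r)) (trailing m (pred ∘ c ∘ fsuc) r)

step≤left : ∀ h x y → trailing-step h x y ≤ h + x
step≤left zero    x y = ≤-refl
step≤left (suc h) x y = m⊓n≤m _ y

step≤right : ∀ h x y → 1 ≤ h → trailing-step h x y ≤ y
step≤right (suc h) x y _ = m⊓n≤n (suc h + x) y

-- A placement with at most one rook per column, given by the row of the rook.
Rooks : ℕ → ℕ → Set
Rooks n m = Fin m → Maybe (Fin n)

occupied : ∀ {n} → Maybe (Fin n) → ℕ
occupied nothing  = 0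
occupied (just _) = 1

rooks : ∀ {n m} → Rooks n m → ℕ
rooks ρ = ΣN (occupied ∘ ρ)

record NonAttacking {n m} (B : Board n m) (ρ : Rooks n m) : Set where
  field
    onBoard : ∀ j i → ρ j ≡ just i → T (B i j)
    oneInRow  : ∀ j j′ i → ρ j ≡ just i → ρ j′ ≡ just i → j ≡ j′

open NonAttacking

below : ∀ {n} → (Fin n → Bool) → Maybe (Fin n) → Fin n → Bool
below β nothing   a = β a
below β (just i₀) a = β a ∧ not (toℕ a ≤ᵇ toℕ i₀)

strike : ∀ {n m} → Maybe (Fin n) → Board n m → Board n m
strike nothing   B = B
strike (just i₀) B = delete i₀ B

-- This is `inv` read column by column: a cell covered from the left lies in a row that was struck
-- at an earlier column, so within a column only its own rook still has to be considered.
uncovered : ∀ {n m} → Board n m → Rooks n m → ℕ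
uncovered {m = zero}  B ρ = 0
uncovered {m = suc m} B ρ =
  count (below (λ i → B i fzero) (ρ fzero)) + uncovered (strike (ρ fzero) (tail B)) (ρ ∘ fsuc)

tail-nonattacking : ∀ {n m} {B : Board n (suc m)} {ρ} → NonAttacking B ρ →
  NonAttacking (strike (ρ fzero) (tail B)) (ρ ∘ fsuc)
tail-nonattacking {B = B} {ρ} na = record
  { onBoard = λ j i e → helper j i e (ρ fzero) refl
  ; oneInRow = λ j j′ i e e′ → suc-injective (oneInRow na (fsuc j) (fsuc j′) i e e′) }
  where
  helper : ∀ j i → ρ (fsuc j) ≡ just i → ∀ x → ρ fzero ≡ x → T (strike x (tail B) i j)
  helper j i e nothing   e₀ = onBoard na (fsuc j) i e
  helper j i e (just i₀) e₀ = without⁺ {β = λ a → B a (fsuc j)}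
    (λ { refl → contradiction (oneInRow na fzero (fsuc j) i e₀ e) (λ ()) })
    (onBoard na (fsuc j) i e)

trailing≤uncovered : ∀ {n} m (B : Board n m) c → RightClosed B → Heights B c →
  ∀ ρ → NonAttacking B ρ → ∀ r → rooks ρ ≤ r → trailing m c r ≤ uncovered B ρ
trailing≤uncovered zero    B c rc hts ρ na r le = z≤n
trailing≤uncovered (suc m) B c rc hts ρ na r le with ρ fzero in e₀ | tail-nonattacking na
... | nothing | na′ = ≤-trans (left r) (+-mono-≤ (≤-reflexive (sym (hts fzero)))
        (trailing≤uncovered m (tail B) (c ∘ fsuc) (tail-closed {B = B} rc) (hts ∘ fsuc) (ρ ∘ fsuc) na′ r le))
  where
  left : ∀ r → trailing (suc m) c r ≤ c fzero + trailing m (c ∘ fsuc) r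
  left zero    = ≤-refl
  left (suc r) = step≤left (c fzero) _ _
trailing≤uncovered (suc m) B c rc hts ρ na (suc r) (s≤s le) | just i₀ | na′ = ≤-trans
  (step≤right (c fzero) (trailing m (c ∘ fsuc) (suc r)) _ pos)
  (≤-trans (trailing≤uncovered m (delete i₀ (tail B)) (pred ∘ c ∘ fsuc)
             (delete-closed {B = tail B} i₀ (tail-closed {B = B} rc)) (delete-heights {B = B} rc hts i₀ t₀) (ρ ∘ fsuc) na′ r le)
           (m≤n+m _ _))
  where
  t₀ : T (B i₀ fzero)
  t₀ = onBoard na fzero i₀ e₀
  pos : 1 ≤ c fzero
  pos = subst (1 ≤_) (≡.trans (count-without (λ i → B i fzero) i₀ t₀) (hts fzero)) (s≤s z≤n)

lowest : ∀ {n} (β : Fin n → Bool) → 1 ≤ count β →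
  Σ (Fin n) λ i₀ → T (β i₀) × (∀ a → T (β a) → toℕ a ≤ toℕ i₀)
lowest {suc n} β pos with count (β ∘ fsuc) in eq | lowest (β ∘ fsuc)
... | suc _ | rec with rec (s≤s z≤n)
... | i₀ , t , max = fsuc i₀ , t , λ { fzero _ → z≤n ; (fsuc a) ta → s≤s (max a ta) }
lowest {suc n} β pos | zero | _ with β fzero in e₀
... | true = fzero , subst T (sym e₀) tt , λ
  { fzero _ → z≤n
  ; (fsuc a) ta → contradiction (ΣN-single (ind ∘ β ∘ fsuc) a)
      (<⇒≱ (subst₂ _<_ (sym eq) (sym (one (β (fsuc a)) ta)) (s≤s z≤n))) }
  where
  one : ∀ b → T b → ind b ≡ 1
  one true _ = refl

cons : ∀ {n m} → Maybe (Fin n) → Rooks n m → Rooks n (suc m)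
cons x ρ fzero    = x
cons x ρ (fsuc j) = ρ j

cons-nothing : ∀ {n m} {B : Board n (suc m)} {ρ} → NonAttacking (tail B) ρ → NonAttacking B (cons nothing ρ)
cons-nothing na = record
  { onBoard = λ { (fsuc j) i e → onBoard na j i e }
  ; oneInRow = λ { (fsuc j) (fsuc j′) i e e′ → cong fsuc (oneInRow na j j′ i e e′) } }

cons-just : ∀ {n m} {B : Board n (suc m)} {ρ} i₀ → T (B i₀ fzero) →
  NonAttacking (delete i₀ (tail B)) ρ → NonAttacking B (cons (just i₀) ρ)
cons-just {B = B} {ρ} i₀ t na = record { onBoard = ob ; oneInRow = inj }
  where
  parts : ∀ {j i} → ρ j ≡ just i → i ≢ i₀ × T (B i (fsuc j))
  parts {j} {i} e = without⁻ {β = λ a → B a (fsuc j)} (onBoard na j i e)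
  ob : ∀ j i → cons (just i₀) ρ j ≡ just i → T (B i j)
  ob fzero    i refl = t
  ob (fsuc j) i e    = proj₂ (parts e)
  inj : ∀ j j′ i → cons (just i₀) ρ j ≡ just i → cons (just i₀) ρ j′ ≡ just i → j ≡ j′
  inj fzero    fzero     i e    e′   = refl
  inj fzero    (fsuc j′) i refl e′   = contradiction refl (proj₁ (parts e′))
  inj (fsuc j) fzero     i e    refl = contradiction refl (proj₁ (parts e))
  inj (fsuc j) (fsuc j′) i e    e′   = cong fsuc (oneInRow na j j′ i e e′)

suc<⇒<pred : ∀ {a b} → suc a < b → a < pred b
suc<⇒<pred {b = suc b} p = s≤s⁻¹ p

-- Heights of at least 1, ..., m allow a rook in every column, each in the lowest cell that remains,
-- and then no cell is left uncovered.
trailing-full : ∀ m (c : Fin m → ℕ) → (∀ j → toℕ j < c j) → trailing m c m ≡ 0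
trailing-full zero    c h = refl
trailing-full (suc m) c h with c fzero | h fzero
... | suc k | _ rewrite trailing-full m (pred ∘ c ∘ fsuc) (λ j → suc<⇒<pred (h (fsuc j))) = ⊓-zeroʳ (suc k + trailing m (c ∘ fsuc) (suc m))

below-lowest : ∀ {n} (β : Fin n → Bool) i₀ → (∀ a → T (β a) → toℕ a ≤ toℕ i₀) → count (below β (just i₀)) ≡ 0
below-lowest {n} β i₀ max = ≡.trans (ΣN-cong none) (≡.trans (ΣN-const n 0) (*-zeroʳ n))
  where
  none : ∀ a → ind (β a ∧ not (toℕ a ≤ᵇ toℕ i₀)) ≡ 0
  none a = n≤0⇒n≡0 (ind-mono _ false λ t → let (p , q) = Equivalence.to T-∧ t in not-T q (≤⇒≤ᵇ (max a p)))

-- An upper bound is enough here, because `trailing≤uncovered` supplies the opposite inequality.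
record OptimalRooks {n m} (B : Board n m) (r bound : ℕ) : Set where
  field
    placement    : Rooks n m
    nonAttacking : NonAttacking B placement
    size         : rooks placement ≡ r
    optimal      : uncovered B placement ≤ bound

open OptimalRooks

-- The last r columns have heights at least 1, …, r; the inequality is
-- arranged so that it holds trivially in the other columns.
Accommodates : (m : ℕ) → (Fin m → ℕ) → ℕ → Set
Accommodates m c r = r ≤ m × (∀ j → r + toℕ j < c j + m)

-- The placement follows the option that attains the minimum. A rook lowers `r`, the number of
-- columns and the heights by one each, which preserves `Accommodates`; skipping a column preserves
-- it if enough columns remain.
optimalRooks : ∀ {n} m (B : Board n m) c → RightClosed B → Heights B c →
  ∀ r → Accommodates m c r → OptimalRooks B r (trailing m c r)
optimalRooks zero    B c rc hts zero    _ = record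
  { placement = λ () ; nonAttacking = record { onBoard = λ () ; oneInRow = λ () } ; size = refl ; optimal = z≤n }
optimalRooks (suc m) B c rc hts zero    _ = record
  { placement = cons nothing (placement R) ; nonAttacking = cons-nothing (nonAttacking R) ; size = size R
  ; optimal = +-mono-≤ (≤-reflexive (hts fzero)) (optimal R) }
  where R = optimalRooks m (tail B) (c ∘ fsuc) (tail-closed {B = B} rc) (hts ∘ fsuc) zero
              (z≤n , λ j → ≤-trans (toℕ<n j) (m≤n+m m _))
optimalRooks {n} (suc m) B c rc hts (suc r) (s≤s r≤m , acc) = main (c fzero) refl
  where
  acc′ : ∀ j → suc r + toℕ j < c (fsuc j) + m
  acc′ j = s≤s⁻¹ (subst₂ _<_ (+-suc (suc r) (toℕ j)) (+-suc (c (fsuc j)) m) (acc (fsuc j)))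
  skip : suc r ≤ m → OptimalRooks B (suc r) (c fzero + trailing m (c ∘ fsuc) (suc r))
  skip le = record
    { placement = cons nothing (placement R) ; nonAttacking = cons-nothing (nonAttacking R) ; size = size R
    ; optimal = +-mono-≤ (≤-reflexive (hts fzero)) (optimal R) }
    where R = optimalRooks m (tail B) (c ∘ fsuc) (tail-closed {B = B} rc) (hts ∘ fsuc) (suc r) (le , acc′)
  use : 1 ≤ c fzero → OptimalRooks B (suc r) (trailing m (pred ∘ c ∘ fsuc) r)
  use pos with lowest (λ i → B i fzero) (subst (1 ≤_) (sym (hts fzero)) pos)
  ... | i₀ , t , max = record
    { placement = cons (just i₀) (placement R) ; nonAttacking = cons-just i₀ t (nonAttacking R)
    ; size = cong suc (size R)
    ; optimal = subst (_≤ trailing m (pred ∘ c ∘ fsuc) r)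
        (cong (_+ uncovered (delete i₀ (tail B)) (placement R)) (sym (below-lowest (λ i → B i fzero) i₀ max)))
        (optimal R) }
    where
    lower : ∀ a b → suc a < b + m → a < pred b + m
    lower a zero    p = <-trans (n<1+n a) p
    lower a (suc b) p = s≤s⁻¹ p
    R = optimalRooks m (delete i₀ (tail B)) (pred ∘ c ∘ fsuc) (delete-closed {B = tail B} i₀ (tail-closed {B = B} rc))
          (delete-heights {B = B} rc hts i₀ t) r (r≤m , λ j → lower (r + toℕ j) (c (fsuc j)) (acc′ j))
  weaken : ∀ {b b′} → OptimalRooks B (suc r) b → b ≤ b′ → OptimalRooks B (suc r) b′
  weaken R le = record { placement = placement R ; nonAttacking = nonAttacking R ; size = size R
                       ; optimal = ≤-trans (optimal R) le }
  x = trailing m (c ∘ fsuc) (suc r)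
  y = trailing m (pred ∘ c ∘ fsuc) r
  bound : ∀ {h} → c fzero ≡ h → OptimalRooks B (suc r) (c fzero + x) → OptimalRooks B (suc r) (h + x)
  bound e R = weaken R (≤-reflexive (cong (_+ x) e))
  main : ∀ h → c fzero ≡ h → OptimalRooks B (suc r) (trailing-step h x y)
  -- In an empty first column `acc` reads r + 1 < m + 1, so enough columns remain after skipping it.
  main zero e = bound e (skip (s≤s⁻¹ (subst₂ _<_ (+-identityʳ (suc r)) (cong (_+ suc m) e) (acc fzero))))
  main (suc h) e with suc r ≤? m
  -- Here r = m and every column needs a rook. The rook option is also the minimum, since the
  -- remaining heights are large enough to make `y` vanish.
  ... | no ¬le = weaken (use (subst (1 ≤_) (sym e) (s≤s z≤n))) (≤-trans (≤-reflexive y≡0) z≤n)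
    where
    r≡m : r ≡ m
    r≡m = ≤-antisym r≤m (s≤s⁻¹ (≰⇒> ¬le))
    tall : ∀ (j : Fin m) b → suc r + toℕ j < b + m → toℕ j < pred b
    tall j b p rewrite r≡m =
      suc<⇒<pred (+-cancelˡ-< m _ _ (subst₂ _<_ (sym (+-suc m (toℕ j))) (+-comm b m) p))
    y≡0 : y ≡ 0
    y≡0 = subst (λ k → trailing m (pred ∘ c ∘ fsuc) k ≡ 0) (sym r≡m)
      (trailing-full m (pred ∘ c ∘ fsuc) λ j → tall j (c (fsuc j)) (acc′ j))
  ... | yes le with ≤-total (suc h + x) y
  ...   | inj₁ p = weaken (bound e (skip le)) (≤-reflexive (sym (m≤n⇒m⊓n≡m p)))
  ...   | inj₂ p = weaken (use (subst (1 ≤_) (sym e) (s≤s z≤n))) (≤-reflexive (sym (m≥n⇒m⊓n≡n p)))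

-- Rook placements and covered cells

open Equivalence using (to; from)

CoveredFromBelow : ∀ {n m} → Rooks n m → Fin n → Fin m → Set
CoveredFromBelow ρ a b = ∃ λ i → ρ b ≡ just i × toℕ a ≤ toℕ i

CoveredFromLeft : ∀ {n m} → Rooks n m → Fin n → Fin m → Set
CoveredFromLeft ρ a b = ∃ λ j → toℕ j ≤ toℕ b × ρ j ≡ just a

record Uncovered {n m} (B : Board n m) (ρ : Rooks n m) (a : Fin n) (b : Fin m) : Set where
  constructor unc
  field
    onB  : T (B a b)
    ¬bel : ¬ CoveredFromBelow ρ a b
    ¬lef : ¬ CoveredFromLeft ρ a b

-- The array `u` is known only through its specification, so that the induction may restrict it to
-- the later columns, where being covered from the left by the first rook turns into lying off the
-- struck board.
uncovered-count : ∀ {n} m (B : Board n m) ρ (u : Fin n → Fin m → Bool) →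
  (∀ a b → T (u a b) ⇔ Uncovered B ρ a b) → ΣN (λ b → ΣN (λ a → ind (u a b))) ≡ uncovered B ρ
uncovered-count zero    B ρ u spec = refl
uncovered-count (suc m) B ρ u spec with ρ fzero in e₀
... | nothing = cong₂ _+_
  (ΣN-cong λ a → ind-cong _ _ (λ t → Uncovered.onB (to (spec a fzero) t))
     (λ t → from (spec a fzero) (unc t (λ { (i , e , _) → clash e₀ e }) (λ { (fzero , _ , e) → clash e₀ e }))))
  (uncovered-count m (tail B) (ρ ∘ fsuc) (λ a b → u a (fsuc b)) λ a b → mk⇔
    (λ t → let unc o p q = to (spec a (fsuc b)) t in unc o p (λ { (j , le , e) → q (fsuc j , s≤s le , e) }))
    (λ { (unc o p q) → from (spec a (fsuc b)) (unc o p (λ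
       { (fzero , _ , e) → clash e₀ e ; (fsuc j , s≤s le , e) → q (j , le , e) })) }))
  where
  clash : ∀ {x : Maybe _} {i} → x ≡ nothing → x ≡ just i → ⊥
  clash refl ()
... | just i₀ = cong₂ _+_
  (ΣN-cong λ a → ind-cong _ _
     (λ t → let unc o p q = to (spec a fzero) t in
        from T-∧ (o , T-not (λ le → p (i₀ , e₀ , ≤ᵇ⇒≤ _ _ le))))
     (λ t → let (o , nle) = to (T-∧ {B a fzero}) t
                nle′ = λ le → not-T nle (≤⇒≤ᵇ le) in
        from (spec a fzero) (unc o
          (λ { (i , e , le) → nle′ (subst (λ i → toℕ a ≤ toℕ i) (just-injective (≡.trans (sym e) e₀)) le) })
          (λ { (fzero , _ , e) → nle′ (≤-reflexive (cong toℕ (just-injective (≡.trans (sym e) e₀)))) }))))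
  (uncovered-count m (delete i₀ (tail B)) (ρ ∘ fsuc) (λ a b → u a (fsuc b)) λ a b → mk⇔
    (λ t → let unc o p q = to (spec a (fsuc b)) t in
       unc (without⁺ {β = λ a → B a (fsuc b)} (λ { refl → q (fzero , z≤n , e₀) }) o) p
           (λ { (j , le , e) → q (fsuc j , s≤s le , e) }))
    (λ { (unc o p q) → let (ne , o′) = without⁻ {β = λ a → B a (fsuc b)} o in
       from (spec a (fsuc b)) (unc o′ p (λ
         { (fzero , _ , e) → ne (just-injective (≡.trans (sym e) e₀)) ; (fsuc j , s≤s le , e) → q (j , le , e) })) }))

module _ {n m : ℕ} (F : Ferrers n m) where

  height : Fin m → ℕ
  height j = count (λ i → cell F i j)

  colHeight≡ : ∀ j → colHeight F j ≡ height j
  colHeight≡ j = sum-allFin (λ i → ind (cell F i j))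

  card≡ : card F ≡ ΣN height
  card≡ = ≡.trans (sum-allFin (λ i → sum (map (λ j → ind (cell F i j)) (allFin m))))
    (≡.trans (ΣN-cong (λ i → sum-allFin (λ j → ind (cell F i j)))) (ΣN-swap (λ i j → ind (cell F i j))))

  cell-closed : RightClosed (cell F)
  cell-closed i j j′ le = go (toℕ j′ ∸ toℕ j) j j′ (sym (m+[n∸m]≡n le))
    where
    go : ∀ s j j′ → toℕ j′ ≡ toℕ j + s → T (cell F i j) → T (cell F i j′)
    go zero    j j′ e t = subst (λ j → T (cell F i j)) (toℕ-injective (sym (≡.trans e (+-identityʳ _)))) t
    go (suc s) j j′ e t = go s k j′ (≡.trans e (≡.trans (+-suc (toℕ j) s) (cong (_+ s) (sym k≡))))
                             (rightClosed F i j k k≡ t)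
      where
      k< : suc (toℕ j) < m
      k< = ≤-<-trans (≤-trans (m≤m+n _ s) (≤-reflexive (≡.trans (sym (+-suc (toℕ j) s)) (sym e)))) (toℕ<n j′)
      k = fromℕ< k<
      k≡ : toℕ k ≡ suc (toℕ j)
      k≡ = toℕ-fromℕ< k<

  height-mono : ∀ j j′ → toℕ j ≤ toℕ j′ → height j ≤ height j′
  height-mono j j′ le = ΣN-mono (λ i → ind-mono _ _ (cell-closed i j j′ le))

  module _ {r : ℕ} (C : RookPlacement F r) (ρ : Rooks n m) where
    open RookPlacement C

    Enumerates : Set
    Enumerates = ∀ i j → ρ j ≡ just i ⇔ (∃ λ c → pos c ≡ (i , j))

    inv≡uncovered : Enumerates → inv F C ≡ uncovered (cell F) ρ
    inv≡uncovered enum = ≡.trans (sum-allFin (λ a → sum (map (λ b → ind (u a b)) (allFin m))))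
      (≡.trans (ΣN-cong (λ a → sum-allFin (λ b → ind (u a b))))
        (≡.trans (ΣN-swap (λ a b → ind (u a b))) (uncovered-count m (cell F) ρ u spec)))
      where
      cov : Fin n → Fin m → Fin r → Bool
      cov a b c = ((toℕ b ≡ᵇ toℕ (proj₂ (pos c))) ∧ (toℕ a ≤ᵇ toℕ (proj₁ (pos c))))
                ∨ ((toℕ a ≡ᵇ toℕ (proj₁ (pos c))) ∧ (toℕ (proj₂ (pos c)) ≤ᵇ toℕ b))
      u : Fin n → Fin m → Bool
      u a b = cell F a b ∧ not (any (cov a b) (allFin r))
      covered⁻ : ∀ a b → T (any (cov a b) (allFin r)) → CoveredFromBelow ρ a b ⊎ CoveredFromLeft ρ a b
      covered⁻ a b t with Any.satisfied (any⁻ (cov a b) (allFin r) t)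
      ... | c , tc with to (T-∨ {(toℕ b ≡ᵇ toℕ (proj₂ (pos c))) ∧ (toℕ a ≤ᵇ toℕ (proj₁ (pos c)))}) tc
      ...   | inj₁ s = let (e , le) = to T-∧ s in inj₁ (proj₁ (pos c) ,
                 from (enum _ b) (c , cong (proj₁ (pos c) ,_) (sym (toℕ-injective (≡ᵇ⇒≡ _ _ e)))) , ≤ᵇ⇒≤ _ _ le)
      ...   | inj₂ s = let (e , le) = to T-∧ s in inj₂ (proj₂ (pos c) , ≤ᵇ⇒≤ _ _ le ,
                 from (enum a _) (c , cong (_, proj₂ (pos c)) (sym (toℕ-injective (≡ᵇ⇒≡ _ _ e)))))
      covered⁺ : ∀ a b c → T (cov a b c) → T (any (cov a b) (allFin r))
      covered⁺ a b c t = any⁺ (cov a b) (lose (∈-allFin c) t)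
      spec : ∀ a b → T (u a b) ⇔ Uncovered (cell F) ρ a b
      spec a b = mk⇔
        (λ t → let (o , nc) = to T-∧ t in unc o
           (λ { (i , e , le) → let (c , pc) = to (enum i b) e in
             not-T nc (covered⁺ a b c (from T-∨ (inj₁ (from T-∧
               (≡⇒≡ᵇ _ _ (cong toℕ (sym (cong proj₂ pc))) , ≤⇒≤ᵇ (subst (λ i → toℕ a ≤ toℕ i) (sym (cong proj₁ pc)) le)))))) })
           (λ { (j , le , e) → let (c , pc) = to (enum a j) e in
             not-T nc (covered⁺ a b c (from (T-∨ {(toℕ b ≡ᵇ toℕ (proj₂ (pos c))) ∧ (toℕ a ≤ᵇ toℕ (proj₁ (pos c)))}) (inj₂ (from T-∧
               (≡⇒≡ᵇ _ _ (cong toℕ (sym (cong proj₁ pc))) , ≤⇒≤ᵇ (subst (λ j → toℕ j ≤ toℕ b) (sym (cong proj₂ pc)) le)))))) }))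
        (λ { (unc o p q) → from T-∧ (o , T-not (λ t → [ p , q ]′ (covered⁻ a b t))) })

  module _ {r : ℕ} (C : RookPlacement F r) where
    open RookPlacement C

    private
      rookRow : ∀ j → Dec (∃ λ c → proj₂ (pos c) ≡ j) → Maybe (Fin n)
      rookRow j (yes (c , _)) = just (proj₁ (pos c))
      rookRow j (no _)        = nothing

      inColumn? : ∀ j → Dec (∃ λ c → proj₂ (pos c) ≡ j)
      inColumn? j = any? (λ c → proj₂ (pos c) Fin.≟ j)

    columnwise : Rooks n m
    columnwise j = rookRow j (inColumn? j)

    columnwise-enumerates : Enumerates C columnwise
    columnwise-enumerates i j with inColumn? j
    ... | yes (c , refl) = mk⇔ (λ { refl → c , refl })
            (λ { (c′ , e) → cong just (subst (λ c → proj₁ (pos c) ≡ i) (colInj c′ c (cong proj₂ e)) (cong proj₁ e)) })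
    ... | no none = mk⇔ (λ ()) (λ { (c , e) → contradiction (c , cong proj₂ e) none })

    columnwise-nonAttacking : NonAttacking (cell F) columnwise
    columnwise-nonAttacking = record
      { onBoard = λ j i e → let (c , pc) = to (columnwise-enumerates i j) e in
          subst (λ p → T (cell F (proj₁ p) (proj₂ p))) pc (inF c)
      ; oneInRow = λ j j′ i e e′ →
          let (c , pc)  = to (columnwise-enumerates i j) e
              (c′ , pc′) = to (columnwise-enumerates i j′) e′
              c≡c′ = rowInj c c′ (≡.trans (cong proj₁ pc) (sym (cong proj₁ pc′)))
          in ≡.trans (sym (cong proj₂ pc)) (≡.trans (cong (λ c → proj₂ (pos c)) c≡c′) (cong proj₂ pc′)) }

    -- Double counting of the pairs of a column and a rook in it: every rook lies in exactly one
    -- column.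
    columnwise-size : rooks columnwise ≤ r
    columnwise-size = ≤-trans (ΣN-mono occ) (≤-reflexive
      (≡.trans (ΣN-swap (λ j c → ⟦ proj₂ (pos c) Fin.≟ j ⟧))
      (≡.trans (ΣN-cong (λ c → ΣN-δ (proj₂ (pos c)))) (≡.trans (ΣN-const r 1) (*-identityʳ r)))))
      where
      occ : ∀ j → occupied (columnwise j) ≤ ΣN (λ c → ⟦ proj₂ (pos c) Fin.≟ j ⟧)
      occ j with inColumn? j
      ... | no _        = z≤n
      ... | yes (c , e) = subst (_≤ ΣN (λ c → ⟦ proj₂ (pos c) Fin.≟ j ⟧)) (⟦⟧-yes (proj₂ (pos c) Fin.≟ j) e)
                            (ΣN-single (λ c → ⟦ proj₂ (pos c) Fin.≟ j ⟧) c)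
      ΣN-zero : ∀ {k} {f : Fin k → ℕ} → (∀ i → f i ≡ 0) → ΣN f ≡ 0
      ΣN-zero {k} h = ≡.trans (ΣN-cong h) (≡.trans (ΣN-const k 0) (*-zeroʳ k))
      ΣN-δ : ∀ {k} (i : Fin k) → ΣN (λ j → ⟦ i Fin.≟ j ⟧) ≡ 1
      ΣN-δ {suc k} fzero = cong suc (ΣN-zero {k} (λ i → ⟦⟧-no (fzero Fin.≟ fsuc i) (λ ())))
      ΣN-δ (fsuc i) = ≡.trans (ΣN-cong (λ j → ⟦⟧-cong (fsuc i Fin.≟ fsuc j) (i Fin.≟ j) suc-injective (cong fsuc))) (ΣN-δ i)

record Enumeration {n m} (ρ : Rooks n m) (r : ℕ) : Set where
  field
    pos      : Fin r → Fin n × Fin m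
    colInj   : ∀ a b → proj₂ (pos a) ≡ proj₂ (pos b) → a ≡ b
    sound    : ∀ c → ρ (proj₂ (pos c)) ≡ just (proj₁ (pos c))
    complete : ∀ i j → ρ j ≡ just i → ∃ λ c → pos c ≡ (i , j)

enumerate : ∀ {n} m (ρ : Rooks n m) → Enumeration ρ (rooks ρ)
enumerate zero    ρ = record { pos = λ () ; colInj = λ () ; sound = λ () ; complete = λ _ () }
enumerate {n} (suc m) ρ with ρ fzero in e₀ | enumerate m (ρ ∘ fsuc)
... | nothing | E = record
  { pos = shift ∘ pos
  ; colInj = λ a b e → colInj a b (suc-injective e)
  ; sound = sound
  ; complete = λ { i fzero e → contradiction (≡.trans (sym e₀) e) (λ ())
                 ; i (fsuc j) e → let (c , pc) = complete i j e in c , cong shift pc } }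
  where
  open Enumeration E
  shift : Fin n × Fin m → Fin n × Fin (suc m)
  shift = map₂ fsuc
... | just i₀ | E = record { pos = pos′ ; colInj = inj ; sound = snd ; complete = cmp }
  where
  open Enumeration E
  pos′ : Fin (suc (rooks (ρ ∘ fsuc))) → Fin n × Fin (suc m)
  pos′ fzero    = i₀ , fzero
  pos′ (fsuc c) = map₂ fsuc (pos c)
  inj : ∀ a b → proj₂ (pos′ a) ≡ proj₂ (pos′ b) → a ≡ b
  inj fzero    fzero    e = refl
  inj (fsuc a) (fsuc b) e = cong fsuc (colInj a b (suc-injective e))
  snd : ∀ c → ρ (proj₂ (pos′ c)) ≡ just (proj₁ (pos′ c))
  snd fzero    = e₀
  snd (fsuc c) = sound c
  cmp : ∀ i j → ρ j ≡ just i → ∃ λ c → pos′ c ≡ (i , j)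
  cmp i fzero    e = fzero , cong (_, fzero) (just-injective (≡.trans (sym e₀) e))
  cmp i (fsuc j) e = let (c , pc) = complete i j e in fsuc c , cong (map₂ fsuc) pc

module _ {n m : ℕ} (F : Ferrers n m) where

  trailing-isTrailingDegree : ∀ r → Accommodates m (height F) r →
    IsTrailingDegree F r (trailing m (height F) r)
  trailing-isTrailingDegree r acc = attained , lower
    where
    t = trailing m (height F) r
    lower : ∀ (C : RookPlacement F r) → t ≤ inv F C
    lower C = subst (t ≤_) (sym (inv≡uncovered F C (columnwise F C) (columnwise-enumerates F C)))
      (trailing≤uncovered m (cell F) (height F) (cell-closed F) (λ _ → refl) (columnwise F C)
        (columnwise-nonAttacking F C) r (columnwise-size F C))
    R = optimalRooks m (cell F) (height F) (cell-closed F) (λ _ → refl) r acc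
    ρ = OptimalRooks.placement R
    E : Enumeration ρ r
    E = subst (Enumeration ρ) (OptimalRooks.size R) (enumerate m ρ)
    open Enumeration E
    C : RookPlacement F r
    C = record
      { pos = pos
      ; rowInj = λ a b e → colInj a b (NonAttacking.oneInRow (OptimalRooks.nonAttacking R) _ _ _ (sound a)
                   (≡.trans (sound b) (cong just (sym e))))
      ; colInj = colInj
      ; inF = λ a → NonAttacking.onBoard (OptimalRooks.nonAttacking R) _ _ (sound a) }
    enum : Enumerates F C ρ
    enum i j = mk⇔ (complete i j) (λ { (c , refl) → sound c })
    attained : Σ (RookPlacement F r) λ C → inv F C ≡ t
    attained = C , ≤-antisym (≤-trans (≤-reflexive (inv≡uncovered F C ρ enum)) (OptimalRooks.optimal R)) (lower C)

  -- A positive κ_j yields a column of height greater than j among those that κ_j sums over. Heights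
  -- grow to the right, so the last of these columns has height greater than j as well. For j = 0,
  -- ..., d - 1 these last columns are the final d columns.
  kappa-accommodates : ∀ d → 1 ≤ kappa F d → Accommodates m (height F) d
  kappa-accommodates zero    pos = z≤n , λ j → ≤-trans (toℕ<n j) (m≤n+m m _)
  kappa-accommodates (suc d) pos = d<m , acc
    where
    foldr-⊓ : ∀ z (xs : List ℕ) {x} → x ∈ xs → foldr _⊓_ z xs ≤ x
    foldr-⊓ z (y ∷ ys) (here refl) = m⊓n≤m y _
    foldr-⊓ z (y ∷ ys) (there p)   = ≤-trans (m⊓n≤n y _) (foldr-⊓ z ys p)
    positive : ∀ {k} (f : Fin k → ℕ) → 1 ≤ ΣN f → ∃ λ i → 1 ≤ f i
    positive {suc k} f p with f fzero in e
    ... | suc _ = fzero , subst (1 ≤_) (sym e) (s≤s z≤n)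
    ... | zero  = let (i , q) = positive (f ∘ fsuc) p in fsuc i , q
    summand : ℕ → Fin m → ℕ
    summand j t = if toℕ t <ᵇ ((m + 1 + j) ∸ suc d) then colHeight F t ∸ j else 0
    unpack : ∀ b {x} → 1 ≤ (if b then x else 0) → T b × 1 ≤ x
    unpack true p = tt , p
    tall : ∀ j → j < suc d → ∃ λ t → toℕ t < (m + 1 + j) ∸ suc d × j < height F t
    tall j j<d with positive (summand j) (subst (1 ≤_) (sum-allFin (summand j))
                      (≤-trans pos (foldr-⊓ (kappaJ F (suc d) 0) _ (∈-map⁺ (kappaJ F (suc d)) (∈-upTo⁺ j<d)))))
    ... | t , p = let (a , b) = unpack (toℕ t <ᵇ ((m + 1 + j) ∸ suc d)) p in
                  t , <ᵇ⇒< _ _ a , subst (j <_) (colHeight≡ F t) (m∸n≢0⇒n<m (λ e → contradiction b (<⇒≱ (≤-reflexive (cong suc e)))))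
    d<m : suc d ≤ m
    d<m with tall 0 (s≤s z≤n)
    ... | t , p , _ = s≤s⁻¹ (subst (suc d <_) (≡.trans (+-identityʳ (m + 1)) (+-comm m 1))
                        (m∸n≢0⇒n<m (λ e → contradiction (subst (toℕ t <_) e p) (λ ()))))
    acc : ∀ J → suc d + toℕ J < height F J + m
    acc J with m ≤? suc d + toℕ J
    -- To the left of the final d columns nothing is claimed about the height.
    ... | no ¬le = ≤-trans (≰⇒> ¬le) (m≤n+m m _)
    ... | yes le = goal (tall j j<)
      where
      -- The index for which `J` is the last column of the sum κ_j.
      j = suc d + toℕ J ∸ m
      j+m : j + m ≡ suc d + toℕ J
      j+m = m∸n+n≡m le
      j< : j < suc d
      j< = +-cancelʳ-< m j (suc d) (subst (_< suc d + m) (sym j+m) (+-monoʳ-< (suc d) (toℕ<n J)))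
      range : (m + 1 + j) ∸ suc d ≡ suc (toℕ J)
      range = ≡.trans (cong (_∸ suc d) (≡.trans (cong (_+ j) (+-comm m 1)) (≡.trans (cong suc (≡.trans (+-comm m j) j+m)) (sym (+-suc (suc d) (toℕ J))))))
                (m+n∸m≡n (suc d) (suc (toℕ J)))
      goal : (∃ λ t → toℕ t < (m + 1 + j) ∸ suc d × j < height F t) → suc d + toℕ J < height F J + m
      goal (t , p , q) = subst (_< height F J + m) j+m
        (+-monoˡ-< m (<-≤-trans q (height-mono F t J (s≤s⁻¹ (subst (toℕ t <_) range p)))))

-- Random tuples in a finite vector space

module Field {q : ℕ} (K : FiniteField q) where
  open FiniteField K public
  open IsCommutativeRing isCommutativeRing public
    using (+-isAbelianGroup)
    renaming (+-identityˡ to +ᶠ-identityˡ; +-identityʳ to +ᶠ-identityʳ; *-assoc to *ᶠ-assoc; *-comm to *ᶠ-comm; *-identityˡ to *ᶠ-identityˡ; distribˡ to distribˡᶠ; distribʳ to distribʳᶠ; zeroˡ to zeroˡᶠ; zeroʳ to zeroʳᶠ; -‿inverseˡ to -‿inverseˡᶠ; -‿inverseʳ to -‿inverseʳᶠ)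

  *ᶠ-leftComm : ∀ a b z → a *ᶠ (b *ᶠ z) ≡ b *ᶠ (a *ᶠ z)
  *ᶠ-leftComm a b z = ≡.trans (sym (*ᶠ-assoc a b z)) (≡.trans (cong (_*ᶠ z) (*ᶠ-comm a b)) (*ᶠ-assoc b a z))

  *ᶠ-cancelˡ-nonzero : ∀ a {x y} → a ≢ 0ᶠ → a *ᶠ x ≡ a *ᶠ y → x ≡ y
  *ᶠ-cancelˡ-nonzero a {x} {y} a≢0 e = ≡.trans (sym (undo x)) (≡.trans (cong (b *ᶠ_) e) (undo y))
    where
    b = proj₁ (inverse a a≢0)
    undo : ∀ x → b *ᶠ (a *ᶠ x) ≡ x
    undo x = ≡.trans (sym (*ᶠ-assoc b a x))
      (≡.trans (cong (_*ᶠ x) (≡.trans (*ᶠ-comm b a) (proj₂ (inverse a a≢0)))) (*ᶠ-identityˡ x))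

  inverse-nonzero : ∀ a (a≢0 : a ≢ 0ᶠ) → proj₁ (inverse a a≢0) ≢ 0ᶠ
  inverse-nonzero a a≢0 e = 0≢1 (≡.trans (sym (zeroʳᶠ a)) (≡.trans (cong (a *ᶠ_) (sym e)) (proj₂ (inverse a a≢0))))

  two≤q : 2 ≤ q
  two≤q = subst (2 ≤_) elements-length (unique-length≤ {xs = 0ᶠ ∷ 1ᶠ ∷ []} ((0≢1 ∷ []) ∷ [] ∷ []) (λ {x} _ → elements-complete x))

-- Matrices and coefficient vectors are both treated as instances, so that the bounds for random
-- tuples apply to either.
record VectorSpace {q : ℕ} (K : FiniteField q) : Set₁ where
  open FiniteField K using (_+ᶠ_; _*ᶠ_; 1ᶠ) renaming (Carrier to 𝕂)
  infixl 6 _⊕_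
  infixr 7 _·_
  field
    V    : Set
    _⊕_  : V → V → V
    0v   : V
    ⊖_   : V → V
    _·_  : 𝕂 → V → V
    isAbelianGroup : IsAbelianGroup _≡_ _⊕_ 0v ⊖_
    ·-distribˡ : ∀ a x y → a · (x ⊕ y) ≡ a · x ⊕ a · y
    ·-distribʳ : ∀ a b x → (a +ᶠ b) · x ≡ a · x ⊕ b · x
    ·-assoc    : ∀ a b x → (a *ᶠ b) · x ≡ a · (b · x)
    ·-identity : ∀ x → 1ᶠ · x ≡ x
    _≟ᵥ_ : DecidableEquality V

module _ {q : ℕ} (K : FiniteField q) where
  open Field K renaming (Carrier to 𝕂)

  scalars : VectorSpace K
  scalars = record
    { V = 𝕂 ; _⊕_ = _+ᶠ_ ; 0v = 0ᶠ ; ⊖_ = -ᶠ_ ; _·_ = _*ᶠ_ ; isAbelianGroup = +-isAbelianGroup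
    ; ·-distribˡ = distribˡᶠ ; ·-distribʳ = λ a b x → distribʳᶠ x a b ; ·-assoc = *ᶠ-assoc
    ; ·-identity = *ᶠ-identityˡ ; _≟ᵥ_ = _≟_ }

  power : VectorSpace K → ℕ → VectorSpace K
  power W n = record
    { V = Vec V n ; _⊕_ = zipWith _⊕_ ; 0v = replicate n 0v ; ⊖_ = Vec.map ⊖_ ; _·_ = λ a → Vec.map (a ·_)
    ; isAbelianGroup = record
      { isGroup = record
        { isMonoid = record
          { isSemigroup = record
            { isMagma = record { isEquivalence = ≡.isEquivalence ; ∙-cong = cong₂ (zipWith _⊕_) }
            ; assoc = Vec.zipWith-assoc assoc }
          ; identity = Vec.zipWith-identityˡ identityˡ , Vec.zipWith-identityʳ identityʳ }
        ; inverse = Vec.zipWith-inverseˡ inverseˡ , Vec.zipWith-inverseʳ inverseʳ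
        ; ⁻¹-cong = cong (Vec.map ⊖_) }
      ; comm = Vec.zipWith-comm comm }
    ; ·-distribˡ = dl ; ·-distribʳ = dr ; ·-assoc = as ; ·-identity = idn
    ; _≟ᵥ_ = Vec.≡-dec _≟ᵥ_ }
    where
    open VectorSpace W
    open IsAbelianGroup isAbelianGroup using (assoc; comm; identityˡ; identityʳ; inverseˡ; inverseʳ)
    dl : ∀ {n} a (x y : Vec V n) → Vec.map (a ·_) (zipWith _⊕_ x y) ≡ zipWith _⊕_ (Vec.map (a ·_) x) (Vec.map (a ·_) y)
    dl a []       []       = refl
    dl a (x ∷ xs) (y ∷ ys) = cong₂ _∷_ (·-distribˡ a x y) (dl a xs ys)
    dr : ∀ {n} a b (x : Vec V n) → Vec.map ((a +ᶠ b) ·_) x ≡ zipWith _⊕_ (Vec.map (a ·_) x) (Vec.map (b ·_) x)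
    dr a b []       = refl
    dr a b (x ∷ xs) = cong₂ _∷_ (·-distribʳ a b x) (dr a b xs)
    as : ∀ {n} a b (x : Vec V n) → Vec.map ((a *ᶠ b) ·_) x ≡ Vec.map (a ·_) (Vec.map (b ·_) x)
    as a b []       = refl
    as a b (x ∷ xs) = cong₂ _∷_ (·-assoc a b x) (as a b xs)
    idn : ∀ {n} (x : Vec V n) → Vec.map (1ᶠ ·_) x ≡ x
    idn []       = refl
    idn (x ∷ xs) = cong₂ _∷_ (·-identity x) (idn xs)

module Linear {q : ℕ} {K : FiniteField q} (W : VectorSpace K) where
  open Field K using (0ᶠ; 1ᶠ; _+ᶠ_; _*ᶠ_; -ᶠ_; inverse; +ᶠ-identityˡ; -‿inverseˡᶠ; -‿inverseʳᶠ; *ᶠ-comm; zeroʳᶠ) renaming (Carrier to 𝕂)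
  open VectorSpace W public
  open IsAbelianGroup isAbelianGroup public
    using () renaming (assoc to ⊕-assoc; comm to ⊕-comm; identityˡ to ⊕-identityˡ; identityʳ to ⊕-identityʳ;
                       inverseˡ to ⊕-inverseˡ; inverseʳ to ⊕-inverseʳ)

  private
    group : Group _ _
    group = record { isGroup = IsAbelianGroup.isGroup isAbelianGroup }
    module G = Algebra.Properties.Group group

  ⊕-cancelˡ : ∀ x {y z} → x ⊕ y ≡ x ⊕ z → y ≡ z
  ⊕-cancelˡ x {y} {z} = G.∙-cancelˡ x y z

  ⊕-cancelʳ : ∀ x {y z} → y ⊕ x ≡ z ⊕ x → y ≡ z
  ⊕-cancelʳ x {y} {z} = G.∙-cancelʳ x y z

  ·-zeroˡ : ∀ x → 0ᶠ · x ≡ 0v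
  ·-zeroˡ x = ⊕-cancelˡ (0ᶠ · x) (≡.trans (sym (·-distribʳ 0ᶠ 0ᶠ x))
    (≡.trans (cong (_· x) (+ᶠ-identityˡ 0ᶠ)) (sym (⊕-identityʳ _))))

  ·-zeroʳ : ∀ a → a · 0v ≡ 0v
  ·-zeroʳ a = ⊕-cancelˡ (a · 0v) (≡.trans (sym (·-distribˡ a 0v 0v))
    (≡.trans (cong (a ·_) (⊕-identityˡ 0v)) (sym (⊕-identityʳ _))))

  -1· : ∀ x → x ⊕ (-ᶠ 1ᶠ) · x ≡ 0v
  -1· x = ≡.trans (cong (_⊕ (-ᶠ 1ᶠ) · x) (sym (·-identity x)))
    (≡.trans (sym (·-distribʳ 1ᶠ (-ᶠ 1ᶠ) x)) (≡.trans (cong (_· x) (-‿inverseʳᶠ 1ᶠ)) (·-zeroˡ x)))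

  ⊕-interchange : ∀ a b c d → (a ⊕ b) ⊕ (c ⊕ d) ≡ (a ⊕ c) ⊕ (b ⊕ d)
  ⊕-interchange a b c d = ≡.trans (⊕-assoc a b (c ⊕ d)) (≡.trans (cong (a ⊕_)
    (≡.trans (sym (⊕-assoc b c d)) (≡.trans (cong (_⊕ d) (⊕-comm b c)) (⊕-assoc c b d)))) (sym (⊕-assoc a c (b ⊕ d))))

  ·-undo : ∀ a (a≢0 : a ≢ 0ᶠ) x → proj₁ (inverse a a≢0) · (a · x) ≡ x
  ·-undo a a≢0 x = ≡.trans (sym (·-assoc _ a x))
    (≡.trans (cong (_· x) (≡.trans (*ᶠ-comm _ a) (proj₂ (inverse a a≢0)))) (·-identity x))

  ·-redo : ∀ a (a≢0 : a ≢ 0ᶠ) x → a · (proj₁ (inverse a a≢0) · x) ≡ x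
  ·-redo a a≢0 x = ≡.trans (sym (·-assoc a _ x))
    (≡.trans (cong (_· x) (proj₂ (inverse a a≢0))) (·-identity x))

  comb : ∀ {k} → Vec 𝕂 k → Vec V k → V
  comb []       []       = 0v
  comb (c ∷ cs) (b ∷ bs) = c · b ⊕ comb cs bs

  comb-⊕ : ∀ {k} (c d : Vec 𝕂 k) b → comb (zipWith _+ᶠ_ c d) b ≡ comb c b ⊕ comb d b
  comb-⊕ []       []       []       = sym (⊕-identityˡ 0v)
  comb-⊕ (c ∷ cs) (d ∷ ds) (b ∷ bs) =
    ≡.trans (cong₂ _⊕_ (·-distribʳ c d b) (comb-⊕ cs ds bs)) (⊕-interchange _ _ _ _)

  comb-· : ∀ {k} a (c : Vec 𝕂 k) b → comb (Vec.map (a *ᶠ_) c) b ≡ a · comb c b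
  comb-· a []       []       = sym (·-zeroʳ a)
  comb-· a (c ∷ cs) (b ∷ bs) =
    ≡.trans (cong₂ _⊕_ (·-assoc a c b) (comb-· a cs bs)) (sym (·-distribˡ a _ _))

  comb-0 : ∀ {k} (b : Vec V k) → comb (replicate k 0ᶠ) b ≡ 0v
  comb-0 []       = refl
  comb-0 (b ∷ bs) = ≡.trans (cong₂ _⊕_ (·-zeroˡ b) (comb-0 bs)) (⊕-identityˡ 0v)

module _ {q : ℕ} {K : FiniteField q} where
  private
    module F = Field K

  Coeffs : ℕ → VectorSpace K
  Coeffs = power K (scalars K)

  coeffs : (k : ℕ) → List (Vec F.Carrier k)
  coeffs = tuples F.elements

  coeffs-unique : ∀ k → Unique (coeffs k)
  coeffs-unique k = vecs-unique k (λ _ → F.elements-unique)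

  ∈-coeffs : ∀ {k} (c : Vec F.Carrier k) → c ∈ coeffs k
  ∈-coeffs {k} c = ∈-vecs⁺ k (λ i → F.elements-complete _)

  length-coeffs : ∀ k → length (coeffs k) ≡ q ^ k
  length-coeffs k = ≡.trans (length-tuples F.elements k) (cong (_^ k) F.elements-length)

  -- Representatives of the nonzero coefficient vectors up to scaling.
  normalised : (k : ℕ) → List (Vec F.Carrier k)
  normalised zero    = []
  normalised (suc k) = map (F.1ᶠ ∷_) (coeffs k) ++ map (F.0ᶠ ∷_) (normalised k)

  normalised-nonzero : ∀ k {c} → c ∈ normalised k → c ≢ replicate k F.0ᶠ
  normalised-nonzero (suc k) c∈ e with ∈-++⁻ (map (F.1ᶠ ∷_) (coeffs k)) c∈
  ... | inj₁ p with ∈-map⁻ (F.1ᶠ ∷_) p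
  ...   | d , _ , e′ = F.0≢1 (sym (Vec.∷-injectiveˡ (≡.trans (sym e′) e)))
  normalised-nonzero (suc k) c∈ e | inj₂ p with ∈-map⁻ (F.0ᶠ ∷_) p
  ...   | d , d∈ , e′ = normalised-nonzero k d∈ (Vec.∷-injectiveʳ (≡.trans (sym e′) e))

  -- Divide by the first nonzero coordinate.
  normalise : ∀ k (c : Vec F.Carrier k) → c ≢ replicate k F.0ᶠ →
    ∃ λ a → a ≢ F.0ᶠ × Vec.map (a F.*ᶠ_) c ∈ normalised k
  normalise zero    []      c≢0 = contradiction refl c≢0
  normalise (suc k) (x ∷ c) c≢0 with x F.≟ F.0ᶠ
  ... | no x≢0 = proj₁ (F.inverse x x≢0) , F.inverse-nonzero x x≢0 ,
        ∈-++⁺ˡ (subst (_∈ map (F.1ᶠ ∷_) (coeffs k))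
                  (cong (_∷ Vec.map (proj₁ (F.inverse x x≢0) F.*ᶠ_) c) (sym (≡.trans (F.*ᶠ-comm _ x) (proj₂ (F.inverse x x≢0)))))
                  (∈-map⁺ (F.1ᶠ ∷_) (∈-coeffs _)))
  ... | yes refl with normalise k c (λ e → c≢0 (cong (F.0ᶠ ∷_) e))
  ...   | a , a≢0 , c∈ = a , a≢0 , ∈-++⁺ʳ (map (F.1ᶠ ∷_) (coeffs k))
        (subst (_∈ map (F.0ᶠ ∷_) (normalised k)) (cong (_∷ Vec.map (a F.*ᶠ_) c) (sym (F.zeroʳᶠ a))) (∈-map⁺ (F.0ᶠ ∷_) c∈))

  -- There are q^(k-1) + ... + q + 1 normalised vectors, and each of the k terms is at most q^(k-1);
  -- the factor q on the left avoids the exponent k - 1.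
  length-normalised : ∀ k → q * length (normalised k) ≤ k * q ^ k
  length-normalised zero    = ≤-reflexive (*-zeroʳ q)
  length-normalised (suc k) = begin
    q * length (normalised (suc k))                     ≡⟨ cong (q *_) (≡.trans (length-++ (map (F.1ᶠ ∷_) (coeffs k)))
                                                             (cong₂ _+_ (≡.trans (length-map _ (coeffs k)) (length-coeffs k)) (length-map _ (normalised k)))) ⟩
    q * (q ^ k + length (normalised k))                 ≡⟨ *-distribˡ-+ q (q ^ k) _ ⟩
    q * q ^ k + q * length (normalised k)               ≤⟨ +-monoʳ-≤ (q * q ^ k) (length-normalised k) ⟩
    q * q ^ k + k * q ^ k                               ≤⟨ +-monoʳ-≤ (q * q ^ k) (*-monoʳ-≤ k (m≤n*m (q ^ k) q)) ⟩
    q * q ^ k + k * (q * q ^ k)                         ∎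
    where
    open ≤-Reasoning
    instance
      _ : NonZero q
      _ = >-nonZero (≤-trans (s≤s z≤n) F.two≤q)

record FiniteSubspace {q : ℕ} {K : FiniteField q} (W : VectorSpace K) : Set where
  open VectorSpace W
  field
    members   : List V
    unique    : Unique members
    0∈        : 0v ∈ members
    ⊕-closed  : ∀ {x y} → x ∈ members → y ∈ members → x ⊕ y ∈ members
    ·-closed  : ∀ a {x} → x ∈ members → a · x ∈ members

module Random {q : ℕ} {K : FiniteField q} {W : VectorSpace K} (S : FiniteSubspace W) where
  open Field K using (0ᶠ; 1ᶠ; _+ᶠ_; _*ᶠ_; -ᶠ_; inverse; _≟_) renaming (Carrier to 𝕂)
  open Linear W
  open FiniteSubspace S renaming (members to U)

  v : ℕ
  v = length U

  comb∈ : ∀ {k} (c : Vec 𝕂 k) {b} → b ∈ tuples U k → comb c b ∈ U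
  comb∈ {k} c {b} b∈ = go c b (∈-vecs⁻ k b∈)
    where
    go : ∀ {k} (c : Vec 𝕂 k) b → (∀ i → lookup b i ∈ U) → comb c b ∈ U
    go []       []       h = 0∈
    go (c ∷ cs) (b ∷ bs) h = ⊕-closed (·-closed c (h fzero)) (go cs bs (h ∘ fsuc))

  ∑-bijection : (g h : V → V) → (∀ {x} → x ∈ U → g x ∈ U) → (∀ {x} → x ∈ U → h x ∈ U) →
    (∀ x → h (g x) ≡ x) → (∀ x → g (h x) ≡ x) → (f : V → ℕ) → ∑ U (f ∘ g) ≡ ∑ U f
  ∑-bijection g h g∈ h∈ hg gh f = ≡.trans (sym (∑-map g U f)) (∑-↭ f (unique-↭
    (Unique.map⁺ (λ {x} {y} e → ≡.trans (sym (hg x)) (≡.trans (cong h e) (hg y))) unique) unique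
    (λ x∈ → let (y , y∈ , e) = ∈-map⁻ g x∈ in subst (_∈ U) (sym e) (g∈ y∈))
    (λ {x} x∈ → subst (_∈ map g U) (gh x) (∈-map⁺ g (h∈ x∈)))))

  ∑-translate : ∀ {w} → w ∈ U → (f : V → ℕ) → ∑ U (λ x → f (w ⊕ x)) ≡ ∑ U f
  ∑-translate {w} w∈ = ∑-bijection (w ⊕_) ((-ᶠ 1ᶠ) · w ⊕_) (⊕-closed w∈) (⊕-closed (·-closed (-ᶠ 1ᶠ) w∈))
    (λ x → ≡.trans (sym (⊕-assoc _ w x)) (≡.trans (cong (_⊕ x) (≡.trans (⊕-comm _ w) (-1· w))) (⊕-identityˡ x)))
    (λ x → ≡.trans (sym (⊕-assoc w _ x)) (≡.trans (cong (_⊕ x) (-1· w)) (⊕-identityˡ x)))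

  ∑-scale : ∀ {a} → a ≢ 0ᶠ → (f : V → ℕ) → ∑ U (λ x → f (a · x)) ≡ ∑ U f
  ∑-scale {a} a≢0 = ∑-bijection (a ·_) (proj₁ (inverse a a≢0) ·_) (·-closed a) (·-closed _)
    (·-undo a a≢0) (·-redo a a≢0)

  ∑-affine : ∀ {a w} → a ≢ 0ᶠ → w ∈ U → (f : V → ℕ) → ∑ U (λ x → f (a · x ⊕ w)) ≡ ∑ U f
  ∑-affine {a} {w} a≢0 w∈ f = ≡.trans (∑-scale a≢0 (λ x → f (x ⊕ w)))
    (≡.trans (∑-cong U (λ x _ → cong f (⊕-comm x w))) (∑-translate w∈ f))

  -- Fix all entries of the tuple except one whose coefficient is nonzero. As that entry runs
  -- through `U`, the combination is an affine bijective image of it and runs through `U` once. The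
  -- factor `v` replaces a division of v^k.
  equidistribution : ∀ k (y : Vec 𝕂 k) → y ≢ replicate k 0ᶠ → (f : V → ℕ) →
    v * ∑ (tuples U k) (λ b → f (comb y b)) ≡ v ^ k * ∑ U f
  equidistribution zero    []       y≢0 f = contradiction refl y≢0
  equidistribution (suc k) (y ∷ ys) y≢0 f with y ≟ 0ᶠ
  ... | no y≠0 = begin
    v * ∑ (tuples U (suc k)) (λ b → f (comb (y ∷ ys) b))          ≡⟨ cong (v *_) (∑-cartesian _∷_ U (tuples U k) _) ⟩
    v * ∑ U (λ b → ∑ (tuples U k) (λ bs → f (y · b ⊕ comb ys bs))) ≡⟨ cong (v *_) (∑-swap U (tuples U k) _) ⟩
    v * ∑ (tuples U k) (λ bs → ∑ U (λ b → f (y · b ⊕ comb ys bs))) ≡⟨ cong (v *_) (∑-cong (tuples U k)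
                                                                       (λ bs bs∈ → ∑-affine y≠0 (comb∈ ys bs∈) f)) ⟩
    v * ∑ (tuples U k) (λ _ → ∑ U f)                              ≡⟨ cong (v *_) (∑-const (tuples U k) _) ⟩
    v * (length (tuples U k) * ∑ U f)                             ≡⟨ cong (λ l → v * (l * ∑ U f)) (length-tuples U k) ⟩
    v * (v ^ k * ∑ U f)                                           ≡⟨ *-assoc v (v ^ k) _ ⟨
    v ^ suc k * ∑ U f                                             ∎
    where open ≡.≡-Reasoning
  ... | yes refl = begin
    v * ∑ (tuples U (suc k)) (λ b → f (comb (0ᶠ ∷ ys) b))         ≡⟨ cong (v *_) (∑-cartesian _∷_ U (tuples U k) _) ⟩
    v * ∑ U (λ b → ∑ (tuples U k) (λ bs → f (0ᶠ · b ⊕ comb ys bs))) ≡⟨ cong (v *_) (∑-cong U (λ b _ → ∑-cong (tuples U k)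
                                                                       (λ bs _ → cong f (≡.trans (cong (_⊕ comb ys bs) (·-zeroˡ b)) (⊕-identityˡ _))))) ⟩
    v * ∑ U (λ b → ∑ (tuples U k) (λ bs → f (comb ys bs)))         ≡⟨ cong (v *_) (∑-const U _) ⟩
    v * (v * ∑ (tuples U k) (λ bs → f (comb ys bs)))               ≡⟨ cong (v *_) (equidistribution k ys (λ e → y≢0 (cong (0ᶠ ∷_) e)) f) ⟩
    v * (v ^ k * ∑ U f)                                            ≡⟨ *-assoc v (v ^ k) _ ⟨
    v ^ suc k * ∑ U f                                              ∎
    where open ≡.≡-Reasoning

  -- For matrices `Low` will mean rank at most r; for coefficient vectors it will mean being zero,
  -- and then `Good` means linearly independent.
  module Avoiding {Low : V → Set} (Low? : ∀ x → Dec (Low x))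
                  (Low-scale : ∀ {a x} → a ≢ 0ᶠ → Low x → Low (a · x)) where

    low : V → ℕ
    low x = ⟦ Low? x ⟧

    ℓ : ℕ
    ℓ = ∑ U low

    Good : ∀ {k} → Vec V k → Set
    Good {k} b = ∀ c → c ≢ replicate k 0ᶠ → ¬ Low (comb c b)

    Good? : ∀ {k} (b : Vec V k) → Dec (Good b)
    Good? {k} b = map′ (λ h c c≢0 → [ (λ e → contradiction e c≢0) , id ]′ (All.lookup h (∈-coeffs {K = K} c)))
      (λ g → All.tabulate (λ {c} _ → dec g c))
      (All.all? (λ c → (VectorSpace._≟ᵥ_ (Coeffs {K = K} k) c (replicate k 0ᶠ)) ⊎-dec ¬? (Low? (comb c b))) (coeffs {K = K} k))
      where
      dec : Good b → ∀ c → c ≡ replicate k 0ᶠ ⊎ ¬ Low (comb c b)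
      dec g c with VectorSpace._≟ᵥ_ (Coeffs {K = K} k) c (replicate k 0ᶠ)
      ... | yes e = inj₁ e
      ... | no ne = inj₂ (g c ne)

    goodCount : ℕ → ℕ
    goodCount k = ∑ (tuples U k) (λ b → ⟦ Good? b ⟧)

    -- A tuple that is not good has a low combination whose coefficients may be normalised, since
    -- `Low` is stable under scaling. Thus 1 is at most the indicator of `Good` plus the number of
    -- low normalised combinations; sum over all tuples and apply `equidistribution`.
    union-bound : ∀ k → v * v ^ k ≤ v * goodCount k + length (normalised {K = K} k) * (v ^ k * ℓ)
    union-bound k = begin
      v * v ^ k
        ≡⟨ cong (v *_) (≡.trans (sym (length-tuples U k)) (length-∑ (tuples U k))) ⟩
      v * ∑ (tuples U k) (λ _ → 1)
        ≤⟨ *-monoʳ-≤ v (∑-mono (tuples U k) (λ b _ → hit b)) ⟩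
      v * ∑ (tuples U k) (λ b → ⟦ Good? b ⟧ + ∑ N (λ c → low (comb c b)))
        ≡⟨ cong (v *_) (∑-+ (tuples U k) _ _) ⟩
      v * (goodCount k + ∑ (tuples U k) (λ b → ∑ N (λ c → low (comb c b))))
        ≡⟨ *-distribˡ-+ v (goodCount k) _ ⟩
      v * goodCount k + v * ∑ (tuples U k) (λ b → ∑ N (λ c → low (comb c b)))
        ≡⟨ cong (λ s → v * goodCount k + s) (≡.trans (cong (v *_) (∑-swap (tuples U k) N _)) (sym (∑-* N v _))) ⟩
      v * goodCount k + ∑ N (λ c → v * ∑ (tuples U k) (λ b → low (comb c b)))
        ≡⟨ cong (v * goodCount k +_) (≡.trans (∑-cong N (λ c c∈ → equidistribution k c (normalised-nonzero {K = K} k c∈) low)) (∑-const N _)) ⟩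
      v * goodCount k + length N * (v ^ k * ℓ) ∎
      where
      open ≤-Reasoning
      N = normalised {K = K} k
      hit : ∀ b → 1 ≤ ⟦ Good? b ⟧ + ∑ N (λ c → low (comb c b))
      hit b with Good? b
      ... | yes _ = s≤s z≤n
      ... | no bad with ∑ N (λ c → low (comb c b)) in e
      ...   | suc _ = s≤s z≤n
      ...   | zero  = contradiction good bad
        where
        good : Good b
        good c c≢0 l with normalise {K = K} k c c≢0
        ... | a , a≢0 , c∈ = contradiction (∑-single (λ c → low (comb c b)) c∈)
          (<⇒≱ (subst₂ _<_ (sym e) (sym (⟦⟧-yes (Low? _) (subst Low (sym (comb-· a c b)) (Low-scale a≢0 l)))) (s≤s z≤n)))

    module SecondMoment (k : ℕ) where

      p total : ℕ
      p = length (coeffs {K = K} k)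
      total = v ^ suc k

      -- Two different coefficient vectors with first entry 1 are never proportional, which makes
      -- the hits pairwise independent.
      hit : Vec 𝕂 k → Vec V (suc k) → ℕ
      hit x b = low (comb (1ᶠ ∷ x) b)

      hits : Vec V (suc k) → ℕ
      hits b = ∑ (coeffs {K = K} k) (λ x → hit x b)

      bs : List (Vec V (suc k))
      bs = tuples U (suc k)

      hit-mean : ∀ x → v * ∑ bs (hit x) ≡ total * ℓ
      hit-mean x = equidistribution (suc k) (1ᶠ ∷ x) (λ e → Field.0≢1 K (sym (Vec.∷-injectiveˡ e))) low

      first-moment : v * ∑ bs hits ≡ p * (total * ℓ)
      first-moment = ≡.trans (cong (v *_) (∑-swap bs (coeffs {K = K} k) (λ b x → hit x b)))
        (≡.trans (sym (∑-* (coeffs {K = K} k) v _))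
        (≡.trans (∑-cong (coeffs {K = K} k) (λ x _ → hit-mean x)) (∑-const (coeffs {K = K} k) _)))

      private
        neg : Vec 𝕂 k → Vec 𝕂 k
        neg = VectorSpace.⊖_ (Coeffs {K = K} k)
        module C = Linear (Coeffs {K = K} k)

      -- The correction term does not involve `b₀`, so the randomness of `b₀` and that of `B` can be
      -- used one after the other.
      difference : ∀ (x x′ : Vec 𝕂 k) b₀ (B : Vec V k) →
        1ᶠ · b₀ ⊕ comb x′ B ≡ (1ᶠ · b₀ ⊕ comb x B) ⊕ comb (zipWith _+ᶠ_ x′ (neg x)) B
      difference x x′ b₀ B = sym (≡.trans (⊕-assoc _ _ _) (cong (1ᶠ · b₀ ⊕_) (≡.trans (sym (comb-⊕ x _ B))
        (cong (λ c → comb c B) (≡.trans (C.⊕-comm x _) (≡.trans (C.⊕-assoc x′ (neg x) x)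
          (≡.trans (cong (zipWith _+ᶠ_ x′) (C.⊕-inverseˡ x)) (C.⊕-identityʳ x′))))))))

      -- For fixed `B`, averaging over `b₀` makes the first combination a uniform z. The second is z
      -- plus the combination of `B` with coefficients d = x′ - x ≠ 0, which for fixed z is uniform
      -- as `B` varies.
      pair-distinct : ∀ x x′ → x ≢ x′ → v * (v * ∑ bs (λ b → hit x b * hit x′ b)) ≡ total * (ℓ * ℓ)
      pair-distinct x x′ ne = begin
        v * (v * ∑ bs (λ b → hit x b * hit x′ b))
          ≡⟨ cong (λ s → v * (v * s)) (≡.trans (∑-cartesian _∷_ U (tuples U k) _) (∑-swap U (tuples U k) _)) ⟩
        v * (v * ∑ (tuples U k) (λ B → ∑ U (λ b₀ → low (1ᶠ · b₀ ⊕ comb x B) * low (1ᶠ · b₀ ⊕ comb x′ B))))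
          ≡⟨ cong (λ s → v * (v * s)) (∑-cong (tuples U k) λ B B∈ → ≡.trans
               (∑-cong U (λ b₀ _ → cong (λ z → low (1ᶠ · b₀ ⊕ comb x B) * low z) (difference x x′ b₀ B)))
               (∑-affine (λ e → Field.0≢1 K (sym e)) (comb∈ x B∈) (λ z → low z * low (z ⊕ comb d B)))) ⟩
        v * (v * ∑ (tuples U k) (λ B → ∑ U (λ z → low z * low (z ⊕ comb d B))))
          ≡⟨ cong (λ s → v * (v * s)) (≡.trans (∑-swap (tuples U k) U _) (∑-cong U (λ z _ → ∑-* (tuples U k) (low z) _))) ⟩
        v * (v * ∑ U (λ z → low z * ∑ (tuples U k) (λ B → low (z ⊕ comb d B))))
          ≡⟨ cong (v *_) (≡.trans (sym (∑-* U v _)) (∑-cong U (λ z _ → lem v (low z) _))) ⟩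
        v * ∑ U (λ z → low z * (v * ∑ (tuples U k) (λ B → low (z ⊕ comb d B))))
          ≡⟨ cong (v *_) (∑-cong U (λ z z∈ → cong (low z *_) (≡.trans
               (equidistribution k d d≢0 (λ w → low (z ⊕ w))) (cong (v ^ k *_) (∑-translate z∈ low))))) ⟩
        v * ∑ U (λ z → low z * (v ^ k * ℓ))
          ≡⟨ cong (v *_) (∑-*ʳ U _ low) ⟩
        v * (ℓ * (v ^ k * ℓ))
          ≡⟨ lem₂ v ℓ (v ^ k) ⟩
        total * (ℓ * ℓ) ∎
        where
        open ≡.≡-Reasoning
        d = zipWith _+ᶠ_ x′ (neg x)
        d≢0 : d ≢ replicate k 0ᶠ
        d≢0 e = ne (C.⊕-cancelʳ (neg x) (≡.trans (C.⊕-inverseʳ x) (sym e)))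
        lem : ∀ a b c → a * (b * c) ≡ b * (a * c)
        lem = ℕR.solve-∀
        lem₂ : ∀ a b c → a * (b * (c * b)) ≡ a * c * (b * b)
        lem₂ = ℕR.solve-∀

      _≟c_ : DecidableEquality (Vec 𝕂 k)
      _≟c_ = VectorSpace._≟ᵥ_ (Coeffs {K = K} k)

      pair : ∀ x x′ → v * (v * ∑ bs (λ b → hit x b * hit x′ b)) ≤ total * (ℓ * ℓ) + ⟦ x ≟c x′ ⟧ * (v * (total * ℓ))
      pair x x′ with x ≟c x′
      ... | no ne = ≤-trans (≤-reflexive (pair-distinct x x′ ne)) (m≤m+n _ _)
      ... | yes refl = ≤-trans (*-monoʳ-≤ v (≤-trans (*-monoʳ-≤ v (∑-mono bs (λ b _ → idem b))) (≤-reflexive (hit-mean x))))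
              (≤-trans (≤-reflexive (sym (*-identityˡ (v * (total * ℓ))))) (m≤n+m _ (total * (ℓ * ℓ))))
        where
        idem : ∀ b → hit x b * hit x b ≤ hit x b
        idem b = ≤-trans (*-monoʳ-≤ (hit x b) (⟦⟧≤1 (Low? (comb (1ᶠ ∷ x) b)))) (≤-reflexive (*-identityʳ _))

      second-moment : v * (v * ∑ bs (λ b → hits b * hits b)) ≤ p * (p * (total * (ℓ * ℓ)) + v * (total * ℓ))
      second-moment = begin
        v * (v * ∑ bs (λ b → hits b * hits b))
          ≡⟨ cong (λ s → v * (v * s)) (∑-cong bs (λ b _ → square b)) ⟩
        v * (v * ∑ bs (λ b → ∑ cs (λ x → ∑ cs (λ x′ → hit x b * hit x′ b))))
          ≡⟨ cong (λ s → v * (v * s)) (≡.trans (∑-swap bs cs _) (∑-cong cs (λ x _ → ∑-swap bs cs _))) ⟩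
        v * (v * ∑ cs (λ x → ∑ cs (λ x′ → ∑ bs (λ b → hit x b * hit x′ b))))
          ≡⟨ push _ ⟩
        ∑ cs (λ x → ∑ cs (λ x′ → v * (v * ∑ bs (λ b → hit x b * hit x′ b))))
          ≤⟨ ∑-mono cs (λ x _ → ≤-trans (∑-mono cs (λ x′ _ → pair x x′)) (diagonal x)) ⟩
        ∑ cs (λ _ → p * (total * (ℓ * ℓ)) + v * (total * ℓ))
          ≡⟨ ∑-const cs _ ⟩
        p * (p * (total * (ℓ * ℓ)) + v * (total * ℓ)) ∎
        where
        open ≤-Reasoning
        cs = coeffs {K = K} k
        square : ∀ b → hits b * hits b ≡ ∑ cs (λ x → ∑ cs (λ x′ → hit x b * hit x′ b))
        square b = ≡.trans (sym (∑-*ʳ cs (hits b) (λ x → hit x b)))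
          (∑-cong cs (λ x _ → sym (∑-* cs (hit x b) (λ x′ → hit x′ b))))
        push : (f : Vec 𝕂 k → Vec 𝕂 k → ℕ) →
          v * (v * ∑ cs (λ x → ∑ cs (f x))) ≡ ∑ cs (λ x → ∑ cs (λ x′ → v * (v * f x x′)))
        push f = sym (≡.trans (∑-cong cs (λ x _ → ≡.trans (∑-* cs v _) (cong (v *_) (∑-* cs v _))))
          (≡.trans (∑-* cs v _) (cong (v *_) (∑-* cs v _))))
        diagonal : ∀ x → ∑ cs (λ x′ → total * (ℓ * ℓ) + ⟦ x ≟c x′ ⟧ * (v * (total * ℓ))) ≤ p * (total * (ℓ * ℓ)) + v * (total * ℓ)
        diagonal x = ≤-trans (≤-reflexive (∑-+ cs _ _)) (+-mono-≤ (≤-reflexive (∑-const cs _))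
          (≤-trans (≤-reflexive (∑-*ʳ cs _ _)) (≤-trans (*-monoˡ-≤ (v * (total * ℓ)) one) (≤-reflexive (*-identityˡ _)))))
          where
          one : ∑ cs (λ x′ → ⟦ x ≟c x′ ⟧) ≤ 1
          one = count≤1 {Q = λ _ → x ≡ x} (x ≟c_) cs (All.tabulate (λ _ → refl)) (coeffs-unique {K = K} k) (λ {y} {z} _ _ e e′ → ≡.trans (sym e) e′)

      -- The Chebyshev-type bound P(hits = 0) ≤ 1 / (1 + E hits), where E hits = p ℓ / v,
      -- from 2 c v X + c² [X = 0] ≤ (v X)² + c² with c = v + p ℓ.
      second-moment-bound : goodCount (suc k) * (v + p * ℓ) ≤ total * v
      second-moment-bound = *-cancelʳ-≤ _ _ c {{>-nonZero c>0}} (+-cancelˡ-≤ (2 * c * (p * (total * ℓ))) _ _ (begin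
        2 * c * (p * (total * ℓ)) + g * c * c
          ≡⟨ cong₂ _+_ (≡.trans (cong (2 * c *_) (sym first-moment)) (≡.trans (lem₁ c v _) (sym (∑-* bs (2 * c * v) hits)))) (*-assoc g c c) ⟩
        ∑ bs (λ b → 2 * c * v * hits b) + g * (c * c)
          ≡⟨ cong (∑ bs (λ b → 2 * c * v * hits b) +_) (∑-*ʳ bs (c * c) (λ b → ⟦ Good? b ⟧)) ⟨
        ∑ bs (λ b → 2 * c * v * hits b) + ∑ bs (λ b → ⟦ Good? b ⟧ * (c * c))
          ≡⟨ ∑-+ bs _ _ ⟨
        ∑ bs (λ b → 2 * c * v * hits b + ⟦ Good? b ⟧ * (c * c))
          ≤⟨ ∑-mono bs (λ b _ → pointwise b) ⟩
        ∑ bs (λ b → v * (v * (hits b * hits b)) + c * c)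
          ≡⟨ ∑-+ bs _ _ ⟩
        ∑ bs (λ b → v * (v * (hits b * hits b))) + ∑ bs (λ _ → c * c)
          ≡⟨ cong₂ _+_ (≡.trans (∑-* bs v _) (cong (v *_) (∑-* bs v _)))
                       (≡.trans (∑-const bs _) (cong (_* (c * c)) (length-tuples U (suc k)))) ⟩
        v * (v * ∑ bs (λ b → hits b * hits b)) + total * (c * c)
          ≤⟨ +-monoˡ-≤ _ second-moment ⟩
        p * (p * (total * (ℓ * ℓ)) + v * (total * ℓ)) + total * (c * c)
          ≡⟨ lem₂ p total ℓ v ⟩
        2 * c * (p * (total * ℓ)) + total * v * c ∎))
        where
        open ≤-Reasoning
        g = goodCount (suc k)
        c = v + p * ℓ
        c>0 : 0 < c
        c>0 = ≤-trans (≤-trans (∑-single (λ _ → 1) 0∈) (≤-reflexive (sym (length-∑ U)))) (m≤m+n v _)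
        lem₁ : ∀ c v s → 2 * c * (v * s) ≡ 2 * c * v * s
        lem₁ = ℕR.solve-∀
        lem₂ : ∀ p total ℓ v → p * (p * (total * (ℓ * ℓ)) + v * (total * ℓ)) + total * ((v + p * ℓ) * (v + p * ℓ))
             ≡ 2 * (v + p * ℓ) * (p * (total * ℓ)) + total * v * (v + p * ℓ)
        lem₂ = ℕR.solve-∀
        am-gm : ∀ a b → 2 * (a * b) ≤ a * a + b * b
        am-gm a b with ≤-total a b
        ... | inj₁ le = subst (λ b → 2 * (a * b) ≤ a * a + b * b) (m+[n∸m]≡n le) (sq a (b ∸ a))
          where
          eq : ∀ a s → 2 * (a * (a + s)) + s * s ≡ a * a + (a + s) * (a + s)
          eq = ℕR.solve-∀
          sq : ∀ a s → 2 * (a * (a + s)) ≤ a * a + (a + s) * (a + s)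
          sq a s = ≤-trans (m≤m+n _ (s * s)) (≤-reflexive (eq a s))
        ... | inj₂ le = subst (λ a → 2 * (a * b) ≤ a * a + b * b) (m+[n∸m]≡n le) (sq b (a ∸ b))
          where
          eq : ∀ b s → 2 * ((b + s) * b) + s * s ≡ (b + s) * (b + s) + b * b
          eq = ℕR.solve-∀
          sq : ∀ b s → 2 * ((b + s) * b) ≤ (b + s) * (b + s) + b * b
          sq b s = ≤-trans (m≤m+n _ (s * s)) (≤-reflexive (eq b s))
        no-hits : ∀ b → Good b → hits b ≡ 0
        no-hits b good = ≡.trans (∑-cong (coeffs {K = K} k) (λ x _ → ⟦⟧-no (Low? _)
            (good (1ᶠ ∷ x) (λ e → Field.0≢1 K (sym (Vec.∷-injectiveˡ e))))))
          (≡.trans (∑-const (coeffs {K = K} k) 0) (*-zeroʳ p))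
        pointwise : ∀ b → 2 * c * v * hits b + ⟦ Good? b ⟧ * (c * c) ≤ v * (v * (hits b * hits b)) + c * c
        pointwise b with Good? b
        ... | yes good rewrite no-hits b good = ≤-reflexive (eq c v)
          where
          eq : ∀ c v → 2 * c * v * 0 + (1 * (c * c)) ≡ v * (v * 0) + c * c
          eq = ℕR.solve-∀
        ... | no _ = ≤-trans (≤-reflexive (eq₁ c v (hits b))) (≤-trans (am-gm (v * hits b) c) (≤-reflexive (eq₂ c v (hits b))))
          where
          eq₁ : ∀ c v x → 2 * c * v * x + 0 ≡ 2 * (v * x * c)
          eq₁ = ℕR.solve-∀
          eq₂ : ∀ c v x → v * x * (v * x) + c * c ≡ v * (v * (x * x)) + c * c
          eq₂ = ℕR.solve-∀

-- Independence and rank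

module Matrices {q : ℕ} (K : FiniteField q) where
  open Field K renaming (Carrier to 𝕂)

  Σᶠ-cong : ∀ {k} {f g : Fin k → 𝕂} → (∀ l → f l ≡ g l) → Σᶠ K f ≡ Σᶠ K g
  Σᶠ-cong {zero}  h = refl
  Σᶠ-cong {suc k} h = cong₂ _+ᶠ_ (h fzero) (Σᶠ-cong (h ∘ fsuc))

  Σᶠ-+ : ∀ {k} (f g : Fin k → 𝕂) → Σᶠ K (λ l → f l +ᶠ g l) ≡ Σᶠ K f +ᶠ Σᶠ K g
  Σᶠ-+ {zero}  f g = sym (+ᶠ-identityˡ 0ᶠ)
  Σᶠ-+ {suc k} f g = ≡.trans (cong (_ +ᶠ_) (Σᶠ-+ (f ∘ fsuc) (g ∘ fsuc))) (Linear.⊕-interchange (scalars K) _ _ _ _)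

  Σᶠ-*ˡ : ∀ {k} a (f : Fin k → 𝕂) → Σᶠ K (λ l → a *ᶠ f l) ≡ a *ᶠ Σᶠ K f
  Σᶠ-*ˡ {zero}  a f = sym (zeroʳᶠ a)
  Σᶠ-*ˡ {suc k} a f = ≡.trans (cong (_ +ᶠ_) (Σᶠ-*ˡ a (f ∘ fsuc))) (sym (distribˡᶠ a _ _))

  Σᶠ-*ʳ : ∀ {k} a (f : Fin k → 𝕂) → Σᶠ K (λ l → f l *ᶠ a) ≡ Σᶠ K f *ᶠ a
  Σᶠ-*ʳ a f = ≡.trans (Σᶠ-cong (λ l → *ᶠ-comm (f l) a)) (≡.trans (Σᶠ-*ˡ a f) (*ᶠ-comm a _))

  Σᶠ-zero : ∀ {k} {f : Fin k → 𝕂} → (∀ l → f l ≡ 0ᶠ) → Σᶠ K f ≡ 0ᶠ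
  Σᶠ-zero {zero}  h = refl
  Σᶠ-zero {suc k} h = ≡.trans (cong₂ _+ᶠ_ (h fzero) (Σᶠ-zero (h ∘ fsuc))) (+ᶠ-identityˡ 0ᶠ)

  Σᶠ-swap : ∀ {k l} (f : Fin k → Fin l → 𝕂) → Σᶠ K (λ i → Σᶠ K (f i)) ≡ Σᶠ K (λ j → Σᶠ K (λ i → f i j))
  Σᶠ-swap {zero}  f = sym (Σᶠ-zero {f = λ j → Σᶠ K (λ i → f i j)} (λ _ → refl))
  Σᶠ-swap {suc k} f = ≡.trans (cong (Σᶠ K (f fzero) +ᶠ_) (Σᶠ-swap (f ∘ fsuc))) (sym (Σᶠ-+ (f fzero) (λ j → Σᶠ K (λ i → f (fsuc i) j))))

  ext : ∀ {A : Set} {k} {x y : Vec A k} → (∀ i → lookup x i ≡ lookup y i) → x ≡ y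
  ext {x = []}    {[]}    h = refl
  ext {x = x ∷ _} {y ∷ _} h = cong₂ _∷_ (h fzero) (ext (h ∘ fsuc))

  minus-zero : ∀ {x y} → x +ᶠ ((-ᶠ 1ᶠ) *ᶠ y) ≡ 0ᶠ → x ≡ y
  minus-zero {x} {y} e = ⊕-cancelʳ ((-ᶠ 1ᶠ) *ᶠ y) (≡.trans e (sym (-1· y)))
    where open Linear (scalars K) using (⊕-cancelʳ; -1·)

  Indep : ∀ {m s} → (Fin s → Fin m → 𝕂) → Set
  Indep = LinIndepVecs K

  indep-cong : ∀ {m s} {u w : Fin s → Fin m → 𝕂} → (∀ l j → u l j ≡ w l j) → Indep u → Indep w
  indep-cong h ind c e = ind c (λ j → ≡.trans (Σᶠ-cong (λ l → cong (c l *ᶠ_) (h l j))) (e j))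

  indep? : ∀ {m s} (u : Fin s → Fin m → 𝕂) → Dec (Indep u)
  indep? {m} {s} u = map′
    (λ h c e l → ≡.trans (sym (Vec.lookup∘tabulate c l)) (All.lookup h (∈-coeffs {K = K} (tabulate c))
      (λ j → ≡.trans (Σᶠ-cong (λ l → cong (_*ᶠ u l j) (Vec.lookup∘tabulate c l))) (e j)) l))
    (λ ind → All.tabulate (λ {c} _ → ind (lookup c)))
    (All.all? (λ c → Fin.all? (λ j → Σᶠ K (λ l → lookup c l *ᶠ u l j) ≟ 0ᶠ) →-dec Fin.all? (λ l → lookup c l ≟ 0ᶠ)) (coeffs {K = K} s))

  -- Counting takes the place of the exchange lemma: an injection forces q^s ≤ q^r, and q ≥ 2.
  injective-dim : ∀ {s r} (f : Vec 𝕂 s → Vec 𝕂 r) → (∀ {c d} → f c ≡ f d → c ≡ d) → s ≤ r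
  injective-dim {s} {r} f inj with s ≤? r
  ... | yes le = le
  ... | no ¬le = contradiction
    (subst₂ _≤_ (≡.trans (length-map f (coeffs {K = K} s)) (length-coeffs {K = K} s)) (length-coeffs {K = K} r)
      (unique-length≤ (Unique.map⁺ inj (coeffs-unique {K = K} s)) (λ {x} _ → ∈-coeffs {K = K} x)))
    (<⇒≱ (^-monoʳ-< q two≤q (≰⇒> ¬le)))

  indep-injective : ∀ {m s} {u : Fin s → Fin m → 𝕂} → Indep u → {c d : Fin s → 𝕂} →
    (∀ j → Σᶠ K (λ l → c l *ᶠ u l j) ≡ Σᶠ K (λ l → d l *ᶠ u l j)) → ∀ l → c l ≡ d l
  indep-injective {s = s} {u} ind {c} {d} e l = minus-zero (ind (λ l → c l +ᶠ ((-ᶠ 1ᶠ) *ᶠ d l)) zero-comb l)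
    where
    zero-comb : ∀ j → Σᶠ K (λ l → (c l +ᶠ ((-ᶠ 1ᶠ) *ᶠ d l)) *ᶠ u l j) ≡ 0ᶠ
    zero-comb j = begin
      Σᶠ K (λ l → (c l +ᶠ ((-ᶠ 1ᶠ) *ᶠ d l)) *ᶠ u l j)
        ≡⟨ Σᶠ-cong {s} (λ l → ≡.trans (distribʳᶠ (u l j) (c l) _) (cong ((c l *ᶠ u l j) +ᶠ_) (*ᶠ-assoc _ _ _))) ⟩
      Σᶠ K (λ l → (c l *ᶠ u l j) +ᶠ ((-ᶠ 1ᶠ) *ᶠ (d l *ᶠ u l j)))
        ≡⟨ Σᶠ-+ {s} (λ l → c l *ᶠ u l j) _ ⟩
      Σᶠ K (λ l → c l *ᶠ u l j) +ᶠ Σᶠ K (λ l → (-ᶠ 1ᶠ) *ᶠ (d l *ᶠ u l j))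
        ≡⟨ cong₂ _+ᶠ_ (e j) (Σᶠ-*ˡ {s} (-ᶠ 1ᶠ) (λ l → d l *ᶠ u l j)) ⟩
      Σᶠ K (λ l → d l *ᶠ u l j) +ᶠ ((-ᶠ 1ᶠ) *ᶠ Σᶠ K (λ l → d l *ᶠ u l j))
        ≡⟨ Linear.-1· (scalars K) (Σᶠ K (λ l → d l *ᶠ u l j)) ⟩
      0ᶠ ∎
      where open ≡.≡-Reasoning

  -- A combination of the rows of X Z with coefficients c depends only on c X, so independence makes
  -- c ↦ c X injective.
  indep-factor : ∀ {m s r} {u : Fin s → Fin m → 𝕂} → Indep u →
    (X : Fin s → Fin r → 𝕂) (Z : Fin r → Fin m → 𝕂) → (∀ l j → u l j ≡ Σᶠ K (λ t → X l t *ᶠ Z t j)) → s ≤ r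
  indep-factor {m} {s} {r} {u} ind X Z fac = injective-dim f λ {c} {d} e →
    ext (indep-injective ind {lookup c} {lookup d} (λ j → ≡.trans (through c j) (≡.trans
      (Σᶠ-cong (λ t → cong (_*ᶠ Z t j) (≡.trans (sym (Vec.lookup∘tabulate _ t))
        (≡.trans (cong (λ w → lookup w t) e) (Vec.lookup∘tabulate _ t)))))
      (sym (through d j)))))
    where
    f : Vec 𝕂 s → Vec 𝕂 r
    f c = tabulate (λ t → Σᶠ K (λ l → lookup c l *ᶠ X l t))
    through : ∀ c j → Σᶠ K (λ l → lookup c l *ᶠ u l j) ≡ Σᶠ K (λ t → Σᶠ K (λ l → lookup c l *ᶠ X l t) *ᶠ Z t j)
    through c j = ≡.trans (Σᶠ-cong {s} (λ l → ≡.trans (cong (lookup c l *ᶠ_) (fac l j))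
        (≡.trans (sym (Σᶠ-*ˡ {r} (lookup c l) (λ t → X l t *ᶠ Z t j))) (Σᶠ-cong {r} (λ t → sym (*ᶠ-assoc (lookup c l) (X l t) (Z t j)))))))
      (≡.trans (Σᶠ-swap (λ l t → (lookup c l *ᶠ X l t) *ᶠ Z t j)) (Σᶠ-cong {r} (λ t → Σᶠ-*ʳ {s} (Z t j) (λ l → lookup c l *ᶠ X l t))))

  indep-dim : ∀ {m s} {u : Fin s → Fin m → 𝕂} → Indep u → s ≤ m
  indep-dim {m} {s} {u} ind = injective-dim (λ c → tabulate (λ j → Σᶠ K (λ l → lookup c l *ᶠ u l j)))
    λ {c} {d} e → ext (indep-injective ind {lookup c} {lookup d} (λ j →
      ≡.trans (sym (Vec.lookup∘tabulate _ j)) (≡.trans (cong (λ w → lookup w j) e) (Vec.lookup∘tabulate _ j))))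

  IndepRows : ∀ {n m} → Mat K n m → ℕ → Set
  IndepRows {n} M s = Σ (Fin s → Fin n) λ ρ → Indep (λ l → M (ρ l))

  indepRows? : ∀ {n m} (M : Mat K n m) s → Dec (IndepRows M s)
  indepRows? {n} M s = map′
    (λ a → let (ρ , ind) = Any.satisfied a in lookup ρ , ind)
    (λ { (ρ , ind) → lose (∈-vecs⁺ s {v = tabulate ρ} (λ _ → ∈-allFin _))
           (indep-cong {u = λ l → M (ρ l)} (λ l j → cong (λ i → M i j) (sym (Vec.lookup∘tabulate ρ l))) ind) })
    (Any.any? (λ ρ → indep? (λ l → M (lookup ρ l))) (tuples (allFin n) s))
    where open import Data.List.Membership.Propositional using (lose)

  -- Rank at most r, phrased without computing the rank: a decidable condition that passes easily to
  -- submatrices and multiples. Repeated rows in a selection need no separate exclusion, as they are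
  -- dependent.
  LowRank : ∀ {n m} → ℕ → Mat K n m → Set
  LowRank r M = ¬ IndepRows M (suc r)

  -- `IsRank` demands a maximal number of independent rows. The search raises `s` until s + 1
  -- independent rows no longer exist, and it must stop by s = m because of `indep-dim`.
  highRank : ∀ {n m} (M : Mat K n m) d → ¬ LowRank d M → RankAtLeast K M (suc d)
  highRank {n} {m} M d ¬low with indepRows? M (suc d)
  ... | no low  = contradiction low ¬low
  ... | yes ind = search m (suc d) ind ≤-refl (m≤n+m m (suc d))
    where
    search : ∀ fuel s → IndepRows M s → suc d ≤ s → m ≤ s + fuel → RankAtLeast K M (suc d)
    search fuel s ind le enough with indepRows? M (suc s)
    ... | no none = s , (ind , λ ρ i → none (ρ , i)) , le
    search zero    s ind le enough | yes more = contradiction (indep-dim {u = λ l → M (proj₁ more l)} (proj₂ more)) (<⇒≱ (s≤s (≤-trans enough (≤-reflexive (+-identityʳ s)))))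
    search (suc f) s ind le enough | yes more = search f (suc s) more (m≤n⇒m≤1+n le) (≤-trans enough (≤-reflexive (+-suc s f)))

-- Matrices of low rank supported on a board: upper bound

module Boards {q : ℕ} (K : FiniteField q) (n : ℕ) where
  open Field K renaming (Carrier to 𝕂)
  open Matrices K

  Column : VectorSpace K
  Column = power K (scalars K) n

  open Linear Column using () renaming (_⊕_ to _+ᶜ_; _·_ to _·ᶜ_; 0v to 0ᶜ; ⊕-assoc to +ᶜ-assoc; -1· to -1·ᶜ; ⊕-identityˡ to +ᶜ-identityˡ)

  -- Vectors of columns, in contrast to the functions in `Mat`, have decidable equality determined
  -- by the entries, so they can be listed and counted.
  Mx : ℕ → Set
  Mx m = Vec (Vec 𝕂 n) m

  entries : ∀ {m} → Mx m → Mat K n m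
  entries M i j = lookup (lookup M j) i

  values : Bool → List 𝕂
  values true  = elements
  values false = 0ᶠ ∷ []

  columns : (Fin n → Bool) → List (Vec 𝕂 n)
  columns β = vecs n (λ i → values (β i))

  length-columns : ∀ β → length (columns β) ≡ q ^ count β
  length-columns β = length-vecs q n (λ i → ind (β i)) (λ i → val (β i))
    where
    val : ∀ b → length (values b) ≡ q ^ ind b
    val true  = ≡.trans elements-length (sym (*-identityʳ q))
    val false = refl

  values-unique : ∀ b → Unique (values b)
  values-unique true  = elements-unique
  values-unique false = [] ∷ []

  columns-unique : ∀ β → Unique (columns β)
  columns-unique β = vecs-unique n (λ i → values-unique (β i))

  ∈-columns⁺ : ∀ {β x} → (∀ i → β i ≡ false → lookup x i ≡ 0ᶠ) → x ∈ columns β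
  ∈-columns⁺ {β} {x} h = ∈-vecs⁺ n (λ i → val (β i) (h i))
    where
    val : ∀ b {a} → (b ≡ false → a ≡ 0ᶠ) → a ∈ values b
    val true  h = elements-complete _
    val false h = here (h refl)

  ∈-columns⁻ : ∀ {β x} → x ∈ columns β → ∀ i → β i ≡ false → lookup x i ≡ 0ᶠ
  ∈-columns⁻ {β} {x} x∈ i e with here e′ ← subst (λ b → lookup x i ∈ values b) e (∈-vecs⁻ n x∈ i) = e′

  Supported : ∀ {m} → Board n m → Mx m → Set
  Supported B M = ∀ i j → B i j ≡ false → entries M i j ≡ 0ᶠ

  supported : ∀ {m} → Board n m → List (Mx m)
  supported {m} B = vecs m (λ j → columns (λ i → B i j))

  supported-unique : ∀ {m} (B : Board n m) → Unique (supported B)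
  supported-unique {m} B = vecs-unique m (λ j → columns-unique (λ i → B i j))

  ∈-supported⁺ : ∀ {m} {B : Board n m} {M} → Supported B M → M ∈ supported B
  ∈-supported⁺ {m} {B} h = ∈-vecs⁺ m (λ j → ∈-columns⁺ {λ i → B i j} (λ i → h i j))

  ∈-supported⁻ : ∀ {m} {B : Board n m} {M} → M ∈ supported B → Supported B M
  ∈-supported⁻ {m} {B} M∈ i j = ∈-columns⁻ {λ i → B i j} (∈-vecs⁻ m M∈ j) i

  length-supported : ∀ {m} (B : Board n m) {c} → Heights B c → length (supported B) ≡ q ^ ΣN c
  length-supported {m} B {c} hts = length-vecs q m c (λ j → ≡.trans (length-columns (λ i → B i j)) (cong (q ^_) (hts j)))

  nonzero : List 𝕂
  nonzero = filter (λ x → ¬? (x ≟ 0ᶠ)) elements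

  length-nonzero≤ : length nonzero ≤ q
  length-nonzero≤ = ≤-trans (length-filter (λ x → ¬? (x ≟ 0ᶠ)) elements) (≤-reflexive elements-length)

  length-nonzero≥ : q ∸ 1 ≤ length nonzero
  length-nonzero≥ = ∸-monoˡ-≤ 1 (subst (_≤ suc (length nonzero)) elements-length (unique-length≤ {ys = 0ᶠ ∷ nonzero} elements-unique cover))
    where
    cover : ∀ {x} → x ∈ elements → x ∈ 0ᶠ ∷ nonzero
    cover {x} x∈ with x ≟ 0ᶠ
    ... | yes e = here e
    ... | no ne = there (∈-filter⁺ (λ x → ¬? (x ≟ 0ᶠ)) x∈ ne)

  -- A matrix whose first column has the entry x ≠ 0 in row i₀: the first column
  -- is u with x in row i₀, and subtracting multiples w of it from the other
  -- columns leaves a matrix M which vanishes in row i₀.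
  Pivoted : ℕ → Set
  Pivoted m = 𝕂 × Vec 𝕂 n × Vec 𝕂 m × Mx m

  assemble : ∀ {m} → Fin n → Pivoted m → Mx (suc m)
  assemble i₀ (x , u , w , M) = (u [ i₀ ]≔ x) ∷ zipWith (λ a y → (a ·ᶜ (u [ i₀ ]≔ x)) +ᶜ y) w M

  -- `u` is taken to vanish in row `i₀`, so that the pivot is recorded only in `x` and a matrix is
  -- not described twice.
  pivoted : ∀ {m} → Fin n → (Fin n → Bool) → List (Mx m) → List (Pivoted m)
  pivoted {m} i₀ β L = cartesianProduct nonzero (cartesianProduct (columns (without i₀ β)) (cartesianProduct (coeffs {K = K} m) L))

  length-pivoted : ∀ {m} i₀ β (L : List (Mx m)) →
    length (pivoted i₀ β L) ≡ length nonzero * (q ^ count (without i₀ β) * (q ^ m * length L))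
  length-pivoted {m} i₀ β L = ≡.trans (length-cartesian _,_ nonzero _) (cong (length nonzero *_)
    (≡.trans (length-cartesian _,_ (columns (without i₀ β)) _) (cong₂ _*_ (length-columns (without i₀ β))
      (≡.trans (length-cartesian _,_ (coeffs {K = K} m) L) (cong (_* length L) (length-coeffs {K = K} m))))))

  entries-assemble : ∀ {m} i₀ x u (w : Vec 𝕂 m) M i j →
    entries (assemble i₀ (x , u , w , M)) i (fsuc j) ≡ (lookup w j *ᶠ lookup (u [ i₀ ]≔ x) i) +ᶠ entries M i j
  entries-assemble i₀ x u w M i j =
    ≡.trans (cong (λ y → lookup y i) (Vec.lookup-zipWith (λ a y → (a ·ᶜ (u [ i₀ ]≔ x)) +ᶜ y) j w M))
    (≡.trans (Vec.lookup-zipWith _+ᶠ_ i (lookup w j ·ᶜ (u [ i₀ ]≔ x)) (lookup M j))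
             (cong (_+ᶠ entries M i j) (Vec.lookup-map i (lookup w j *ᶠ_) (u [ i₀ ]≔ x))))

  -- The lists for different pivot rows overlap, since a matrix can be reached from each nonzero
  -- entry of its first column. For an upper bound this costs at most a factor n per column.
  pivots : ∀ {m} → Board n (suc m) → (Fin n → List (Mx m)) → List (Mx (suc m))
  pivots B L = concatMap (λ i₀ → if B i₀ fzero then map (assemble i₀) (pivoted i₀ (λ i → B i fzero) (L i₀)) else []) (allFin n)

  lowRankMatrices : ∀ m → Board n m → ℕ → List (Mx m)
  lowRankMatrices zero    B r       = [] ∷ []
  lowRankMatrices (suc m) B zero    = map (0ᶜ ∷_) (lowRankMatrices m (tail B) zero)
  lowRankMatrices (suc m) B (suc r) =
    map (0ᶜ ∷_) (lowRankMatrices m (tail B) (suc r)) ++ pivots B (λ i₀ → lowRankMatrices m (delete i₀ (tail B)) r)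

  ∈-pivots⁺ : ∀ {m} (B : Board n (suc m)) L {i₀ M} → B i₀ fzero ≡ true →
    M ∈ map (assemble i₀) (pivoted i₀ (λ i → B i fzero) (L i₀)) → M ∈ pivots B L
  ∈-pivots⁺ B L {i₀} {M} e M∈ = ∈-concatMap⁺ _ (lose (∈-allFin i₀)
    (subst (λ b → M ∈ (if b then map (assemble i₀) (pivoted i₀ (λ i → B i fzero) (L i₀)) else [])) (sym e) M∈))

  length-pivots : ∀ {m} (B : Board n (suc m)) L x b → (∀ i₀ → B i₀ fzero ≡ true →
    length (pivoted i₀ (λ i → B i fzero) (L i₀)) * x ≤ b) → length (pivots B L) * x ≤ n * b
  length-pivots B L x b h = begin
    length (pivots B L) * x                  ≡⟨ cong (_* x) (length-concatMap f (allFin n)) ⟩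
    ∑ (allFin n) (λ i₀ → length (f i₀)) * x  ≡⟨ ∑-*ʳ (allFin n) x (λ i₀ → length (f i₀)) ⟨
    ∑ (allFin n) (λ i₀ → length (f i₀) * x)  ≤⟨ ∑-mono (allFin n) (λ i₀ _ → each i₀ (B i₀ fzero) refl) ⟩
    ∑ (allFin n) (λ _ → b)                   ≡⟨ ∑-const (allFin n) b ⟩
    length (allFin n) * b                    ≡⟨ cong (_* b) (length-tabulate {n = n} id) ⟩
    n * b                                    ∎
    where
    open ≤-Reasoning
    f : Fin n → List (Mx _)
    f i₀ = if B i₀ fzero then map (assemble i₀) (pivoted i₀ (λ i → B i fzero) (L i₀)) else []
    each : ∀ i₀ y → B i₀ fzero ≡ y →
      length (if y then map (assemble i₀) (pivoted i₀ (λ i → B i fzero) (L i₀)) else []) * x ≤ b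
    each i₀ false e = z≤n
    each i₀ true  e = ≤-trans (≤-reflexive (cong (_* x) (length-map (assemble i₀) (pivoted i₀ (λ i → B i fzero) (L i₀))))) (h i₀ e)

  private
    shuffle : ∀ a b c d e → a * (b * (c * d)) * e ≡ a * (b * (c * (d * e)))
    shuffle = ℕR.solve-∀

  ΣN-pred : ∀ {m} (c : Fin m → ℕ) → (∀ j → 1 ≤ c j) → ΣN c ≡ m + ΣN (pred ∘ c)
  ΣN-pred {m} c pos = ≡.trans (ΣN-cong (λ j → sym (suc-pred (c j) {{>-nonZero (pos j)}})))
    (≡.trans (ΣN-+ (λ _ → 1) (pred ∘ c)) (cong (_+ ΣN (pred ∘ c)) (≡.trans (ΣN-const m 1) (*-identityʳ m))))

  -- The balance of parameters: the cell lost in the first column is paid for by the pivot entry,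
  -- and the m cells lost in the later columns by the m multipliers.
  pivot-height : ∀ {m} {B : Board n (suc m)} {c} → RightClosed B → Heights B c → ∀ i₀ → B i₀ fzero ≡ true →
    (suc (count (without i₀ (λ i → B i fzero))) ≡ c fzero) × (ΣN (c ∘ fsuc) ≡ m + ΣN (pred ∘ c ∘ fsuc))
  pivot-height {B = B} {c} rc hts i₀ e =
    ≡.trans (count-without (λ i → B i fzero) i₀ t) (hts fzero) ,
    ΣN-pred (c ∘ fsuc) (λ j → subst (1 ≤_) (≡.trans (count-without (λ i → B i (fsuc j)) i₀ (rc i₀ fzero (fsuc j) z≤n t)) (hts (fsuc j))) (s≤s z≤n))
    where
    t = Equivalence.from T-≡ e

  -- The exponent on the left is at most that of either option of `trailing-step`, so each option
  -- fits under the same bound. Every column gives n + 1 options, namely being zero or one of at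
  -- most n pivot rows, whence the constant (n + 1)^m.
  length-lowRankMatrices : ∀ m (B : Board n m) c → RightClosed B → Heights B c → ∀ r →
    length (lowRankMatrices m B r) * q ^ trailing m c r ≤ suc n ^ m * q ^ ΣN c
  length-lowRankMatrices zero    B c rc hts r = ≤-refl
  length-lowRankMatrices (suc m) B c rc hts zero = begin
    length (map (0ᶜ ∷_) L) * q ^ (c fzero + t)  ≡⟨ cong₂ _*_ (length-map _ L) (^-distribˡ-+-* q (c fzero) t) ⟩
    length L * (q ^ c fzero * q ^ t)            ≡⟨ lem (length L) (q ^ c fzero) (q ^ t) ⟩
    q ^ c fzero * (length L * q ^ t)            ≤⟨ *-monoʳ-≤ (q ^ c fzero) (length-lowRankMatrices m (tail B) (c ∘ fsuc) (tail-closed {B = B} rc) (hts ∘ fsuc) zero) ⟩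
    q ^ c fzero * (suc n ^ m * q ^ s)           ≤⟨ *-monoʳ-≤ (q ^ c fzero) (*-monoˡ-≤ (q ^ s) (m≤n*m (suc n ^ m) (suc n))) ⟩
    q ^ c fzero * (suc n ^ suc m * q ^ s)       ≡⟨ lem (q ^ c fzero) (suc n ^ suc m) _ ⟩
    suc n ^ suc m * (q ^ c fzero * q ^ s)       ≡⟨ cong (suc n ^ suc m *_) (^-distribˡ-+-* q (c fzero) s) ⟨
    suc n ^ suc m * q ^ (c fzero + s)           ∎
    where
    open ≤-Reasoning
    L = lowRankMatrices m (tail B) zero
    t = trailing m (c ∘ fsuc) zero
    s = ΣN (c ∘ fsuc)
    lem : ∀ a b c → a * (b * c) ≡ b * (a * c)
    lem = ℕR.solve-∀
  length-lowRankMatrices (suc m) B c rc hts (suc r) = begin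
    length (map (0ᶜ ∷_) L ++ P) * q ^ t
      ≡⟨ cong (_* q ^ t) (≡.trans (length-++ (map (0ᶜ ∷_) L)) (cong (_+ length P) (length-map _ L))) ⟩
    (length L + length P) * q ^ t
      ≡⟨ *-distribʳ-+ (q ^ t) (length L) _ ⟩
    length L * q ^ t + length P * q ^ t
      ≤⟨ +-mono-≤ first second ⟩
    suc n ^ m * q ^ ΣN c + n * (suc n ^ m * q ^ ΣN c)
      ≡⟨ lem₃ n (suc n ^ m) _ ⟩
    suc n ^ suc m * q ^ ΣN c ∎
    where
    open ≤-Reasoning
    lem₃ : ∀ n a x → a * x + n * (a * x) ≡ suc n * a * x
    lem₃ = ℕR.solve-∀
    lem : ∀ a b c → a * (b * c) ≡ b * (a * c)
    lem = ℕR.solve-∀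
    instance
      _ : NonZero q
      _ = >-nonZero (≤-trans (s≤s z≤n) two≤q)
    L = lowRankMatrices m (tail B) (suc r)
    M : Fin n → List (Mx m)
    M i₀ = lowRankMatrices m (delete i₀ (tail B)) r
    P = pivots B M
    t = trailing (suc m) c (suc r)
    t₁ = trailing m (c ∘ fsuc) (suc r)
    t₂ = trailing m (pred ∘ c ∘ fsuc) r
    s = ΣN (c ∘ fsuc)
    first : length L * q ^ t ≤ suc n ^ m * q ^ ΣN c
    first = begin
      length L * q ^ t                    ≤⟨ *-monoʳ-≤ (length L) (^-monoʳ-≤ q (step≤left (c fzero) t₁ t₂)) ⟩
      length L * q ^ (c fzero + t₁)       ≡⟨ cong (length L *_) (^-distribˡ-+-* q (c fzero) t₁) ⟩
      length L * (q ^ c fzero * q ^ t₁)   ≡⟨ lem (length L) (q ^ c fzero) (q ^ t₁) ⟩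
      q ^ c fzero * (length L * q ^ t₁)   ≤⟨ *-monoʳ-≤ (q ^ c fzero) (length-lowRankMatrices m (tail B) (c ∘ fsuc) (tail-closed {B = B} rc) (hts ∘ fsuc) (suc r)) ⟩
      q ^ c fzero * (suc n ^ m * q ^ s)   ≡⟨ lem (q ^ c fzero) (suc n ^ m) _ ⟩
      suc n ^ m * (q ^ c fzero * q ^ s)   ≡⟨ cong (suc n ^ m *_) (^-distribˡ-+-* q (c fzero) s) ⟨
      suc n ^ m * q ^ ΣN c                ∎
    each : ∀ i₀ → B i₀ fzero ≡ true → length (pivoted i₀ (λ i → B i fzero) (M i₀)) * q ^ t ≤ suc n ^ m * q ^ ΣN c
    each i₀ e = begin
      length (pivoted i₀ (λ i → B i fzero) (M i₀)) * q ^ t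
        ≡⟨ cong (_* q ^ t) (length-pivoted i₀ (λ i → B i fzero) (M i₀)) ⟩
      length nonzero * (q ^ h * (q ^ m * length (M i₀))) * q ^ t
        ≡⟨ shuffle (length nonzero) (q ^ h) (q ^ m) (length (M i₀)) (q ^ t) ⟩
      length nonzero * (q ^ h * (q ^ m * (length (M i₀) * q ^ t)))
        ≤⟨ *-mono-≤ length-nonzero≤ (*-monoʳ-≤ (q ^ h) (*-monoʳ-≤ (q ^ m) (≤-trans
             (*-monoʳ-≤ (length (M i₀)) (^-monoʳ-≤ q (step≤right (c fzero) t₁ t₂ (subst (1 ≤_) h≡ (s≤s z≤n)))))
             (length-lowRankMatrices m (delete i₀ (tail B)) (pred ∘ c ∘ fsuc) (delete-closed {B = tail B} i₀ (tail-closed {B = B} rc))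
               (delete-heights {B = B} rc hts i₀ (Equivalence.from T-≡ e)) r)))) ⟩
      q * (q ^ h * (q ^ m * (suc n ^ m * q ^ s₂)))
        ≡⟨ lem₂ q (q ^ h) (q ^ m) (suc n ^ m) (q ^ s₂) ⟩
      suc n ^ m * (q ^ suc h * (q ^ m * q ^ s₂))
        ≡⟨ cong (λ z → suc n ^ m * (q ^ z * (q ^ m * q ^ s₂))) h≡ ⟩
      suc n ^ m * (q ^ c fzero * (q ^ m * q ^ s₂))
        ≡⟨ cong (λ z → suc n ^ m * (q ^ c fzero * z)) (≡.trans (sym (^-distribˡ-+-* q m s₂)) (cong (q ^_) (sym s≡))) ⟩
      suc n ^ m * (q ^ c fzero * q ^ s)
        ≡⟨ cong (suc n ^ m *_) (^-distribˡ-+-* q (c fzero) s) ⟨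
      suc n ^ m * q ^ ΣN c ∎
      where
      h = count (without i₀ (λ i → B i fzero))
      h≡ = proj₁ (pivot-height {B = B} rc hts i₀ e)
      s₂ = ΣN (pred ∘ c ∘ fsuc)
      s≡ = proj₂ (pivot-height {B = B} rc hts i₀ e)
      lem₂ : ∀ q a b c d → q * (a * (b * (c * d))) ≡ c * (q * a * (b * d))
      lem₂ = ℕR.solve-∀
    second : length P * q ^ t ≤ n * (suc n ^ m * q ^ ΣN c)
    second = length-pivots B M (q ^ t) (suc n ^ m * q ^ ΣN c) each

  lowRank-zero : ∀ {m} {M : Mx m} → LowRank 0 (entries M) → ∀ i j → entries M i j ≡ 0ᶠ
  lowRank-zero {m} {M} low i j with entries M i j ≟ 0ᶠ
  ... | yes e = e
  ... | no ne = contradiction ((λ _ → i) , independent) low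
    where
    independent : Indep {m} {1} (λ l → entries M i)
    independent c e fzero = *ᶠ-cancelˡ-nonzero (entries M i j) ne (≡.trans (*ᶠ-comm _ _)
      (≡.trans (sym (+ᶠ-identityʳ _)) (≡.trans (e j) (sym (zeroʳᶠ _)))))

  lowRank-tail : ∀ {m r} {x} {M : Mx m} → LowRank r (entries (x ∷ M)) → LowRank r (entries M)
  lowRank-tail low (ρ , ind) = low (ρ , λ c e → ind c (λ j → e (fsuc j)))

  -- Independent rows of `M` stay independent in the assembled matrix even when row `i₀` joins them:
  -- eliminating with the first column removes row `i₀` from any relation, and then the pivot entry
  -- forces its coefficient to be zero.
  lowRank-assemble : ∀ {m r} i₀ (P : Pivoted m) → let (x , u , w , M) = P in x ≢ 0ᶠ →
    (∀ j → entries M i₀ j ≡ 0ᶠ) → LowRank (suc r) (entries (assemble i₀ P)) → LowRank r (entries M)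
  lowRank-assemble {m} {r} i₀ (x , u , w , M) x≢0 row0 low (ρ , ind) = low (ρ⁺ , ind⁺)
    where
    y = u [ i₀ ]≔ x
    N = assemble i₀ (x , u , w , M)
    ρ⁺ : Fin (suc (suc r)) → Fin n
    ρ⁺ fzero    = i₀
    ρ⁺ (fsuc l) = ρ l
    ind⁺ : Indep (λ l → entries N (ρ⁺ l))
    ind⁺ c e = λ { fzero → c₀≡0 ; (fsuc l) → c≡0 l }
      where
      first : Σᶠ K (λ l → c l *ᶠ lookup y (ρ⁺ l)) ≡ 0ᶠ
      first = e fzero
      row : ∀ l j → entries N (ρ⁺ l) (fsuc j) ≡ (lookup w j *ᶠ lookup y (ρ⁺ l)) +ᶠ entries M (ρ⁺ l) j
      row l j = entries-assemble i₀ x u w M (ρ⁺ l) j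
      -- A later column of `N` is a multiple of the first column plus the column of `M`, and the
      -- relation already holds in the first column.
      rest⁺ : ∀ j → Σᶠ K (λ l → c l *ᶠ entries M (ρ⁺ l) j) ≡ 0ᶠ
      rest⁺ j = begin
        Σᶠ K (λ l → c l *ᶠ entries M (ρ⁺ l) j)
          ≡⟨ +ᶠ-identityˡ _ ⟨
        0ᶠ +ᶠ Σᶠ K (λ l → c l *ᶠ entries M (ρ⁺ l) j)
          ≡⟨ cong (_+ᶠ Σᶠ K (λ l → c l *ᶠ entries M (ρ⁺ l) j)) (≡.trans (cong (lookup w j *ᶠ_) first) (zeroʳᶠ (lookup w j))) ⟨
        (lookup w j *ᶠ Σᶠ K (λ l → c l *ᶠ lookup y (ρ⁺ l))) +ᶠ Σᶠ K (λ l → c l *ᶠ entries M (ρ⁺ l) j)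
          ≡⟨ cong (_+ᶠ Σᶠ K (λ l → c l *ᶠ entries M (ρ⁺ l) j)) (Σᶠ-*ˡ {suc (suc r)} (lookup w j) (λ l → c l *ᶠ lookup y (ρ⁺ l))) ⟨
        Σᶠ K (λ l → lookup w j *ᶠ (c l *ᶠ lookup y (ρ⁺ l))) +ᶠ Σᶠ K (λ l → c l *ᶠ entries M (ρ⁺ l) j)
          ≡⟨ Σᶠ-+ {suc (suc r)} (λ l → lookup w j *ᶠ (c l *ᶠ lookup y (ρ⁺ l))) (λ l → c l *ᶠ entries M (ρ⁺ l) j) ⟨
        Σᶠ K (λ l → (lookup w j *ᶠ (c l *ᶠ lookup y (ρ⁺ l))) +ᶠ (c l *ᶠ entries M (ρ⁺ l) j))
          ≡⟨ Σᶠ-cong {suc (suc r)} (λ l → ≡.trans (cong (_+ᶠ (c l *ᶠ entries M (ρ⁺ l) j)) (*ᶠ-leftComm (lookup w j) (c l) (lookup y (ρ⁺ l))))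
               (≡.trans (sym (distribˡᶠ (c l) _ _)) (cong (c l *ᶠ_) (sym (row l j))))) ⟩
        Σᶠ K (λ l → c l *ᶠ entries N (ρ⁺ l) (fsuc j))
          ≡⟨ e (fsuc j) ⟩
        0ᶠ ∎
        where
        open ≡.≡-Reasoning
      rest : ∀ j → Σᶠ K (λ l → c (fsuc l) *ᶠ entries M (ρ l) j) ≡ 0ᶠ
      rest j = ≡.trans (sym (≡.trans (cong (_+ᶠ Σᶠ K (λ l → c (fsuc l) *ᶠ entries M (ρ l) j))
        (≡.trans (cong (c fzero *ᶠ_) (row0 j)) (zeroʳᶠ (c fzero)))) (+ᶠ-identityˡ _))) (rest⁺ j)
      c≡0 : ∀ l → c (fsuc l) ≡ 0ᶠ
      c≡0 = ind (c ∘ fsuc) rest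
      c₀≡0 : c fzero ≡ 0ᶠ
      c₀≡0 = *ᶠ-cancelˡ-nonzero x x≢0 (≡.trans (*ᶠ-comm x (c fzero)) (≡.trans (sym (≡.trans
        (cong₂ _+ᶠ_ (cong (c fzero *ᶠ_) (Vec.lookup∘updateAt i₀ u))
          (Σᶠ-zero {suc r} (λ l → ≡.trans (cong (_*ᶠ lookup y (ρ l)) (c≡0 l)) (zeroˡᶠ _)))) (+ᶠ-identityʳ _)))
        (≡.trans first (sym (zeroʳᶠ x)))))

  ∈-lowRankMatrices : ∀ m (B : Board n m) → RightClosed B → ∀ r (M : Mx m) → Supported B M → LowRank r (entries M) →
    M ∈ lowRankMatrices m B r
  ∈-lowRankMatrices zero    B rc r       []      sup low = here refl
  ∈-lowRankMatrices (suc m) B rc zero    (x ∷ M) sup low =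
    subst (λ y → y ∷ M ∈ map (0ᶜ ∷_) (lowRankMatrices m (tail B) zero))
      (ext (λ i → ≡.trans (Vec.lookup-replicate i 0ᶠ) (sym (lowRank-zero {M = x ∷ M} low i fzero))))
      (∈-map⁺ (0ᶜ ∷_) (∈-lowRankMatrices m (tail B) (tail-closed {B = B} rc) zero M (λ i j → sup i (fsuc j)) (lowRank-tail {x = x} {M} low)))
  ∈-lowRankMatrices (suc m) B rc (suc r) (x ∷ M) sup low with Fin.any? (λ i → ¬? (lookup x i ≟ 0ᶠ))
  ... | no none = ∈-++⁺ˡ (subst (λ y → y ∷ M ∈ map (0ᶜ ∷_) (lowRankMatrices m (tail B) (suc r)))
      (ext (λ i → ≡.trans (Vec.lookup-replicate i 0ᶠ) (sym (zero-entry i))))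
      (∈-map⁺ (0ᶜ ∷_) (∈-lowRankMatrices m (tail B) (tail-closed {B = B} rc) (suc r) M (λ i j → sup i (fsuc j)) (lowRank-tail {x = x} {M} low))))
    where
    zero-entry : ∀ i → lookup x i ≡ 0ᶠ
    zero-entry i with lookup x i ≟ 0ᶠ
    ... | yes e = e
    ... | no ne = contradiction (i , ne) none
  -- Any nonzero entry of the first column can be the pivot; its cell is on the board because the
  -- matrix is supported there.
  ... | yes (i₀ , a≢0) = ∈-++⁺ʳ (map (0ᶜ ∷_) (lowRankMatrices m (tail B) (suc r)))
      (∈-pivots⁺ B (λ i₀ → lowRankMatrices m (delete i₀ (tail B)) r) {i₀} B₀
        (subst (_∈ map (assemble i₀) Ps) P≡ (∈-map⁺ (assemble i₀) P∈)))
    where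
    Ps = pivoted i₀ (λ i → B i fzero) (lowRankMatrices m (delete i₀ (tail B)) r)
    a = lookup x i₀
    a⁻¹ = proj₁ (inverse a a≢0)
    a⁻¹a : ∀ b → (a⁻¹ *ᶠ b) *ᶠ a ≡ b
    a⁻¹a b = ≡.trans (*ᶠ-comm _ a) (≡.trans (sym (*ᶠ-assoc a a⁻¹ b)) (≡.trans (cong (_*ᶠ b) (proj₂ (inverse a a≢0))) (*ᶠ-identityˡ b)))
    B₀ : B i₀ fzero ≡ true
    B₀ with B i₀ fzero in e
    ... | true  = refl
    ... | false = contradiction (sup i₀ fzero e) a≢0
    u = x [ i₀ ]≔ 0ᶠ
    -- These multipliers make row `i₀` vanish after the elimination.
    w = tabulate (λ j → a⁻¹ *ᶠ entries M i₀ j)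
    N = zipWith (λ b y → ((-ᶠ 1ᶠ) ·ᶜ (b ·ᶜ x)) +ᶜ y) w M
    P : Pivoted m
    P = a , u , w , N
    u≡ : u [ i₀ ]≔ a ≡ x
    u≡ = ≡.trans (Vec.[]≔-idempotent x i₀) (Vec.[]≔-lookup x i₀)
    undo : ∀ {m} (w : Vec 𝕂 m) (M : Mx m) →
      zipWith (λ b y → (b ·ᶜ x) +ᶜ y) w (zipWith (λ b y → ((-ᶠ 1ᶠ) ·ᶜ (b ·ᶜ x)) +ᶜ y) w M) ≡ M
    undo []      []      = refl
    undo (b ∷ w) (y ∷ M) = cong₂ _∷_ (≡.trans (sym (+ᶜ-assoc (b ·ᶜ x) _ y))
      (≡.trans (cong (_+ᶜ y) (-1·ᶜ (b ·ᶜ x))) (+ᶜ-identityˡ y))) (undo w M)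
    P≡ : assemble i₀ P ≡ x ∷ M
    P≡ = ≡.trans (cong (λ y → y ∷ zipWith (λ b z → (b ·ᶜ y) +ᶜ z) w N) u≡) (cong (x ∷_) (undo w M))
    N-entry : ∀ i j → entries (x ∷ M) i (fsuc j) ≡ (lookup w j *ᶠ lookup x i) +ᶠ entries N i j
    N-entry i j = ≡.trans (cong (λ Q → entries Q i (fsuc j)) (sym P≡)) (≡.trans (entries-assemble i₀ a u w N i j)
      (cong (λ y → (lookup w j *ᶠ lookup y i) +ᶠ entries N i j) u≡))
    N-row : ∀ j → entries N i₀ j ≡ 0ᶠ
    N-row j = Linear.⊕-cancelˡ (scalars K) (entries M i₀ j) (≡.trans (sym (≡.trans (N-entry i₀ j)
      (cong (_+ᶠ entries N i₀ j) (≡.trans (cong (_*ᶠ a) (Vec.lookup∘tabulate _ j)) (a⁻¹a _))))) (sym (+ᶠ-identityʳ _)))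
    u∈ : u ∈ columns (without i₀ (λ i → B i fzero))
    u∈ = ∈-columns⁺ {without i₀ (λ i → B i fzero)} vanish
      where
      vanish : ∀ i → without i₀ (λ i → B i fzero) i ≡ false → lookup u i ≡ 0ᶠ
      vanish i e with i Fin.≟ i₀
      ... | yes refl = Vec.lookup∘updateAt i₀ x
      ... | no ne    = ≡.trans (Vec.lookup∘updateAt′ i i₀ ne x) (sup i fzero e)
    N-sup : Supported (delete i₀ (tail B)) N
    N-sup i j e with i Fin.≟ i₀
    ... | yes refl = N-row j
    ... | no ne    = ≡.trans (sym (≡.trans (N-entry i j) (≡.trans (cong (_+ᶠ entries N i j)
              (≡.trans (cong (lookup w j *ᶠ_) (sup i fzero off)) (zeroʳᶠ _))) (+ᶠ-identityˡ _)))) (sup i (fsuc j) e)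
      where
      -- By closure to the right, a cell off the board has the first cell of its row off the board
      -- too, so elimination creates no entry outside the board.
      off : B i fzero ≡ false
      off with B i fzero in e₀
      ... | false = refl
      ... | true  = contradiction (subst T e (rc i fzero (fsuc j) z≤n (Equivalence.from T-≡ e₀))) λ ()
    P∈ : P ∈ Ps
    P∈ = ∈-cartesianProduct⁺ (∈-filter⁺ (λ x → ¬? (x ≟ 0ᶠ)) (elements-complete a) a≢0)
      (∈-cartesianProduct⁺ u∈ (∈-cartesianProduct⁺ (∈-coeffs {K = K} w)
        (∈-lowRankMatrices m (delete i₀ (tail B)) (delete-closed {B = tail B} i₀ (tail-closed {B = B} rc)) r N N-sup
          (lowRank-assemble i₀ P a≢0 N-row (subst (λ Q → LowRank (suc r) (entries Q)) (sym P≡) low)))))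

-- Matrices of low rank supported on a board: lower bound

module LowRankCount {q : ℕ} (K : FiniteField q) (n : ℕ) where
  open Field K renaming (Carrier to 𝕂)
  open Matrices K
  open Boards K n
  open Linear (power K (scalars K) n) using () renaming (_⊕_ to _+ᶜ_; _·_ to _·ᶜ_; 0v to 0ᶜ)

  -- A positive certificate for rank at most r, which can be built up one pivot at a time.
  Factors : ∀ {m} → ℕ → Mx m → Set
  Factors {m} r M = Σ (Fin n → Fin r → 𝕂) λ X → Σ (Fin r → Fin m → 𝕂) λ Z →
    ∀ i j → entries M i j ≡ Σᶠ K (λ t → X i t *ᶠ Z t j)

  factors-lowRank : ∀ {m r} {M : Mx m} → Factors r M → LowRank r (entries M)
  factors-lowRank {r = r} {M} (X , Z , fac) (ρ , ind) =
    1+n≰n (indep-factor {u = λ l → entries M (ρ l)} ind (λ l → X (ρ l)) Z (λ l → fac (ρ l)))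

  factors-skip : ∀ {m r} {M : Mx m} → Factors r M → Factors r (0ᶜ ∷ M)
  factors-skip {m} {r} {M} (X , Z , fac) = X , Z′ , fac′
    where
    Z′ : Fin r → Fin (suc m) → 𝕂
    Z′ t fzero    = 0ᶠ
    Z′ t (fsuc j) = Z t j
    fac′ : ∀ i j → entries (0ᶜ ∷ M) i j ≡ Σᶠ K (λ t → X i t *ᶠ Z′ t j)
    fac′ i fzero    = ≡.trans (Vec.lookup-replicate i 0ᶠ) (sym (Σᶠ-zero {r} (λ t → zeroʳᶠ (X i t))))
    fac′ i (fsuc j) = fac i j

  -- The new term is the rank-one product of the pivot column with the row (1, w).
  factors-assemble : ∀ {m r} i₀ x u w {M : Mx m} → Factors r M → Factors (suc r) (assemble i₀ (x , u , w , M))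
  factors-assemble {m} {r} i₀ x u w {M} (X , Z , fac) = X′ , Z′ , fac′
    where
    X′ : Fin n → Fin (suc r) → 𝕂
    X′ i fzero    = lookup (u [ i₀ ]≔ x) i
    X′ i (fsuc t) = X i t
    Z′ : Fin (suc r) → Fin (suc m) → 𝕂
    Z′ fzero    fzero    = 1ᶠ
    Z′ fzero    (fsuc j) = lookup w j
    Z′ (fsuc t) fzero    = 0ᶠ
    Z′ (fsuc t) (fsuc j) = Z t j
    fac′ : ∀ i j → entries (assemble i₀ (x , u , w , M)) i j ≡ Σᶠ K (λ t → X′ i t *ᶠ Z′ t j)
    fac′ i fzero    = sym (≡.trans (cong₂ _+ᶠ_ (≡.trans (*ᶠ-comm _ 1ᶠ) (*ᶠ-identityˡ _)) (Σᶠ-zero {r} (λ t → zeroʳᶠ (X i t)))) (+ᶠ-identityʳ _))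
    fac′ i (fsuc j) = ≡.trans (entries-assemble i₀ x u w M i j) (cong₂ _+ᶠ_ (*ᶠ-comm _ _) (fac i j))

  pivoted-parts : ∀ {m} {i₀ β L x u w} {M : Mx m} → (x , u , w , M) ∈ pivoted i₀ β L →
    x ≢ 0ᶠ × (∀ i → without i₀ β i ≡ false → lookup u i ≡ 0ᶠ) × M ∈ L
  pivoted-parts {m} {i₀} {β} {L} P∈ =
    let (x∈ , P∈′)  = ∈-cartesianProduct⁻ nonzero _ P∈
        (u∈ , P∈″)  = ∈-cartesianProduct⁻ (columns (without i₀ β)) _ P∈′
        (_  , M∈)   = ∈-cartesianProduct⁻ (coeffs {K = K} m) L P∈″
    in proj₂ (∈-filter⁻ (λ x → ¬? (x ≟ 0ᶠ)) {xs = elements} x∈) , ∈-columns⁻ {without i₀ β} u∈ , M∈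

  without-self : ∀ i₀ (β : Fin n → Bool) → without i₀ β i₀ ≡ false
  without-self i₀ β with i₀ Fin.≟ i₀
  ... | yes _ = refl
  ... | no ne = contradiction refl ne

  without-off : ∀ i₀ {β : Fin n → Bool} {i} → β i ≡ false → without i₀ β i ≡ false
  without-off i₀ {β} {i} e with i Fin.≟ i₀
  ... | yes _ = refl
  ... | no _  = e

  -- The first column determines `x` and `u`. Row `i₀` then determines `w`, because `M` vanishes
  -- there and x ≠ 0, and what remains is `M`.
  assemble-injective : ∀ {m} i₀ {x u w M x′ u′ w′} {M′ : Mx m} → x ≢ 0ᶠ →
    lookup u i₀ ≡ 0ᶠ → lookup u′ i₀ ≡ 0ᶠ → (∀ j → entries M i₀ j ≡ 0ᶠ) → (∀ j → entries M′ i₀ j ≡ 0ᶠ) →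
    assemble i₀ (x , u , w , M) ≡ assemble i₀ (x′ , u′ , w′ , M′) → (x , u , w , M) ≡ (x′ , u′ , w′ , M′)
  assemble-injective {m} i₀ {x} {u} {w} {M} {x′} {u′} {w′} {M′} x≢0 u₀ u₀′ r₀ r₀′ e =
    cong₂ _,_ x≡ (cong₂ _,_ u≡ (cong₂ _,_ w≡ M≡))
    where
    y≡ : u [ i₀ ]≔ x ≡ u′ [ i₀ ]≔ x′
    y≡ = Vec.∷-injectiveˡ e
    x≡ : x ≡ x′
    x≡ = ≡.trans (sym (Vec.lookup∘updateAt i₀ u)) (≡.trans (cong (λ y → lookup y i₀) y≡) (Vec.lookup∘updateAt i₀ u′))
    u≡ : u ≡ u′
    u≡ = ext pointwise
      where
      pointwise : ∀ i → lookup u i ≡ lookup u′ i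
      pointwise i with i Fin.≟ i₀
      ... | yes refl = ≡.trans u₀ (sym u₀′)
      ... | no ne    = ≡.trans (sym (Vec.lookup∘updateAt′ i i₀ ne u)) (≡.trans (cong (λ y → lookup y i) y≡) (Vec.lookup∘updateAt′ i i₀ ne u′))
    entry : ∀ i j → (lookup w j *ᶠ lookup (u [ i₀ ]≔ x) i) +ᶠ entries M i j ≡ (lookup w′ j *ᶠ lookup (u [ i₀ ]≔ x) i) +ᶠ entries M′ i j
    entry i j = ≡.trans (sym (entries-assemble i₀ x u w M i j)) (≡.trans (cong (λ Q → entries Q i (fsuc j)) e)
      (≡.trans (entries-assemble i₀ x′ u′ w′ M′ i j) (cong (λ y → (lookup w′ j *ᶠ lookup y i) +ᶠ entries M′ i j) (sym y≡))))
    w≡ : w ≡ w′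
    w≡ = ext λ j → *ᶠ-cancelˡ-nonzero x x≢0 (≡.trans (side w M r₀ j) (≡.trans (entry i₀ j) (sym (side w′ M′ r₀′ j))))
      where
      side : ∀ (w : Vec 𝕂 m) (M : Mx m) → (∀ j → entries M i₀ j ≡ 0ᶠ) → ∀ j →
        x *ᶠ lookup w j ≡ (lookup w j *ᶠ lookup (u [ i₀ ]≔ x) i₀) +ᶠ entries M i₀ j
      side w M r₀ j = sym (≡.trans (cong₂ _+ᶠ_ (cong (lookup w j *ᶠ_) (Vec.lookup∘updateAt i₀ u)) (r₀ j))
        (≡.trans (+ᶠ-identityʳ _) (*ᶠ-comm _ x)))
    M≡ : M ≡ M′
    M≡ = ext λ j → ext λ i → Linear.⊕-cancelˡ (scalars K) (lookup w j *ᶠ lookup (u [ i₀ ]≔ x) i)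
      (≡.trans (entry i j) (cong (λ w → (lookup w j *ᶠ lookup (u [ i₀ ]≔ x) i) +ᶠ entries M′ i j) (sym w≡)))

  -- The field `many` asserts at least q^(s-t) (1 - 1/q)^r matrices, with all denominators cleared;
  -- each pivot accounts for one factor (q - 1) / q.
  record ManyOfRank {m} (B : Board n m) (r s t : ℕ) : Set where
    field
      matrices : List (Mx m)
      distinct : Unique matrices
      onBoard  : ∀ {M} → M ∈ matrices → Supported B M
      factor   : ∀ {M} → M ∈ matrices → Factors r M
      many     : (q ∸ 1) ^ r * q ^ s ≤ length matrices * q ^ t * q ^ r

  open ManyOfRank

  many-skip : ∀ {m} {B : Board n (suc m)} {r s t} h → ManyOfRank (tail B) r s t → ManyOfRank B r (h + s) (h + t)
  many-skip {B = B} {r} {s} {t} h R = record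
    { matrices = map (0ᶜ ∷_) (matrices R)
    ; distinct = Unique.map⁺ Vec.∷-injectiveʳ (distinct R)
    ; onBoard  = λ M∈ → let (M , M∈′ , e) = ∈-map⁻ (0ᶜ ∷_) M∈ in subst (Supported B) (sym e)
        λ { i fzero _ → Vec.lookup-replicate i 0ᶠ ; i (fsuc j) → onBoard R M∈′ i j }
    ; factor   = λ M∈ → let (M , M∈′ , e) = ∈-map⁻ (0ᶜ ∷_) M∈ in subst (Factors r) (sym e) (factors-skip {M = M} (factor R M∈′))
    ; many     = begin
        (q ∸ 1) ^ r * q ^ (h + s)
          ≡⟨ cong ((q ∸ 1) ^ r *_) (^-distribˡ-+-* q h s) ⟩
        (q ∸ 1) ^ r * (q ^ h * q ^ s)
          ≡⟨ lem ((q ∸ 1) ^ r) (q ^ h) (q ^ s) ⟩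
        q ^ h * ((q ∸ 1) ^ r * q ^ s)
          ≤⟨ *-monoʳ-≤ (q ^ h) (many R) ⟩
        q ^ h * (length (matrices R) * q ^ t * q ^ r)
          ≡⟨ lem₂ (q ^ h) (length (matrices R)) (q ^ t) (q ^ r) ⟩
        length (matrices R) * (q ^ h * q ^ t) * q ^ r
          ≡⟨ cong₂ (λ l z → l * z * q ^ r) (sym (length-map (0ᶜ ∷_) (matrices R))) (sym (^-distribˡ-+-* q h t)) ⟩
        length (map (0ᶜ ∷_) (matrices R)) * q ^ (h + t) * q ^ r ∎ }
    where
    open ≤-Reasoning
    lem : ∀ a b c → a * (b * c) ≡ b * (a * c)
    lem = ℕR.solve-∀
    lem₂ : ∀ a b c d → a * (b * c * d) ≡ b * (a * c) * d
    lem₂ = ℕR.solve-∀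

  -- One pivot row is fixed, in contrast to `pivots`, so that `assemble-injective` rules out double
  -- counting.
  many-use : ∀ {m} {B : Board n (suc m)} {c} → RightClosed B → Heights B c → ∀ {r t} i₀ → B i₀ fzero ≡ true →
    ManyOfRank (delete i₀ (tail B)) r (ΣN (pred ∘ c ∘ fsuc)) t → ManyOfRank B (suc r) (ΣN c) t
  many-use {m} {B} {c} rc hts {r} {t} i₀ e R = record
    { matrices = map (assemble i₀) Ps
    ; distinct = unique-map {f = assemble i₀} Ps-unique inj
    ; onBoard  = λ N∈ → let (P , P∈ , e) = ∈-map⁻ (assemble i₀) N∈ in subst (Supported B) (sym e) (sup P∈)
    ; factor   = λ N∈ → let ((x , u , w , M) , P∈ , e) = ∈-map⁻ (assemble i₀) N∈ in
        subst (Factors (suc r)) (sym e) (factors-assemble i₀ x u w {M} (factor R (proj₂ (proj₂ (pivoted-parts {β = β} P∈)))))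
    ; many     = bound }
    where
    β : Fin n → Bool
    β i = B i fzero
    L = matrices R
    Ps = pivoted i₀ β L
    Ps-unique : Unique Ps
    Ps-unique = Unique.cartesianProduct⁺ (Unique.filter⁺ (λ x → ¬? (x ≟ 0ᶠ)) elements-unique)
      (Unique.cartesianProduct⁺ (columns-unique (without i₀ β)) (Unique.cartesianProduct⁺ (coeffs-unique {K = K} m) (distinct R)))
    row₀ : ∀ {M} → M ∈ L → ∀ j → entries M i₀ j ≡ 0ᶠ
    row₀ M∈ j = onBoard R M∈ i₀ j (without-self i₀ (λ a → B a (fsuc j)))
    inj : ∀ {P Q} → P ∈ Ps → Q ∈ Ps → assemble i₀ P ≡ assemble i₀ Q → P ≡ Q
    inj P∈ Q∈ e =
      let (x≢0 , u₀ , M∈) = pivoted-parts {β = β} P∈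
          (_ , u₀′ , M∈′) = pivoted-parts {β = β} Q∈
      in assemble-injective i₀ x≢0 (u₀ i₀ (without-self i₀ β)) (u₀′ i₀ (without-self i₀ β)) (row₀ M∈) (row₀ M∈′) e
    sup : ∀ {P} → P ∈ Ps → Supported B (assemble i₀ P)
    sup {x , u , w , M} P∈ = go
      where
      parts = pivoted-parts {β = β} P∈
      off : ∀ i → B i fzero ≡ false → lookup (u [ i₀ ]≔ x) i ≡ 0ᶠ
      off i e′ with i Fin.≟ i₀
      ... | yes refl = contradiction (≡.trans (sym e) e′) λ ()
      ... | no ne    = ≡.trans (Vec.lookup∘updateAt′ i i₀ ne u) (proj₁ (proj₂ parts) i (without-off i₀ {β} e′))
      left-off : ∀ i j → B i (fsuc j) ≡ false → B i fzero ≡ false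
      left-off i j e′ with B i fzero in e₀
      ... | false = refl
      ... | true  = contradiction (subst T e′ (rc i fzero (fsuc j) z≤n (Equivalence.from T-≡ e₀))) λ ()
      go : Supported B (assemble i₀ (x , u , w , M))
      go i fzero    e′ = off i e′
      go i (fsuc j) e′ = ≡.trans (entries-assemble i₀ x u w M i j) (≡.trans (cong₂ _+ᶠ_
        (≡.trans (cong (lookup w j *ᶠ_) (off i (left-off i j e′))) (zeroʳᶠ _))
        (onBoard R (proj₂ (proj₂ parts)) i j (without-off i₀ {λ a → B a (fsuc j)} e′))) (+ᶠ-identityˡ 0ᶠ))
    h = count (without i₀ β)
    h≡ = proj₁ (pivot-height {B = B} rc hts i₀ e)
    s = ΣN (pred ∘ c ∘ fsuc)
    s≡ = proj₂ (pivot-height {B = B} rc hts i₀ e)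
    bound : (q ∸ 1) ^ suc r * q ^ ΣN c ≤ length (map (assemble i₀) Ps) * q ^ t * q ^ suc r
    bound = begin
      (q ∸ 1) ^ suc r * q ^ ΣN c
        ≡⟨ cong (λ z → (q ∸ 1) ^ suc r * q ^ z) (cong₂ _+_ (sym h≡) s≡) ⟩
      (q ∸ 1) ^ suc r * q ^ (suc h + (m + s))
        ≡⟨ cong ((q ∸ 1) ^ suc r *_) (≡.trans (^-distribˡ-+-* q (suc h) (m + s)) (cong (q ^ suc h *_) (^-distribˡ-+-* q m s))) ⟩
      (q ∸ 1) ^ suc r * (q ^ suc h * (q ^ m * q ^ s))
        ≡⟨ lem (q ∸ 1) ((q ∸ 1) ^ r) q (q ^ h) (q ^ m) (q ^ s) ⟩
      (q ∸ 1) * (q ^ h * q ^ m * q) * ((q ∸ 1) ^ r * q ^ s)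
        ≤⟨ *-mono-≤ (*-monoˡ-≤ (q ^ h * q ^ m * q) length-nonzero≥) (many R) ⟩
      length nonzero * (q ^ h * q ^ m * q) * (length L * q ^ t * q ^ r)
        ≡⟨ lem₂ (length nonzero) (q ^ h) (q ^ m) q (length L) (q ^ t) (q ^ r) ⟩
      length nonzero * (q ^ h * (q ^ m * length L)) * q ^ t * q ^ suc r
        ≡⟨ cong (λ z → z * q ^ t * q ^ suc r) (≡.trans (sym (length-pivoted i₀ β L)) (sym (length-map (assemble i₀) Ps))) ⟩
      length (map (assemble i₀) Ps) * q ^ t * q ^ suc r ∎
      where
      open ≤-Reasoning
      lem : ∀ a b q x y z → a * b * (q * x * (y * z)) ≡ a * (x * y * q) * (b * z)
      lem = ℕR.solve-∀
      lem₂ : ∀ a x y q l t r → a * (x * y * q) * (l * t * r) ≡ a * (x * (y * l)) * t * (q * r)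
      lem₂ = ℕR.solve-∀

  manyOfRank : ∀ m (B : Board n m) c → RightClosed B → Heights B c → ∀ r → ManyOfRank B r (ΣN c) (trailing m c r)
  manyOfRank zero B c rc hts r = record
    { matrices = [] ∷ [] ; distinct = [] ∷ [] ; onBoard = λ _ _ () ; factor = λ _ → (λ _ _ → 0ᶠ) , (λ _ _ → 0ᶠ) , λ _ ()
    ; many = begin
        (q ∸ 1) ^ r * 1  ≡⟨ *-identityʳ _ ⟩
        (q ∸ 1) ^ r      ≤⟨ ^-monoˡ-≤ r (m∸n≤m q 1) ⟩
        q ^ r            ≡⟨ *-identityˡ (q ^ r) ⟨
        1 * q ^ r        ∎ }
    where open ≤-Reasoning
  manyOfRank (suc m) B c rc hts zero =
    many-skip {B = B} (c fzero) (manyOfRank m (tail B) (c ∘ fsuc) (tail-closed {B = B} rc) (hts ∘ fsuc) zero)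
  manyOfRank (suc m) B c rc hts (suc r) = main (c fzero) refl
    where
    t₁ = trailing m (c ∘ fsuc) (suc r)
    t₂ = trailing m (pred ∘ c ∘ fsuc) r
    skip : ManyOfRank B (suc r) (ΣN c) (c fzero + t₁)
    skip = many-skip {B = B} (c fzero) (manyOfRank m (tail B) (c ∘ fsuc) (tail-closed {B = B} rc) (hts ∘ fsuc) (suc r))
    main : ∀ h → c fzero ≡ h → ManyOfRank B (suc r) (ΣN c) (trailing-step h t₁ t₂)
    main zero    e = subst (λ h → ManyOfRank B (suc r) (ΣN c) (h + t₁)) e skip
    main (suc h) e with ≤-total (suc h + t₁) t₂
    ... | inj₁ le = subst (ManyOfRank B (suc r) (ΣN c)) (sym (m≤n⇒m⊓n≡m le))
                      (subst (λ h → ManyOfRank B (suc r) (ΣN c) (h + t₁)) e skip)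
    ... | inj₂ le with lowest (λ i → B i fzero) (subst (1 ≤_) (sym (≡.trans (hts fzero) e)) (s≤s z≤n))
    ...   | i₀ , b₀ , _ = subst (ManyOfRank B (suc r) (ΣN c)) (sym (m≥n⇒m⊓n≡n le))
              (many-use {B = B} rc hts i₀ (Equivalence.to T-≡ b₀)
                (manyOfRank m (delete i₀ (tail B)) (pred ∘ c ∘ fsuc) (delete-closed {B = tail B} i₀ (tail-closed {B = B} rc))
                  (delete-heights {B = B} rc hts i₀ b₀) r))

  lowRank? : ∀ {m} r (M : Mx m) → Dec (LowRank r (entries M))
  lowRank? r M = ¬? (indepRows? (entries M) (suc r))

  lowRankCount : ∀ {m} → Board n m → ℕ → ℕ
  lowRankCount B r = ∑ (supported B) (λ M → ⟦ lowRank? r M ⟧)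

  lowRankCount-upper : ∀ {m} (B : Board n m) c → RightClosed B → Heights B c → ∀ r →
    lowRankCount B r * q ^ trailing m c r ≤ suc n ^ m * q ^ ΣN c
  lowRankCount-upper {m} B c rc hts r = ≤-trans (*-monoˡ-≤ (q ^ trailing m c r)
      (≤-trans (≤-reflexive (sym (∑-filter (lowRank? r) (supported B))))
        (unique-length≤ (Unique.filter⁺ (lowRank? r) (supported-unique B)) λ {M} M∈ →
          let (M∈′ , low) = ∈-filter⁻ (lowRank? r) {xs = supported B} M∈ in ∈-lowRankMatrices m B rc r M (∈-supported⁻ {B = B} M∈′) low)))
    (length-lowRankMatrices m B c rc hts r)

  lowRankCount-lower : ∀ {m} (B : Board n m) c → RightClosed B → Heights B c → ∀ r →
    (q ∸ 1) ^ r * q ^ ΣN c ≤ lowRankCount B r * q ^ trailing m c r * q ^ r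
  lowRankCount-lower {m} B c rc hts r = ≤-trans (many R) (*-monoˡ-≤ (q ^ r) (*-monoˡ-≤ (q ^ trailing m c r)
      (≤-trans (unique-length≤ (distinct R) (λ {M} M∈ → ∈-filter⁺ (lowRank? r) (∈-supported⁺ {B = B} (onBoard R M∈)) (factors-lowRank {M = M} (factor R M∈))))
        (≤-reflexive (∑-filter (lowRank? r) (supported B))))))
    where R = manyOfRank m B c rc hts r

-- Subspaces and tuples that span them

module CombProperties {q : ℕ} {K : FiniteField q} (W : VectorSpace K) where
  open Field K renaming (Carrier to 𝕂)
  open Linear W

  comb-comb : ∀ {k l} (c : Vec 𝕂 k) (Γ : Vec (Vec 𝕂 l) k) (b : Vec V l) →
    comb c (Vec.map (λ y → comb y b) Γ) ≡ comb (Linear.comb (Coeffs {K = K} l) c Γ) b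
  comb-comb []       []      b = sym (comb-0 b)
  comb-comb (c ∷ cs) (y ∷ Γ) b = ≡.trans (cong₂ _⊕_ (sym (comb-· c y b)) (comb-comb cs Γ b)) (sym (comb-⊕ (Linear._·_ (Coeffs {K = K} _) c y) (Linear.comb (Coeffs {K = K} _) cs Γ) b))

  unit : ∀ {k} → Fin k → Vec 𝕂 k
  unit {suc k} fzero    = 1ᶠ ∷ replicate k 0ᶠ
  unit {suc k} (fsuc l) = 0ᶠ ∷ unit l

  comb-unit : ∀ {k} (l : Fin k) (b : Vec V k) → comb (unit l) b ≡ lookup b l
  comb-unit fzero    (b ∷ bs) = ≡.trans (cong₂ _⊕_ (·-identity b) (comb-0 bs)) (⊕-identityʳ b)
  comb-unit (fsuc l) (b ∷ bs) = ≡.trans (cong₂ _⊕_ (·-zeroˡ b) (comb-unit l bs)) (⊕-identityˡ _)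

  comb-injective : ∀ {k} {b : Vec V k} → (∀ c → comb c b ≡ 0v → c ≡ replicate k 0ᶠ) →
    ∀ {c d} → comb c b ≡ comb d b → c ≡ d
  comb-injective {k} {b} indep {c} {d} e = C.⊕-cancelʳ ((-ᶠ 1ᶠ) C.· d) (≡.trans
    (indep (c C.⊕ (-ᶠ 1ᶠ) C.· d) (≡.trans (comb-⊕ c _ b) (≡.trans (cong₂ _⊕_ e (comb-· (-ᶠ 1ᶠ) d b)) (-1· (comb d b)))))
    (sym (C.-1· d)))
    where module C = Linear (Coeffs {K = K} k)

module Spaces {q : ℕ} (K : FiniteField q) {n m : ℕ} (F : Ferrers n m) (r k : ℕ) where
  open Field K renaming (Carrier to 𝕂)
  open Matrices K
  open Boards K n
  open LowRankCount K n using (lowRank?)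

  Matrix : VectorSpace K
  Matrix = power K (power K (scalars K) n) m

  open Linear Matrix
  open CombProperties Matrix

  entries-⊕ : ∀ (M N : Mx m) i j → entries (M ⊕ N) i j ≡ entries M i j +ᶠ entries N i j
  entries-⊕ M N i j = ≡.trans (cong (λ y → lookup y i) (Vec.lookup-zipWith (zipWith _+ᶠ_) j M N))
    (Vec.lookup-zipWith _+ᶠ_ i (lookup M j) (lookup N j))

  entries-· : ∀ a (M : Mx m) i j → entries (a · M) i j ≡ a *ᶠ entries M i j
  entries-· a M i j = ≡.trans (cong (λ y → lookup y i) (Vec.lookup-map j (Vec.map (a *ᶠ_)) M))
    (Vec.lookup-map i (a *ᶠ_) (lookup M j))

  entries-0 : ∀ i j → entries 0v i j ≡ 0ᶠ
  entries-0 i j = ≡.trans (cong (λ y → lookup y i) (Vec.lookup-replicate j (replicate n 0ᶠ))) (Vec.lookup-replicate i 0ᶠ)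

  entries-comb : ∀ {k} (c : Vec 𝕂 k) (b : Vec (Mx m) k) i j →
    entries (comb c b) i j ≡ Σᶠ K (λ l → lookup c l *ᶠ entries (lookup b l) i j)
  entries-comb []       []       i j = entries-0 i j
  entries-comb (c ∷ cs) (b ∷ bs) i j = ≡.trans (entries-⊕ (c · b) (comb cs bs) i j)
    (cong₂ _+ᶠ_ (entries-· c b i j) (entries-comb cs bs i j))

  ext² : {M N : Mx m} → (∀ i j → entries M i j ≡ entries N i j) → M ≡ N
  ext² h = ext (λ j → ext (λ i → h i j))

  toMx : Mat K n m → Mx m
  toMx M = tabulate (λ j → tabulate (λ i → M i j))

  entries-toMx : ∀ M i j → entries (toMx M) i j ≡ M i j
  entries-toMx M i j = ≡.trans (cong (λ y → lookup y i) (Vec.lookup∘tabulate _ j)) (Vec.lookup∘tabulate _ i)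

  toMx≡ : ∀ {M N} → (∀ i j → M i j ≡ entries N i j) → toMx M ≡ N
  toMx≡ h = ext² (λ i j → ≡.trans (entries-toMx _ i j) (h i j))

  lowRank-scale : ∀ {a} {M : Mx m} → LowRank r (entries M) → LowRank r (entries (a · M))
  lowRank-scale {a} {M} low (ρ , ind) = low (ρ , λ c e → ind c (λ j →
    ≡.trans (Σᶠ-cong {suc r} (λ l → ≡.trans (cong (c l *ᶠ_) (entries-· a M (ρ l) j)) (*ᶠ-leftComm (c l) a _)))
    (≡.trans (Σᶠ-*ˡ {suc r} a (λ l → c l *ᶠ entries M (ρ l) j)) (≡.trans (cong (a *ᶠ_) (e j)) (zeroʳᶠ a)))))

  lowRank-0 : LowRank r (entries 0v)
  lowRank-0 (ρ , ind) = 0≢1 (sym (ind (λ _ → 1ᶠ)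
    (λ j → Σᶠ-zero {suc r} (λ l → ≡.trans (cong (1ᶠ *ᶠ_) (entries-0 (ρ l) j)) (zeroʳᶠ 1ᶠ))) fzero))

  indepRows-fewer : ∀ {M : Mat K n m} {s} → IndepRows M (suc s) → IndepRows M s
  indepRows-fewer {M} {s} (ρ , ind) = ρ ∘ fsuc , λ c e l → ind (c⁺ c)
    (λ j → ≡.trans (cong (_+ᶠ Σᶠ K (λ l → c l *ᶠ M (ρ (fsuc l)) j)) (zeroˡᶠ _)) (≡.trans (+ᶠ-identityˡ _) (e j))) (fsuc l)
    where
    c⁺ : (Fin s → 𝕂) → Fin (suc s) → 𝕂
    c⁺ c fzero    = 0ᶠ
    c⁺ c (fsuc l) = c l

  rankAtLeast⇒¬lowRank : ∀ {M : Mat K n m} → RankAtLeast K M (suc r) → ¬ LowRank r M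
  rankAtLeast⇒¬lowRank {M} (s , (ind , _) , le) low = low (shrink (s ∸ suc r) (subst (IndepRows M) (sym (m∸n+n≡m le)) ind))
    where
    shrink : ∀ x → IndepRows M (x + suc r) → IndepRows M (suc r)
    shrink zero    ind = ind
    shrink (suc x) ind = shrink x (indepRows-fewer {M} ind)

  lowRank-cong : ∀ {M N : Mat K n m} → (∀ i j → M i j ≡ N i j) → LowRank r M → LowRank r N
  lowRank-cong {N = N} h low (ρ , ind) = low (ρ , indep-cong {u = λ l → N (ρ l)} (λ l j → sym (h (ρ l) j)) ind)

  U : FiniteSubspace Matrix
  U = record
    { members = supported (cell F)
    ; unique = supported-unique (cell F)
    ; 0∈ = ∈-supported⁺ {B = cell F} (λ i j _ → entries-0 i j)
    ; ⊕-closed = λ {M} {N} M∈ N∈ → ∈-supported⁺ {B = cell F} (λ i j e → ≡.trans (entries-⊕ M N i j)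
        (≡.trans (cong₂ _+ᶠ_ (∈-supported⁻ {B = cell F} M∈ i j e) (∈-supported⁻ {B = cell F} N∈ i j e)) (+ᶠ-identityˡ 0ᶠ)))
    ; ·-closed = λ a {M} M∈ → ∈-supported⁺ {B = cell F} (λ i j e → ≡.trans (entries-· a M i j)
        (≡.trans (cong (a *ᶠ_) (∈-supported⁻ {B = cell F} M∈ i j e)) (zeroʳᶠ a))) }

  module R = Random U
  module A = R.Avoiding {λ M → LowRank r (entries M)} (lowRank? r) (λ {a} {M} _ → lowRank-scale {a} {M})
  open A using (Good; Good?)

  -- In terms of a basis, tuples in a k-dimensional space are tuples of coefficient vectors, so
  -- ordered bases are the good tuples of this second instance.
  allCoeffs : FiniteSubspace (Coeffs {K = K} k)
  allCoeffs = record
    { members = coeffs {K = K} k ; unique = coeffs-unique {K = K} k ; 0∈ = ∈-coeffs {K = K} _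
    ; ⊕-closed = λ _ _ → ∈-coeffs {K = K} _ ; ·-closed = λ _ _ → ∈-coeffs {K = K} _ }

  private
    module C = Linear (Coeffs {K = K} k)

  module RC = Random allCoeffs
  module AC = RC.Avoiding {λ y → y ≡ C.0v} (λ y → y C.≟ᵥ C.0v) (λ {a} _ e → ≡.trans (cong (a C.·_) e) (C.·-zeroʳ a))

  -- The zero matrix is of low rank, so a nontrivial relation would be a forbidden combination.
  good-independent : ∀ {b : Vec (Mx m) k} → Good b → ∀ c → comb c b ≡ 0v → c ≡ replicate k 0ᶠ
  good-independent {b} good c e with c C.≟ᵥ replicate k 0ᶠ
  ... | yes c≡0 = c≡0
  ... | no c≢0  = contradiction (subst (λ M → LowRank r (entries M)) (sym e) lowRank-0) (good c c≢0)

  Contains : SubsetMat K F → Vec (Mx m) k → Set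
  Contains S b = ∀ l → T (S (entries (lookup b l)))

  contains? : ∀ S b → Dec (Contains S b)
  contains? S b = Fin.all? (λ l → T? (S (entries (lookup b l))))

  FdSpace : SubsetMat K F → Set
  FdSpace = IsFdSpace K F k (suc r)

  module _ {S : SubsetMat K F} (sub : IsSubspace K F S) where
    open IsSubspace sub

    respectsT : ∀ {M N} → (∀ i j → M i j ≡ N i j) → T (S M) → T (S N)
    respectsT {M} {N} h = subst T (respects M N h)

    comb∈S : ∀ {k} (c : Vec 𝕂 k) (b : Vec (Mx m) k) → (∀ l → T (S (entries (lookup b l)))) → T (S (entries (comb c b)))
    comb∈S []       []       h = respectsT (λ i j → sym (entries-0 i j)) hasZero
    comb∈S (c ∷ cs) (b ∷ bs) h = respectsT (λ i j → sym (≡.trans (entries-⊕ (c · b) (comb cs bs) i j)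
        (cong (_+ᶠ entries (comb cs bs) i j) (entries-· c b i j))))
      (addClosed _ _ (scalClosed c (entries b) (h fzero)) (comb∈S cs bs (h ∘ fsuc)))

  module Basis {S : SubsetMat K F} (fd : FdSpace S) where
    sub : IsSubspace K F S
    sub = proj₁ fd

    β : Fin k → Mat K n m
    β = proj₁ (proj₁ (proj₂ fd))

    B : Vec (Mx m) k
    B = tabulate (λ l → toMx (β l))

    entries-B : ∀ l i j → entries (lookup B l) i j ≡ β l i j
    entries-B l i j = ≡.trans (cong (λ M → entries M i j) (Vec.lookup∘tabulate _ l)) (entries-toMx (β l) i j)

    B∈S : ∀ l → T (S (entries (lookup B l)))
    B∈S l = respectsT sub (λ i j → sym (entries-B l i j)) (proj₁ (proj₂ (proj₁ (proj₂ fd))) l)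

    entries-combB : ∀ c i j → entries (comb c B) i j ≡ Σᶠ K (λ l → lookup c l *ᶠ β l i j)
    entries-combB c i j = ≡.trans (entries-comb c B i j) (Σᶠ-cong {k} (λ l → cong (lookup c l *ᶠ_) (entries-B l i j)))

    B-independent : ∀ c → comb c B ≡ 0v → c ≡ replicate k 0ᶠ
    B-independent c e = ext (λ l → ≡.trans (proj₁ (proj₂ (proj₂ (proj₁ (proj₂ fd)))) (lookup c)
        (λ i j → ≡.trans (sym (entries-combB c i j)) (≡.trans (cong (λ M → entries M i j) e) (entries-0 i j))) l)
      (sym (Vec.lookup-replicate l 0ᶠ)))

    B-spans : ∀ M → T (S M) → ∃ λ y → toMx M ≡ comb y B
    B-spans M M∈ =
      let (y , e) = proj₂ (proj₂ (proj₂ (proj₁ (proj₂ fd)))) M M∈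
      in tabulate y , toMx≡ (λ i j → ≡.trans (e i j) (sym (≡.trans (entries-combB (tabulate y) i j)
           (Σᶠ-cong {k} (λ l → cong (_*ᶠ β l i j) (Vec.lookup∘tabulate y l))))))

    ∈S⇒¬lowRank : ∀ {N} → T (S (entries N)) → N ≢ 0v → ¬ LowRank r (entries N)
    ∈S⇒¬lowRank {N} N∈ N≢0 = rankAtLeast⇒¬lowRank {entries N} (proj₂ (proj₂ fd) (entries N) N∈
      (λ z → N≢0 (ext² (λ i j → ≡.trans (z i j) (sym (entries-0 i j))))))

    fromCoeffs : Vec (Vec 𝕂 k) k → Vec (Mx m) k
    fromCoeffs = Vec.map (λ y → comb y B)

    toCoeffs : ∀ b → Contains S b → ∃ λ Γ → fromCoeffs Γ ≡ b
    toCoeffs b h = tabulate (λ l → proj₁ (co l)) , ext (λ l → ≡.trans (Vec.lookup-map l _ (tabulate (λ l → proj₁ (co l))))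
        (≡.trans (cong (λ y → comb y B) (Vec.lookup∘tabulate _ l)) (proj₂ (co l))))
      where
      co : ∀ l → ∃ λ y → comb y B ≡ lookup b l
      co l = let (y , e) = B-spans (entries (lookup b l)) (h l) in y , ≡.trans (sym e) (toMx≡ (λ i j → refl))

    -- The coefficient map c ↦ c Γ is injective on a finite set, hence surjective.
    good-spans : ∀ b → Contains S b → Good b → ∀ M → T (S M) → ∃ λ c → toMx M ≡ comb c b
    good-spans b h good M M∈ =
      let (Γ , eb)     = toCoeffs b h
          f            = λ c → Linear.comb (Coeffs {K = K} k) c Γ
          through c    = ≡.trans (cong (comb c) (sym eb)) (comb-comb c Γ B)
          f-inj        = λ {c d} e → comb-injective (good-independent {b} good) {c} {d}
                           (≡.trans (through c) (≡.trans (cong (λ y → comb y B) e) (sym (through d))))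
          (y , ey)     = B-spans M M∈
          (c , _ , ec) = ∈-map⁻ f (unique-surjective C._≟ᵥ_ {map f (coeffs {K = K} k)} {coeffs {K = K} k}
                           (Unique.map⁺ f-inj (coeffs-unique {K = K} k)) (λ _ → ∈-coeffs {K = K} _)
                           (≤-reflexive (sym (length-map f (coeffs {K = K} k)))) (∈-coeffs {K = K} y))
      in c , ≡.trans ey (≡.trans (cong (λ y → comb y B) ec) (sym (through c)))

    -- Independent coefficient tuples map injectively to tuples in `S`. Their nonzero combinations
    -- are nonzero elements of `S`, hence of rank above r.
    tuples-lower : AC.goodCount k ≤ ∑ (tuples (supported (cell F)) k) (λ b → ⟦ Good? b ×-dec contains? S b ⟧)
    tuples-lower = count-injection AC.Good? (λ b → Good? b ×-dec contains? S b)
      (vecs-unique k (λ _ → coeffs-unique {K = K} k)) fromCoeffs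
      (λ {Γ} {Δ} _ _ e → ext (λ l → comb-injective B-independent (≡.trans (sym (Vec.lookup-map l _ Γ))
        (≡.trans (cong (λ b → lookup b l) e) (Vec.lookup-map l _ Δ)))))
      λ {Γ} Γ∈ good → ∈-vecs⁺ k (λ l → ∈-supported⁺ {B = cell F} (IsSubspace.inside sub _ (inS Γ l))) ,
        (λ c c≢0 → subst (λ N → ¬ LowRank r (entries N)) (sym (comb-comb c Γ B))
          (∈S⇒¬lowRank (comb∈S sub (C.comb c Γ) B B∈S) (λ e → good c c≢0 (B-independent _ e)))) , inS Γ
      where
      inS : ∀ Γ l → T (S (entries (lookup (fromCoeffs Γ) l)))
      inS Γ l = subst (λ N → T (S (entries N))) (sym (Vec.lookup-map l _ Γ)) (comb∈S sub (lookup Γ l) B B∈S)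

    -- The crude count of all tuples in `S` exceeds the number of bases only by a factor 1 + O(1/q).
    tuples-upper : ∑ (tuples (supported (cell F)) k) (λ b → ⟦ Good? b ×-dec contains? S b ⟧) ≤ (q ^ k) ^ k
    tuples-upper = begin
      ∑ Us (λ b → ⟦ good? b ⟧)                                     ≡⟨ ∑-filter good? Us ⟨
      length (filter good? Us)                                     ≤⟨ unique-length≤ (Unique.filter⁺ good?
                                                                        (vecs-unique k (λ _ → supported-unique (cell F)))) sub′ ⟩
      length (map fromCoeffs (tuples (coeffs {K = K} k) k))        ≡⟨ length-map fromCoeffs (tuples (coeffs {K = K} k) k) ⟩
      length (tuples (coeffs {K = K} k) k)                         ≡⟨ length-tuples (coeffs {K = K} k) k ⟩
      length (coeffs {K = K} k) ^ k                                ≡⟨ cong (_^ k) (length-coeffs {K = K} k) ⟩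
      (q ^ k) ^ k                                                  ∎
      where
      open ≤-Reasoning
      Us = tuples (supported (cell F)) k
      good? : ∀ b → Dec (Good b × Contains S b)
      good? b = Good? b ×-dec contains? S b
      sub′ : ∀ {b} → b ∈ filter good? Us → b ∈ map fromCoeffs (tuples (coeffs {K = K} k) k)
      sub′ {b} b∈ = let (Γ , e) = toCoeffs b (proj₂ (proj₂ (∈-filter⁻ good? {xs = Us} b∈)))
        in subst (_∈ map fromCoeffs (tuples (coeffs {K = K} k) k)) e (∈-map⁺ fromCoeffs (∈-vecs⁺ k (λ l → ∈-coeffs {K = K} _)))

  -- A good tuple spans every k-dimensional space that contains it.
  good-unique : ∀ b → Good b → ∀ {S S′} → FdSpace S → FdSpace S′ → Contains S b → Contains S′ b → _≈ˢ_ K F S S′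
  good-unique b good {S} {S′} fd fd′ h h′ M = T-ext (transfer fd fd′ h h′) (transfer fd′ fd h′ h)
    where
    T-ext : ∀ {x y} → (T x → T y) → (T y → T x) → x ≡ y
    T-ext {false} {false} f g = refl
    T-ext {false} {true}  f g = contradiction (g tt) id
    T-ext {true}  {false} f g = contradiction (f tt) id
    T-ext {true}  {true}  f g = refl
    transfer : ∀ {S S′} → FdSpace S → FdSpace S′ → Contains S b → Contains S′ b → T (S M) → T (S′ M)
    transfer fd fd′ h h′ M∈ = let (c , e) = Basis.good-spans fd b h good M M∈ in
      respectsT (proj₁ fd′) (λ i j → ≡.trans (cong (λ N → entries N i j) (sym e)) (entries-toMx M i j))
        (comb∈S (proj₁ fd′) c b h′)

  module Span (b : Vec (Mx m) k) (b∈ : b ∈ tuples (supported (cell F)) k) (good : Good b) where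

    -- Subspaces are Boolean predicates, so membership in the span has to be decided, here by trying
    -- all coefficient vectors.
    combination? : ∀ N → Dec (∃ λ c → N ≡ comb c b)
    combination? N = map′ Any.satisfied (λ { (c , e) → lose (∈-coeffs {K = K} c) e })
      (Any.any? (λ c → N ≟ᵥ comb c b) (coeffs {K = K} k))

    span : SubsetMat K F
    span M = ⌊ combination? (toMx M) ⌋

    in⁺ : ∀ {M} c → (∀ i j → M i j ≡ entries (comb c b) i j) → T (span M)
    in⁺ c h = fromWitness (c , toMx≡ h)

    in⁻ : ∀ {M} → T (span M) → ∃ λ c → ∀ i j → M i j ≡ entries (comb c b) i j
    in⁻ {M} t = let (c , e) = toWitness t in c , λ i j → ≡.trans (sym (entries-toMx M i j)) (cong (λ N → entries N i j) e)

    span-subspace : IsSubspace K F span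
    span-subspace = record
      { respects = λ M N h → cong (λ x → ⌊ combination? x ⌋) (toMx≡ {M} (λ i j → ≡.trans (h i j) (sym (entries-toMx N i j))))
      ; inside = λ M M∈ i j e → let (c , h) = in⁻ M∈ in
          ≡.trans (h i j) (∈-supported⁻ {B = cell F} (R.comb∈ c b∈) i j e)
      ; hasZero = in⁺ (replicate k 0ᶠ) (λ i j → sym (≡.trans (cong (λ N → entries N i j) (comb-0 b)) (entries-0 i j)))
      ; addClosed = λ M N M∈ N∈ → let (c , h) = in⁻ M∈ ; (d , h′) = in⁻ N∈ in
          in⁺ (c C.⊕ d) (λ i j → ≡.trans (cong₂ _+ᶠ_ (h i j) (h′ i j))
            (sym (≡.trans (cong (λ N → entries N i j) (comb-⊕ c d b)) (entries-⊕ (comb c b) (comb d b) i j))))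
      ; scalClosed = λ a M M∈ → let (c , h) = in⁻ M∈ in
          in⁺ (a C.· c) (λ i j → ≡.trans (cong (a *ᶠ_) (h i j))
            (sym (≡.trans (cong (λ N → entries N i j) (comb-· a c b)) (entries-· a (comb c b) i j)))) }

    contains : Contains span b
    contains l = in⁺ (unit l) (λ i j → cong (λ N → entries N i j) (sym (comb-unit l b)))

    span-dim : HasDim K F span k
    span-dim = (λ l → entries (lookup b l)) , contains ,
      (λ c e l → ≡.trans (sym (Vec.lookup∘tabulate c l)) (≡.trans (cong (λ y → lookup y l)
        (good-independent {b} good (tabulate c) (ext² (λ i j → ≡.trans (expand c i j) (≡.trans (e i j) (sym (entries-0 i j)))))))
        (Vec.lookup-replicate l 0ᶠ))) ,
      (λ M M∈ → let (c , h) = in⁻ M∈ in lookup c , λ i j → ≡.trans (h i j) (entries-comb c b i j))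
      where
      expand : ∀ c i j → entries (comb (tabulate c) b) i j ≡ Σᶠ K (λ l → c l *ᶠ entries (lookup b l) i j)
      expand c i j = ≡.trans (entries-comb (tabulate c) b i j)
        (Σᶠ-cong {k} (λ l → cong (_*ᶠ entries (lookup b l) i j) (Vec.lookup∘tabulate c l)))

    span-fd : FdSpace span
    span-fd = span-subspace , span-dim , λ M M∈ M≢0 → let (c , h) = in⁻ M∈ in
      highRank M r (λ low → good c
        (λ e → M≢0 (λ i j → ≡.trans (h i j) (≡.trans (cong (λ N → entries N i j) (≡.trans (cong (λ y → comb y b) e) (comb-0 b))) (entries-0 i j))))
        (lowRank-cong h low))

  module _ {N : ℕ} (count : NumFdSpaces K F k (suc r) N) where
    private
      L    = proj₁ count
      Us   = tuples (supported (cell F)) k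
      fds  = proj₁ (proj₂ (proj₂ count))
      diff = proj₁ (proj₂ (proj₂ (proj₂ count)))
      cover = proj₂ (proj₂ (proj₂ (proj₂ count)))
      pairs : SubsetMat K F → Vec (Mx m) k → ℕ
      pairs S b = ⟦ Good? b ×-dec contains? S b ⟧

    -- Double counting of pairs of a listed space and a good tuple in it: each space occurs at least
    -- `AC.goodCount k` times, each tuple at most once.
    spaces-upper : N * AC.goodCount k ≤ A.goodCount k
    spaces-upper = begin
      N * AC.goodCount k                   ≡⟨ cong (_* AC.goodCount k) (proj₁ (proj₂ count)) ⟨
      length L * AC.goodCount k            ≡⟨ ∑-const L _ ⟨
      ∑ L (λ _ → AC.goodCount k)           ≤⟨ ∑-mono L (λ S S∈ → Basis.tuples-lower (All.lookup fds S∈)) ⟩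
      ∑ L (λ S → ∑ Us (λ b → pairs S b))   ≡⟨ ∑-swap L Us pairs ⟩
      ∑ Us (λ b → ∑ L (λ S → pairs S b))   ≤⟨ ∑-mono Us (λ b _ → once b) ⟩
      A.goodCount k                        ∎
      where
      open ≤-Reasoning
      once : ∀ b → ∑ L (λ S → pairs S b) ≤ ⟦ Good? b ⟧
      once b with Good? b in eq
      ... | no bad   = ≤-reflexive (≡.trans (∑-const L 0) (*-zeroʳ (length L)))
      ... | yes good = ≤-trans (∑-mono L (λ S _ → ⟦⟧-mono (yes good ×-dec contains? S b) (contains? S b) proj₂))
                         (count≤1 (λ S → contains? S b) L fds diff (good-unique b good))

    -- The same pairs: each good tuple occurs at least once, through its span, and each space at
    -- most (q^k)^k times.
    spaces-lower : A.goodCount k ≤ N * (q ^ k) ^ k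
    spaces-lower = begin
      A.goodCount k                        ≤⟨ ∑-mono Us covered ⟩
      ∑ Us (λ b → ∑ L (λ S → pairs S b))   ≡⟨ ∑-swap L Us pairs ⟨
      ∑ L (λ S → ∑ Us (λ b → pairs S b))   ≤⟨ ∑-mono L (λ S S∈ → Basis.tuples-upper (All.lookup fds S∈)) ⟩
      ∑ L (λ _ → (q ^ k) ^ k)              ≡⟨ ∑-const L _ ⟩
      length L * (q ^ k) ^ k               ≡⟨ cong (_* (q ^ k) ^ k) (proj₁ (proj₂ count)) ⟩
      N * (q ^ k) ^ k                      ∎
      where
      open ≤-Reasoning
      covered : ∀ b → b ∈ Us → ⟦ Good? b ⟧ ≤ ∑ L (λ S → pairs S b)
      covered b b∈ = go (Good? b)
        where
        go : (g : Dec (Good b)) → ⟦ g ⟧ ≤ ∑ L (λ S → pairs S b)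
        go (no _)     = z≤n
        go (yes good) =
          let (S , S∈ , eq) = find (cover (Span.span b b∈ good) (Span.span-fd b b∈ good))
          in subst (_≤ ∑ L (λ S → pairs S b))
               (⟦⟧-yes (Good? b ×-dec contains? S b) (good , λ l → subst T (eq _) (Span.contains b b∈ good l)))
               (∑-single (λ S → pairs S b) S∈)

-- Asymptotics

-- X ≤ (1 + c / q) Y
Approx : (q c X Y : ℕ) → Set
Approx q c X Y = q * X ≤ (q + c) * Y

approx-weaken : ∀ q {c c′ X Y} → c ≤ c′ → Approx q c X Y → Approx q c′ X Y
approx-weaken q {Y = Y} le a = ≤-trans a (*-monoˡ-≤ Y (+-monoʳ-≤ q le))

-- (1 + c/q) (1 + c′/q) ≤ 1 + (c + c′ + c c′)/q, as 1/q² ≤ 1/q; the term added in the chain is the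
-- difference, with p = q - 1.
approx-trans : ∀ q {c c′ X Y Z} → 1 ≤ q → Approx q c X Y → Approx q c′ Y Z → Approx q (c + c′ + c * c′) X Z
approx-trans (suc p) {c} {c′} {X} {Y} {Z} _ a b = *-cancelˡ-≤ q (begin
  q * (q * X)                             ≤⟨ *-monoʳ-≤ q a ⟩
  q * ((q + c) * Y)                       ≡⟨ lem q c Y ⟩
  (q + c) * (q * Y)                       ≤⟨ *-monoʳ-≤ (q + c) b ⟩
  (q + c) * ((q + c′) * Z)                ≤⟨ m≤m+n _ (p * (c * c′) * Z) ⟩
  (q + c) * ((q + c′) * Z) + p * (c * c′) * Z  ≡⟨ lem₂ p c c′ Z ⟩
  q * ((q + (c + c′ + c * c′)) * Z)       ∎)
  where
  open ≤-Reasoning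
  q = suc p
  lem : ∀ q c y → q * ((q + c) * y) ≡ (q + c) * (q * y)
  lem = ℕR.solve-∀
  lem₂ : ∀ p c d z → (suc p + c) * ((suc p + d) * z) + p * (c * d) * z ≡ suc p * ((suc p + (c + d + c * d)) * z)
  lem₂ = ℕR.solve-∀

approx-*ˡ : ∀ q {c} Z {X Y} → Approx q c X Y → Approx q c (Z * X) (Z * Y)
approx-*ˡ q {c} Z {X} {Y} a = subst₂ _≤_ (lem Z q X) (lem Z (q + c) Y) (*-monoʳ-≤ Z a)
  where
  lem : ∀ a b x → a * (b * x) ≡ b * (a * x)
  lem = ℕR.solve-∀

approx-cancelʳ : ∀ q {c X Y} Z → 1 ≤ Z → Approx q c (X * Z) (Y * Z) → Approx q c X Y
approx-cancelʳ q {c} {X} {Y} Z pos a =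
  *-cancelʳ-≤ (q * X) ((q + c) * Y) Z {{>-nonZero pos}} (subst₂ _≤_ (sym (*-assoc q X Z)) (sym (*-assoc (q + c) Y Z)) a)

-- The error is given relative to the larger quantity X. Once 2 c ≤ q it follows that X ≤ 2 Y, so
-- the error is at most 2 c Y / q.
deficit⇒approx : ∀ q c {X Y} → 2 * c ≤ q → q * X ≤ q * Y + c * X → Approx q (2 * c) X Y
deficit⇒approx zero    c {X} {Y} le h = z≤n
deficit⇒approx (suc p) c {X} {Y} le h = begin
  q * X                    ≤⟨ h ⟩
  q * Y + c * X            ≤⟨ +-monoʳ-≤ (q * Y) (*-monoʳ-≤ c X≤2Y) ⟩
  q * Y + c * (2 * Y)      ≡⟨ lem q c Y ⟩
  (q + 2 * c) * Y          ∎
  where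
  open ≤-Reasoning
  q = suc p
  lem : ∀ q c y → q * y + c * (2 * y) ≡ (q + 2 * c) * y
  lem = ℕR.solve-∀
  lem₂ : ∀ q y c x → 2 * (q * y + c * x) ≡ q * (2 * y) + 2 * c * x
  lem₂ = ℕR.solve-∀
  lem₃ : ∀ q x → q * x + q * x ≡ 2 * (q * x)
  lem₃ = ℕR.solve-∀
  X≤2Y : X ≤ 2 * Y
  X≤2Y = *-cancelˡ-≤ q (+-cancelʳ-≤ (q * X) _ _ (begin
    q * X + q * X              ≡⟨ lem₃ q X ⟩
    2 * (q * X)                ≤⟨ *-monoʳ-≤ 2 h ⟩
    2 * (q * Y + c * X)        ≡⟨ lem₂ q Y c X ⟩
    q * (2 * Y) + 2 * c * X    ≤⟨ +-monoʳ-≤ (q * (2 * Y)) (*-monoˡ-≤ X le) ⟩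
    q * (2 * Y) + q * X        ∎))

-- The inequality (1 - 1/q)^r ≥ 1 - r/q multiplied by q^(r+1).
bernoulli : ∀ q r → 1 ≤ q → q * q ^ r ≤ q * (q ∸ 1) ^ r + r * q ^ r
bernoulli q zero    _ = m≤m+n _ 0
bernoulli (suc p) (suc r) pos = begin
  q * (q * q ^ r)                                   ≤⟨ *-monoʳ-≤ q (bernoulli q r pos) ⟩
  q * (q * p ^ r + r * q ^ r)                       ≡⟨ lem p (p ^ r) r (q ^ r) ⟩
  q * (p * p ^ r) + (q * p ^ r + r * (q * q ^ r))   ≤⟨ +-monoʳ-≤ (q * (p * p ^ r)) (+-monoˡ-≤ (r * (q * q ^ r)) (*-monoʳ-≤ q (^-monoˡ-≤ r (n≤1+n p)))) ⟩
  q * (p * p ^ r) + (q * q ^ r + r * (q * q ^ r))   ∎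
  where
  open ≤-Reasoning
  q = suc p
  lem : ∀ p a r b → suc p * (suc p * a + r * b) ≡ suc p * (p * a) + (suc p * a + r * (suc p * b))
  lem = ℕR.solve-∀

module _ (q a : ℕ) (q≥1 : 1 ≤ q) where

  private
    instance
      _ : NonZero q
      _ = >-nonZero q≥1

    qprod : List ℕ → ℕ
    qprod is = product (map (λ i → q ^ a ∸ q ^ i) is)

  qprod-upper : ∀ is → qprod is ≤ (q ^ a) ^ length is
  qprod-upper []       = ≤-refl
  qprod-upper (i ∷ is) = *-mono-≤ (m∸n≤m (q ^ a) (q ^ i)) (qprod-upper is)

  -- For i < a the factor q^a - q^i is at least (1 - 1/q) q^a, and the relative losses add up as in
  -- `bernoulli`.
  qprod-lower : ∀ is → All (_< a) is → q * (q ^ a) ^ length is ≤ q * qprod is + length is * (q ^ a) ^ length is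
  qprod-lower []       []       = m≤m+n _ 0
  qprod-lower (i ∷ is) (i<a ∷ h) = begin
    q * (Q * E)                              ≡⟨ lem q Q E ⟩
    Q * (q * E)                              ≤⟨ *-monoʳ-≤ Q (qprod-lower is h) ⟩
    Q * (q * P + l * E)                      ≡⟨ lem₂ Q q P l E ⟩
    q * Q * P + l * (Q * E)                  ≤⟨ +-monoˡ-≤ (l * (Q * E)) (*-monoˡ-≤ P factor) ⟩
    (q * x + Q) * P + l * (Q * E)            ≡⟨ lem₃ q x Q P (l * (Q * E)) ⟩
    q * (x * P) + (Q * P + l * (Q * E))      ≤⟨ +-monoʳ-≤ (q * (x * P)) (+-monoˡ-≤ (l * (Q * E)) (*-monoʳ-≤ Q (qprod-upper is))) ⟩
    q * (x * P) + (Q * E + l * (Q * E))      ∎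
    where
    open ≤-Reasoning
    Q = q ^ a
    l = length is
    E = Q ^ l
    P = qprod is
    x = Q ∸ q ^ i
    factor : q * Q ≤ q * x + Q
    factor = begin
      q * Q                        ≡⟨ cong (q *_) (m∸n+n≡m (^-monoʳ-≤ q (<⇒≤ i<a))) ⟨
      q * (x + q ^ i)              ≡⟨ *-distribˡ-+ q x (q ^ i) ⟩
      q * x + q ^ suc i            ≤⟨ +-monoʳ-≤ (q * x) (^-monoʳ-≤ q i<a) ⟩
      q * x + Q                    ∎
    lem : ∀ a b c → a * (b * c) ≡ b * (a * c)
    lem = ℕR.solve-∀
    lem₂ : ∀ Q q P l E → Q * (q * P + l * E) ≡ q * Q * P + l * (Q * E)
    lem₂ = ℕR.solve-∀
    lem₃ : ∀ q x Q P z → (q * x + Q) * P + z ≡ q * (x * P) + (Q * P + z)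
    lem₃ = ℕR.solve-∀

  qbinNum-upper : ∀ b → qbinNum q a b ≤ (q ^ a) ^ b
  qbinNum-upper b = subst (λ l → qbinNum q a b ≤ (q ^ a) ^ l) (length-upTo b) (qprod-upper (upTo b))

  qbinNum-approx : ∀ b → b ≤ a → 2 * b ≤ q → Approx q (2 * b) ((q ^ a) ^ b) (qbinNum q a b)
  qbinNum-approx b b≤a le = deficit⇒approx q b le
    (subst (λ l → q * (q ^ a) ^ l ≤ q * qbinNum q a b + l * (q ^ a) ^ l) (length-upTo b)
      (qprod-lower (upTo b) (All.tabulate (λ i∈ → <-≤-trans (∈-upTo⁻ i∈) b≤a))))

-- Estimates over a fixed field

module Density {n m : ℕ} (F : Ferrers n m) (r k : ℕ) (k≥1 : 1 ≤ k) (k≤card : k ≤ card F) where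

  -- `A` is the constant of the upper bound on ℓ. The others come from `approx-trans`: `c₀` composes
  -- `W≈G` with `total≈num`, and `c₁` composes `v≈ℓ` with `total≈num`.
  t A c₀ c₁ : ℕ
  t  = trailing m (height F) r
  A  = suc n ^ m
  c₀ = 2 * k + 2 * k + 2 * k * (2 * k)
  c₁ = 2 * r + 2 * k + 2 * r * (2 * k)

  module At {q : ℕ} (K : FiniteField q) {N : ℕ} (count : NumFdSpaces K F k (suc r) N)
            (2k≤q : 2 * k ≤ q) where
    open Spaces K F r k
    open Boards K n using (supported; length-supported)
    open LowRankCount K n using (lowRankCount-upper; lowRankCount-lower)

    -- The density is W / num, while G / total is the probability that a random tuple is good; I / D
    -- is the probability that a random tuple of coefficient vectors is independent.
    a v total D G I W num : ℕ
    a   = card F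
    v   = q ^ a
    total   = v ^ k
    D   = (q ^ k) ^ k
    G   = A.goodCount k
    I   = AC.goodCount k
    num = qbinNum q a k
    W   = N * qbinDen q a k

    q≥1 : 1 ≤ q
    q≥1 = ≤-trans (s≤s z≤n) (Field.two≤q K)

    instance
      q-nonZero : NonZero q
      q-nonZero = >-nonZero q≥1

    v≡ : R.v ≡ v
    v≡ = ≡.trans (length-supported (cell F) (λ _ → refl)) (cong (q ^_) (sym (card≡ F)))

    v≥1 : 1 ≤ v
    v≥1 = m^n>0 q a

    num≤total : num ≤ total
    num≤total = qbinNum-upper q a q≥1 k

    total≈num : Approx q (2 * k) total num
    total≈num = qbinNum-approx q a q≥1 k k≤card 2k≤q

    den≤D : qbinDen q a k ≤ D
    den≤D = qbinNum-upper q k q≥1 k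

    D≈den : Approx q (2 * k) D (qbinDen q a k)
    D≈den = qbinNum-approx q k q≥1 k ≤-refl 2k≤q

    L : ℕ
    L = length (normalised {K = K} k)

    -- The union bound for coefficient vectors, where zero is the only low vector.
    D≈I : Approx q (2 * k) D I
    D≈I = deficit⇒approx q k 2k≤q (*-cancelˡ-≤ (q ^ k) {{m^n≢0 q k}} (begin
      q ^ k * (q * D)                           ≡⟨ lem (q ^ k) q D ⟩
      q * (q ^ k * D)                           ≤⟨ *-monoʳ-≤ q bound ⟩
      q * (q ^ k * I + L * (D * 1))             ≡⟨ lem₂ q (q ^ k) I L D ⟩
      q ^ k * (q * I) + q * L * D               ≤⟨ +-monoʳ-≤ (q ^ k * (q * I)) (*-monoˡ-≤ D (length-normalised {K = K} k)) ⟩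
      q ^ k * (q * I) + k * q ^ k * D           ≡⟨ lem₃ (q ^ k) (q * I) k D ⟩
      q ^ k * (q * I + k * D)                   ∎))
      where
      open ≤-Reasoning
      lem : ∀ a b c → a * (b * c) ≡ b * (a * c)
      lem = ℕR.solve-∀
      lem₂ : ∀ q x I L D → q * (x * I + L * (D * 1)) ≡ x * (q * I) + q * L * D
      lem₂ = ℕR.solve-∀
      lem₃ : ∀ x y k D → x * y + k * x * D ≡ x * (y + k * D)
      lem₃ = ℕR.solve-∀
      one-zero : AC.ℓ ≤ 1
      one-zero = count≤1 {Q = λ y → y ≡ y} _ (coeffs {K = K} k) (All.tabulate (λ _ → refl)) (coeffs-unique {K = K} k)
        (λ _ _ e e′ → ≡.trans e (sym e′))
      bound : q ^ k * D ≤ q ^ k * I + L * (D * 1)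
      bound = subst (λ z → z * z ^ k ≤ z * I + L * (z ^ k * 1)) (length-coeffs {K = K} k)
        (≤-trans (AC.union-bound k) (+-monoʳ-≤ (RC.v * I) (*-monoʳ-≤ L (*-monoʳ-≤ (RC.v ^ k) one-zero))))

    W≈G : Approx q (2 * k) W G
    W≈G = ≤-trans (*-monoʳ-≤ q (*-monoʳ-≤ N den≤D))
      (≤-trans (approx-*ˡ q N D≈I) (*-monoʳ-≤ (q + 2 * k) (spaces-upper count)))

    G≤total : G ≤ total
    G≤total = ≤-trans (∑-mono (tuples (supported (cell F)) k) (λ b _ → ⟦⟧≤1 (A.Good? b)))
      (≤-reflexive (≡.trans (sym (length-∑ (tuples (supported (cell F)) k))) (≡.trans (length-tuples (supported (cell F)) k) (cong (_^ k) v≡))))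

    W≈num : Approx q c₀ W num
    W≈num = approx-trans q {2 * k} {2 * k} q≥1 W≈G (≤-trans (*-monoʳ-≤ q G≤total) total≈num)

    ℓ : ℕ
    ℓ = A.ℓ

    ℓ-upper : ℓ * q ^ t ≤ A * v
    ℓ-upper = subst (λ s → ℓ * q ^ t ≤ A * q ^ s) (sym (card≡ F))
      (lowRankCount-upper (cell F) (height F) (cell-closed F) (λ _ → refl) r)

    v≈ℓ : 2 * r ≤ q → Approx q (2 * r) v (ℓ * q ^ t)
    v≈ℓ 2r≤q = deficit⇒approx q r 2r≤q (*-cancelʳ-≤ _ _ (q ^ r) {{m^n≢0 q r}} (begin
      q * v * q ^ r                                ≡⟨ lem q v (q ^ r) ⟩
      q * q ^ r * v                                ≤⟨ *-monoˡ-≤ v (bernoulli q r q≥1) ⟩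
      (q * (q ∸ 1) ^ r + r * q ^ r) * v            ≡⟨ lem₂ q ((q ∸ 1) ^ r) (r * q ^ r) v ⟩
      q * ((q ∸ 1) ^ r * v) + r * q ^ r * v        ≤⟨ +-monoˡ-≤ (r * q ^ r * v) (*-monoʳ-≤ q lower) ⟩
      q * (ℓ * q ^ t * q ^ r) + r * q ^ r * v      ≡⟨ lem₃ q (ℓ * q ^ t) (q ^ r) r v ⟩
      (q * (ℓ * q ^ t) + r * v) * q ^ r            ∎))
      where
      open ≤-Reasoning
      lower : (q ∸ 1) ^ r * v ≤ ℓ * q ^ t * q ^ r
      lower = subst (λ s → (q ∸ 1) ^ r * q ^ s ≤ ℓ * q ^ t * q ^ r) (sym (card≡ F))
        (lowRankCount-lower (cell F) (height F) (cell-closed F) (λ _ → refl) r)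
      lem : ∀ q v x → q * v * x ≡ q * x * v
      lem = ℕR.solve-∀
      lem₂ : ∀ q a b v → (q * a + b) * v ≡ q * (a * v) + b * v
      lem₂ = ℕR.solve-∀
      lem₃ : ∀ q a x r v → q * (a * x) + r * x * v ≡ (q * a + r * v) * x
      lem₃ = ℕR.solve-∀

    -- The loss in the union bound is L ℓ / v ≤ k q^(k-1) A q^(-t), which is at most k A / q because
    -- k ≤ t.
    total≈G : k ≤ t → 2 * (k * A) ≤ q → Approx q (2 * (k * A)) total G
    total≈G k≤t le = deficit⇒approx q (k * A) le (*-cancelˡ-≤ (v * q ^ t) {{>-nonZero (*-mono-≤ v≥1 (m^n>0 q t))}} (begin
      v * q ^ t * (q * total)                          ≡⟨ lem v (q ^ t) q total ⟩
      q ^ t * (q * (v * total))                        ≤⟨ *-monoʳ-≤ (q ^ t) (*-monoʳ-≤ q bound) ⟩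
      q ^ t * (q * (v * G + L * (total * ℓ)))          ≡⟨ lem₂ (q ^ t) q v G L total ℓ ⟩
      v * q ^ t * (q * G) + q * L * (ℓ * q ^ t) * total  ≤⟨ +-monoʳ-≤ (v * q ^ t * (q * G)) (*-monoˡ-≤ total (*-mono-≤ few ℓ-upper)) ⟩
      v * q ^ t * (q * G) + k * q ^ t * (A * v) * total  ≡⟨ lem₃ v (q ^ t) (q * G) k A total ⟩
      v * q ^ t * (q * G + k * A * total)              ∎))
      where
      open ≤-Reasoning
      few : q * L ≤ k * q ^ t
      few = ≤-trans (length-normalised {K = K} k) (*-monoʳ-≤ k (^-monoʳ-≤ q k≤t))
      bound : v * total ≤ v * G + L * (total * ℓ)
      bound = subst (λ z → z * z ^ k ≤ z * G + L * (z ^ k * ℓ)) v≡ (A.union-bound k)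
      lem : ∀ v x q total → v * x * (q * total) ≡ x * (q * (v * total))
      lem = ℕR.solve-∀
      lem₂ : ∀ x q v G L total l → x * (q * (v * G + L * (total * l))) ≡ v * x * (q * G) + q * L * (l * x) * total
      lem₂ = ℕR.solve-∀
      lem₃ : ∀ v x y k A total → v * x * y + k * x * (A * v) * total ≡ v * x * (y + k * A * total)
      lem₃ = ℕR.solve-∀

    second-moment : G * (v + q ^ (k ∸ 1) * ℓ) ≤ total * v
    second-moment = go k refl
      where
      go : ∀ k₁ → k₁ ≡ k → G * (v + q ^ (k ∸ 1) * ℓ) ≤ total * v
      go zero     refl = contradiction k≥1 λ ()
      go (suc k₁) refl = subst₂ (λ z p → G * (z + p * ℓ) ≤ z ^ k * z) v≡ (length-coeffs {K = K} k₁)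
        (A.SecondMoment.second-moment-bound k₁)

    num≈W : k ≤ t → 2 * (k * A) ≤ q → Approx q (2 * (k * A) + 2 * k + 2 * (k * A) * (2 * k)) num W
    num≈W k≤t le = approx-trans q {2 * (k * A)} {2 * k} q≥1
      (≤-trans (*-monoʳ-≤ q num≤total) (≤-trans (total≈G k≤t le) (*-monoʳ-≤ (q + 2 * (k * A)) (spaces-lower count))))
      (approx-*ˡ q N D≈den)

    -- With k - 1 = t the expected number of hits is q^t ℓ / v ≥ 1 - O(1/q), so the second moment
    -- bound is close to 1/2 at most.
    2W≈num : k ≡ t + 1 → 2 * r ≤ q → Approx q (2 * k + c₁ + 2 * k * c₁) (2 * W) num
    2W≈num k≡ 2r≤q = approx-trans q {2 * k} {c₁} q≥1 (approx-*ˡ q 2 W≈G)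
      (approx-trans q {2 * r} {2 * k} q≥1 (approx-cancelʳ q {X = 2 * G} v v≥1 2Gv≈tv) total≈num)
      where
      open ≤-Reasoning
      lem : ∀ q g v → q * (2 * g * v) ≡ g * (q * v + q * v)
      lem = ℕR.solve-∀
      lem₂ : ∀ q c g v x → g * ((q + c) * v + (q + c) * x) ≡ (q + c) * (g * (v + x))
      lem₂ = ℕR.solve-∀
      t≡ : t ≡ k ∸ 1
      t≡ = sym (≡.trans (cong (_∸ 1) k≡) (m+n∸n≡m t 1))
      2Gv≈tv : Approx q (2 * r) (2 * G * v) (total * v)
      2Gv≈tv = begin
        q * (2 * G * v)                                     ≡⟨ lem q G v ⟩
        G * (q * v + q * v)                                 ≤⟨ *-monoʳ-≤ G (+-mono-≤ (*-monoˡ-≤ v (m≤m+n q (2 * r))) (v≈ℓ 2r≤q)) ⟩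
        G * ((q + 2 * r) * v + (q + 2 * r) * (ℓ * q ^ t))   ≡⟨ lem₂ q (2 * r) G v (ℓ * q ^ t) ⟩
        (q + 2 * r) * (G * (v + ℓ * q ^ t))                 ≡⟨ cong (λ x → (q + 2 * r) * (G * (v + x))) (≡.trans (*-comm ℓ _) (cong (λ s → q ^ s * ℓ) t≡)) ⟩
        (q + 2 * r) * (G * (v + q ^ (k ∸ 1) * ℓ))           ≤⟨ *-monoʳ-≤ (q + 2 * r) second-moment ⟩
        (q + 2 * r) * (total * v)                               ∎

    -- Now the expected number of hits is at least q^(t+1) ℓ / v, which is of order q or more, so
    -- the density is O(1/q).
    qW≈num : t + 2 ≤ k → 2 * r ≤ q → Approx q (2 * k + c₁ + 2 * k * c₁) (q * W) num
    qW≈num t+2≤k 2r≤q = approx-trans q {2 * k} {c₁} q≥1 (approx-*ˡ q q W≈G)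
      (approx-trans q {2 * r} {2 * k} q≥1 (approx-cancelʳ q {X = q * G} v v≥1 qGv≈tv) total≈num)
      where
      open ≤-Reasoning
      lem : ∀ q g v → q * (q * g * v) ≡ q * g * (q * v)
      lem = ℕR.solve-∀
      lem₂ : ∀ q g c l x → q * g * (c * (l * x)) ≡ c * (g * (q * x * l))
      lem₂ = ℕR.solve-∀
      t<k-1 : suc t ≤ k ∸ 1
      t<k-1 = ≤-trans (≤-reflexive (≡.trans (+-comm 1 t) (sym (+-∸-assoc t {2} {1} (s≤s z≤n))))) (∸-monoˡ-≤ 1 t+2≤k)
      qGv≈tv : Approx q (2 * r) (q * G * v) (total * v)
      qGv≈tv = begin
        q * (q * G * v)                              ≡⟨ lem q G v ⟩
        q * G * (q * v)                              ≤⟨ *-monoʳ-≤ (q * G) (v≈ℓ 2r≤q) ⟩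
        q * G * ((q + 2 * r) * (ℓ * q ^ t))          ≡⟨ lem₂ q G (q + 2 * r) ℓ (q ^ t) ⟩
        (q + 2 * r) * (G * (q ^ suc t * ℓ))          ≤⟨ *-monoʳ-≤ (q + 2 * r) (*-monoʳ-≤ G (≤-trans (*-monoˡ-≤ ℓ (^-monoʳ-≤ q t<k-1)) (m≤n+m _ v))) ⟩
        (q + 2 * r) * (G * (v + q ^ (k ∸ 1) * ℓ))    ≤⟨ *-monoʳ-≤ (q + 2 * r) second-moment ⟩
        (q + 2 * r) * (total * v)                        ∎

-- From relative errors of order 1/q to the three limits

∣-∣-approx : ∀ q {c X Y e₁ e₂} → 1 ≤ q → 1 ≤ e₁ → c * e₂ ≤ q → Approx q c X Y → Approx q c Y X → ∣ X - Y ∣ * e₂ ≤ e₁ * Y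
∣-∣-approx q {c} {X} {Y} {e₁} {e₂} q≥1 e₁≥1 big xy yx = *-cancelˡ-≤ q {{>-nonZero q≥1}} (begin
  q * (∣ X - Y ∣ * e₂)   ≡⟨ *-assoc q _ e₂ ⟨
  q * ∣ X - Y ∣ * e₂     ≤⟨ *-monoˡ-≤ e₂ (gap (≤-total X Y)) ⟩
  c * Y * e₂             ≡⟨ lem c Y e₂ ⟩
  c * e₂ * Y             ≤⟨ *-mono-≤ big (m≤n*m Y e₁ {{>-nonZero e₁≥1}}) ⟩
  q * (e₁ * Y)           ∎)
  where
  open ≤-Reasoning
  open import Data.Sum using (_⊎_)
  lem : ∀ c y e → c * y * e ≡ c * e * y
  lem = ℕR.solve-∀
  excess : ∀ {X Y} → X ≤ Y → Approx q c Y X → q * (Y ∸ X) ≤ c * X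
  excess {X} {Y} le a = ≤-trans (≤-reflexive (*-distribˡ-∸ q Y X)) (≤-trans (∸-monoˡ-≤ (q * X) a)
    (≤-reflexive (≡.trans (cong (_∸ q * X) (*-distribʳ-+ X q c)) (m+n∸m≡n (q * X) (c * X)))))
  gap : X ≤ Y ⊎ Y ≤ X → q * ∣ X - Y ∣ ≤ c * Y
  gap (inj₁ le) = ≤-trans (≤-reflexive (cong (q *_) (m≤n⇒∣m-n∣≡n∸m le))) (≤-trans (excess le yx) (*-monoʳ-≤ c le))
  gap (inj₂ le) = ≤-trans (≤-reflexive (cong (q *_) (m≤n⇒∣n-m∣≡n∸m le))) (excess le xy)

module _ {n m : ℕ} (F : Ferrers n m) (r k : ℕ) (k≥1 : 1 ≤ k) (k≤card : k ≤ card F) where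
  open Density F r k k≥1 k≤card

  dense : k ≤ t → EventuallyDensity F k (suc r) DensityNear1
  dense k≤t e₁ e₂ e₁≥1 _ = Q , λ q Q≤q K N count →
    let 2k≤q  = ≤-trans (≤-trans (m≤m+n (2 * k) x) (m≤m+n _ (c * e₂))) Q≤q
        x≤q   = ≤-trans (≤-trans (m≤n+m x (2 * k)) (m≤m+n _ (c * e₂))) Q≤q
        ce₂≤q = ≤-trans (m≤n+m (c * e₂) (2 * k + x)) Q≤q
        module M = At K count 2k≤q
    in ∣-∣-approx q {c} M.q≥1 e₁≥1 ce₂≤q (approx-weaken q (m≤m+n c₀ c₂) M.W≈num)
         (approx-weaken q (m≤n+m c₂ c₀) (M.num≈W k≤t x≤q))
    where
    x = 2 * (k * A)
    c₂ = x + 2 * k + x * (2 * k)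
    c = c₀ + c₂
    -- A sum of thresholds, so that q ≥ Q implies each of them.
    Q = 2 * k + x + c * e₂

  private
    c₃ : ℕ
    c₃ = 2 * k + c₁ + 2 * k * c₁

  sparse : t + 2 ≤ k → EventuallyDensity F k (suc r) DensityAtMost
  sparse t+2≤k e₁ e₂ e₁≥1 _ = Q , λ q Q≤q K N count →
    let 2k≤q  = ≤-trans (≤-trans (≤-trans (m≤m+n (2 * k) (2 * r)) (m≤m+n _ c₃)) (m≤m+n _ (2 * e₂))) Q≤q
        2r≤q  = ≤-trans (≤-trans (≤-trans (m≤n+m (2 * r) (2 * k)) (m≤m+n _ c₃)) (m≤m+n _ (2 * e₂))) Q≤q
        c₃≤q  = ≤-trans (≤-trans (m≤n+m c₃ (2 * k + 2 * r)) (m≤m+n _ (2 * e₂))) Q≤q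
        2e₂≤q = ≤-trans (m≤n+m (2 * e₂) (2 * k + 2 * r + c₃)) Q≤q
        module M = At K count 2k≤q
    in finish q (N * qbinDen q (card F) k) (qbinNum q (card F) k) M.q≥1 c₃≤q 2e₂≤q (M.qW≈num t+2≤k 2r≤q)
    where
    -- From c₃ ≤ q the density is at most 2 / q, and 2 e₂ ≤ q brings this below 1 / e₂.
    Q = 2 * k + 2 * r + c₃ + 2 * e₂
    finish : ∀ q W num → 1 ≤ q → c₃ ≤ q → 2 * e₂ ≤ q → Approx q c₃ (q * W) num → W * e₂ ≤ e₁ * num
    finish q W num q≥1 c₃≤q 2e₂≤q h = *-cancelˡ-≤ (q * q) {{>-nonZero (*-mono-≤ q≥1 q≥1)}} (begin
      q * q * (W * e₂)             ≡⟨ lem q W e₂ ⟩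
      q * (q * W) * e₂             ≤⟨ *-monoˡ-≤ e₂ h ⟩
      (q + c₃) * num * e₂          ≤⟨ *-monoˡ-≤ e₂ (*-monoˡ-≤ num (+-monoʳ-≤ q c₃≤q)) ⟩
      (q + q) * num * e₂           ≡⟨ lem₂ q num e₂ ⟩
      q * (2 * e₂) * num           ≤⟨ *-mono-≤ (*-monoʳ-≤ q 2e₂≤q) (m≤n*m num e₁ {{>-nonZero e₁≥1}}) ⟩
      q * q * (e₁ * num)           ∎)
      where
      open ≤-Reasoning
      lem : ∀ q w e → q * q * (w * e) ≡ q * (q * w) * e
      lem = ℕR.solve-∀
      lem₂ : ∀ q x e → (q + q) * x * e ≡ q * (2 * e) * x
      lem₂ = ℕR.solve-∀

  critical : k ≡ t + 1 → EventuallyDensity F k (suc r) DensityAtMostHalfPlus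
  critical k≡ e₁ e₂ e₁≥1 _ = Q , λ q Q≤q K N count →
    let 2k≤q  = ≤-trans (≤-trans (m≤m+n (2 * k) (2 * r)) (m≤m+n _ (c₃ * e₂))) Q≤q
        2r≤q  = ≤-trans (≤-trans (m≤n+m (2 * r) (2 * k)) (m≤m+n _ (c₃ * e₂))) Q≤q
        ce₂≤q = ≤-trans (m≤n+m (c₃ * e₂) (2 * k + 2 * r)) Q≤q
        module M = At K count 2k≤q
    in finish q (N * qbinDen q (card F) k) (qbinNum q (card F) k) M.q≥1 ce₂≤q (M.2W≈num k≡ 2r≤q)
    where
    -- Twice the density is at most 1 + c₃ / q, and c₃ / q ≤ 1 / e₂ is within the allowed excess 2
    -- e₁ / e₂.
    Q = 2 * k + 2 * r + c₃ * e₂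
    finish : ∀ q W num → 1 ≤ q → c₃ * e₂ ≤ q → Approx q c₃ (2 * W) num → 2 * e₂ * W ≤ (e₂ + 2 * e₁) * num
    finish q W num q≥1 ce₂≤q h = *-cancelˡ-≤ q {{>-nonZero q≥1}} (begin
      q * (2 * e₂ * W)               ≡⟨ lem q e₂ W ⟩
      q * (2 * W) * e₂               ≤⟨ *-monoˡ-≤ e₂ h ⟩
      (q + c₃) * num * e₂            ≡⟨ lem₂ q c₃ num e₂ ⟩
      (q * e₂ + c₃ * e₂) * num       ≤⟨ *-monoˡ-≤ num (+-monoʳ-≤ (q * e₂) (≤-trans ce₂≤q (m≤m*n q (2 * e₁) {{>-nonZero (≤-trans e₁≥1 (m≤n*m e₁ 2))}}))) ⟩
      (q * e₂ + q * (2 * e₁)) * num  ≡⟨ lem₃ q e₂ e₁ num ⟩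
      q * ((e₂ + 2 * e₁) * num)      ∎)
      where
      open ≤-Reasoning
      lem : ∀ q e w → q * (2 * e * w) ≡ q * (2 * w) * e
      lem = ℕR.solve-∀
      lem₂ : ∀ q c x e → (q + c) * x * e ≡ (q * e + c * e) * x
      lem₂ = ℕR.solve-∀
      lem₃ : ∀ q e f x → (q * e + q * (2 * f)) * x ≡ q * ((e + 2 * f) * x)
      lem₃ = ℕR.solve-∀

theorem3p6 : ∀ (n m : ℕ) (F : Ferrers n m) (d k : ℕ) →
    2 ≤ d → d ≤ n → 1 ≤ k → k ≤ card F → 1 ≤ kappa F d →
    Σ ℕ λ t → IsTrailingDegree F (d ∸ 1) t
    × (k ≤ t → EventuallyDensity F k d DensityNear1)
    × (t + 2 ≤ k → EventuallyDensity F k d DensityAtMost)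
    × (k ≡ t + 1 → EventuallyDensity F k d DensityAtMostHalfPlus)
theorem3p6 n m F (suc r) k 2≤d d≤n 1≤k k≤card 1≤κ =
  trailing m (height F) r ,
  -- κ(F,d) ≥ 1 provides room for d = r + 1 rooks, while the trailing degree concerns r of them.
  trailing-isTrailingDegree F r (≤-trans (n≤1+n r) (proj₁ acc) , λ j → ≤-trans (n≤1+n _) (proj₂ acc j)) ,
  dense F r k 1≤k k≤card , sparse F r k 1≤k k≤card , critical F r k 1≤k k≤card
  where
  acc = kappa-accommodates F (suc r) 1≤κ
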